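{- In $\mathbb{Z}[t][[u]]$, \[ \sum_{n=0}^\infty Z_{F_n}(t) u^{n}=\frac{2}{\sqrt{(1-(t+1) u)^2-4 t u^2}-(t+1) u+1}, \] where the square root is the power series in $u$ with constant term $1$.
   Context: For a matroid $M$ let $L(M)$ be its lattice of flats, $\mathrm{rk}\, M$ its rank, $\chi_M(t)$ its characteristic polynomial; for a flat $F$, $M_F$ is the localization (restriction to $F$) and $M^F$ the contraction at $F$. The Kazhdan–Lusztig polynomial is the unique assignment of $P_M(t)\in\mathbb{Z}[t]$ to each loopless matroid $M$ with: $P_M=1$ if $\mathrm{rk}\, M=0$; $\deg P_M<\frac12\mathrm{rk}\, M$ if $\mathrm{rk}\, M>0$; $t^{\mathrm{rk}\, M}P_M(t^{ -1})=\sum_{F\in L(M)}\chi_{M_F}(t)P_{M^F}(t)$. The $Z$-polynomial is $Z_M(t)=\sum_{F\in L(M)}t^{\mathrm{rk}\, M_F}P_{M^F}(t)$; for a graph $G$, $Z_G=Z_{M(G)}$ for its graphic matroid. The fan graph $F_n$ ($n\ge1$) has vertices $0,1,\dots,n$, edges $\{i,i+1\}$ ($1\le i<n$) and $\{0,i\}$ ($1\le i\le n$); $F_0$ is the single-vertex graph (so $Z_{F_0}=1$). -}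

module Defs where

open import Data.Bool using (Bool; true; false; _∧_; _∨_; not; if_then_else_)
open import Data.Nat as ℕ using (ℕ; zero; suc; _∸_; _≡ᵇ_; ⌊_/2⌋)
open import Data.Integer as ℤ using (ℤ; +_; -_)
open import Data.Fin using (Fin; zero; suc)
open import Data.Fin.Subset using (Subset; ⊤; ⊥; ⁅_⁆; ∁; _∩_; _∪_; ∣_∣)
open import Data.List as L using (List; []; _∷_; _++_; map; foldr; allFin; upTo; length; filter; take; replicate; concatMap)
open import Data.Vec as V using (Vec; []; _∷_; lookup)
open import Data.Product using (_×_; _,_; proj₁; proj₂)
open import Relation.Binary.PropositionalEquality using (_≡_)
open import Relation.Nullary.Decidable using (does)

-- Polynomials in ℤ[t], as coefficient lists (constant term first).
-- Two lists represent the same polynomial iff all coefficients agree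
-- (trailing zeros are irrelevant); see _≈P_.

Poly : Set
Poly = List ℤ

coeff : Poly → ℕ → ℤ
coeff []       _       = + 0
coeff (a ∷ _)  zero    = a
coeff (_ ∷ p)  (suc k) = coeff p k

infix 4 _≈P_
_≈P_ : Poly → Poly → Set
p ≈P q = ∀ k → coeff p k ≡ coeff q k

infixl 6 _+P_
infixl 7 _*P_

_+P_ : Poly → Poly → Poly
[]      +P q       = q
(a ∷ p) +P []      = a ∷ p
(a ∷ p) +P (b ∷ q) = (a ℤ.+ b) ∷ (p +P q)

negP : Poly → Poly
negP = map -_

_*P_ : Poly → Poly → Poly
[]      *P q = []
(a ∷ p) *P q = map (a ℤ.*_) q +P (+ 0 ∷ (p *P q))

zeroP : Poly
zeroP = []

oneP : Poly
oneP = + 1 ∷ []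

constP : ℤ → Poly
constP a = a ∷ []

tPow : ℕ → Poly
tPow k = replicate k (+ 0) ++ (+ 1 ∷ [])

tP : Poly
tP = tPow 1

sumP : List Poly → Poly
sumP = foldr _+P_ zeroP

truncP : ℕ → Poly → Poly
truncP = take

allSubsets : (m : ℕ) → List (Subset m)
allSubsets zero    = [] ∷ []
allSubsets (suc m) = map (false ∷_) (allSubsets m) ++ map (true ∷_) (allSubsets m)

allB : {A : Set} → (A → Bool) → List A → Bool
allB p = foldr (λ x b → p x ∧ b) true

filterB : {A : Set} → (A → Bool) → List A → List A
filterB p = foldr (λ x xs → if p x then x ∷ xs else xs) []

anyB : {A : Set} → (A → Bool) → List A → Bool
anyB p = foldr (λ x b → p x ∨ b) false

_∈ᵇ_ : {m : ℕ} → Fin m → Subset m → Bool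
e ∈ᵇ S = lookup S e

_⊆ᵇ_ : {m : ℕ} → Subset m → Subset m → Bool
_⊆ᵇ_ {m} S T = allB (λ e → not (e ∈ᵇ S) ∨ (e ∈ᵇ T)) (allFin m)

-- Matroids, given by a rank function. A matroid has ground set
-- `ground ⊆ Fin carrier`; only subsets of `ground` are meaningful.
-- (Ground sets as subsets of a fixed Fin m let us form contractions and
-- restrictions without re-indexing.)

record Matroid : Set where
  field
    carrier : ℕ
    ground  : Subset carrier
    rk      : Subset carrier → ℕ
open Matroid public

rankM : Matroid → ℕ
rankM M = rk M (ground M)

subsetsOf : (M : Matroid) → List (Subset (carrier M))
subsetsOf M = filterB (λ S → S ⊆ᵇ ground M) (allSubsets (carrier M))

isFlatᵇ : (M : Matroid) → Subset (carrier M) → Bool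
isFlatᵇ M F =
  (F ⊆ᵇ ground M) ∧
  allB (λ e → not (e ∈ᵇ ground M) ∨ (e ∈ᵇ F) ∨ not (rk M (F ∪ ⁅ e ⁆) ≡ᵇ rk M F))
       (allFin (carrier M))

flats : (M : Matroid) → List (Subset (carrier M))
flats M = filterB (isFlatᵇ M) (allSubsets (carrier M))

loc : (M : Matroid) → Subset (carrier M) → Matroid
loc M F = record { carrier = carrier M ; ground = F ; rk = rk M }

con : (M : Matroid) → Subset (carrier M) → Matroid
con M F = record { carrier = carrier M ; ground = ground M ∩ ∁ F
                 ; rk = λ S → rk M (S ∪ F) ∸ rk M F }

signPow : ℕ → ℤ
signPow zero    = + 1
signPow (suc k) = - signPow k

charPoly : Matroid → Poly
charPoly M = sumP (map (λ S → map (signPow ∣ S ∣ ℤ.*_) (tPow (rankM M ∸ rk M S)))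
                       (subsetsOf M))

-- Kazhdan–Lusztig polynomial. The defining identity
--   t^r P_M(t⁻¹) = Σ_F χ_{M_F}(t) P_{M^F}(t)
-- has F = ∅ term P_M(t) (M loopless, so cl ∅ = ∅); since deg P_M < r/2,
-- P_M = −(terms of degree < r/2 of Σ_{F ≠ ∅} χ_{M_F} P_{M^F}).
-- The recursion is on a fuel bound ≥ rank (rk M^F < rk M for F ≠ ∅).
nonemptyFlats : (M : Matroid) → List (Subset (carrier M))
nonemptyFlats M = filterB (λ F → not (∣ F ∣ ≡ᵇ 0)) (flats M)

KL′ : ℕ → Matroid → Poly
KL′ zero    M = oneP
KL′ (suc k) M with rankM M
... | zero  = oneP
... | suc r = negP (truncP ⌊ suc (suc r) /2⌋
                  (sumP (map (λ F → charPoly (loc M F) *P KL′ k (con M F))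
                             (nonemptyFlats M))))

KL : Matroid → Poly
KL M = KL′ (rankM M) M

Zpoly : Matroid → Poly
Zpoly M = sumP (map (λ F → tPow (rk M F) *P KL (con M F)) (flats M))

-- Graphs and graphic matroids.
-- A finite (multi)graph with vertices 0..V-1 and edges Fin m.

record Graph : Set where
  field
    V     : ℕ
    m     : ℕ
    ends  : Fin m → ℕ × ℕ
open Graph public

-- number of connected components of the spanning subgraph (vertices 0..V-1,
-- edges S): each vertex repeatedly takes the minimum label of itself and its
-- S-neighbours; after V rounds every vertex carries the least vertex of its
-- component, and components are counted by their least vertices.
private
  nbrLabels : (G : Graph) → Subset (m G) → (ℕ → ℕ) → ℕ → List ℕ
  nbrLabels G S lab x =
    concatMap (λ e → if e ∈ᵇ S
                     then ((if proj₁ (ends G e) ≡ᵇ x then lab (proj₂ (ends G e)) ∷ [] else [])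
                        ++ (if proj₂ (ends G e) ≡ᵇ x then lab (proj₁ (ends G e)) ∷ [] else []))
                     else [])
              (allFin (m G))

  step : (G : Graph) → Subset (m G) → (ℕ → ℕ) → ℕ → ℕ
  step G S lab x = foldr ℕ._⊓_ (lab x) (nbrLabels G S lab x)

  iter : ℕ → (G : Graph) → Subset (m G) → (ℕ → ℕ) → ℕ → ℕ
  iter zero    G S lab = lab
  iter (suc k) G S lab = iter k G S (step G S lab)

components : (G : Graph) → Subset (m G) → ℕ
components G S = length (filterB (λ x → lab x ≡ᵇ x) (upTo (V G)))
  where lab = iter (V G) G S (λ x → x)

graphic : Graph → Matroid
graphic G = record { carrier = m G ; ground = ⊤ ; rk = λ S → V G ∸ components G S }

ZG : Graph → Poly
ZG G = Zpoly (graphic G)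

-- Fan graph F_n: vertices 0..n; edges {i,i+1} (1 ≤ i < n) and {0,i} (1 ≤ i ≤ n).
-- For n = 0 this is the single-vertex graph F_0.
fanEdges : ℕ → List (ℕ × ℕ)
fanEdges n = map (λ i → (suc i , suc (suc i))) (upTo (n ∸ 1))
          ++ map (λ i → (0 , suc i)) (upTo n)

fan : ℕ → Graph
fan n = record { V = suc n ; m = length (fanEdges n)
               ; ends = λ e → L.lookup (fanEdges n) e }

Series : Set
Series = ℕ → Poly

infix 4 _≈S_
_≈S_ : Series → Series → Set
A ≈S B = ∀ n → A n ≈P B n

infixl 6 _+S_ _-S_
infixl 7 _*S_

_+S_ : Series → Series → Series
(A +S B) n = A n +P B n

_-S_ : Series → Series → Series
(A -S B) n = A n +P negP (B n)

_*S_ : Series → Series → Series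
(A *S B) n = sumP (map (λ i → A i *P B (n ∸ i)) (upTo (suc n)))

constS : Poly → Series
constS p zero    = p
constS p (suc _) = zeroP

uS : Series
uS (suc zero) = oneP
uS _          = zeroP

ZfanGF : Series
ZfanGF n = ZG (fan n)

discS : Series
discS = (constS oneP -S constS (tP +P oneP) *S uS) *S (constS oneP -S constS (tP +P oneP) *S uS)
        -S constS (constP (+ 4) *P tP) *S uS *S uS

{-# OPTIONS --safe #-}
module Submission where

-- Deleting the hub from a flat F of the fan leaves maximal runs of path vertices, and M^F is, up
-- to parallel edges, the direct sum of one fan F_m for each run falling into m parts. The product
-- of weighted Motzkin path counts p_m over these runs is the candidate for P_{M^F}. By Möbius
-- inversion it satisfies the KL recursion as soon as, for every set S of edges, the sum over flats
-- F ⊇ S of t^(rk F − rk S) P_{M^F}(t) equals that of t^(rk M^F) P_{M^F}(t⁻¹). Both are the same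
-- sum with weights (a , b) = (1 , t) and (t , 1). Joining path vertices adds b to the transfer
-- operator of the Motzkin paths, so that the sum is a product of numbers Z_m of Motzkin paths
-- with level weight a + b and up-down weight a b, which is symmetric in a and b. For S empty it
-- is Z_{F_n}, and the first-passage decomposition gives Z = 1 + (t + 1) u Z + t u² Z².

open import Defs
open import Algebra.Bundles using (CommutativeRing)
open import Data.Bool as Bool using (Bool; true; false; _∧_; _∨_; not; if_then_else_)
open import Data.Bool.Properties using (∨-identityʳ; ∨-zeroʳ; ∧-assoc; ∧-zeroʳ; not-involutive)
open import Data.Empty using (⊥-elim)
open import Data.Fin using (Fin; zero; suc; toℕ; _↑ˡ_; _↑ʳ_; splitAt)
open import Data.Fin.Properties using (splitAt⁻¹-↑ˡ; splitAt⁻¹-↑ʳ; toℕ-↑ˡ; toℕ-↑ʳ; toℕ<n)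
open import Data.Fin.Subset using (Subset; ⊤; ⊥; ⁅_⁆; ∁; _∩_; _∪_; ∣_∣)
open import Data.Fin.Subset.Properties using (∪-assoc; ∪-comm; ∪-identityˡ; ∪-identityʳ; p∪∁p≡⊤; ∩-identityˡ; ∪-zeroʳ)
import Data.Integer as ℤ
open import Data.Integer using (ℤ; +_)
import Data.Integer.Properties as ℤ
import Algebra.Properties.Ring ℤ.+-*-ring as ℤRing
open import Data.List as List using (List; []; _∷_; map; foldr; allFin; upTo; applyUpTo; concatMap; length; replicate; tabulate)
open import Data.List.Membership.Propositional using (_∈_)
open import Data.List.Membership.Propositional.Properties using (∈-allFin; ∈-concatMap⁺; ∈-concatMap⁻; ∈-++⁺ʳ; ∈-++⁻)
open import Data.List.Properties using (length-++; length-map; length-upTo; map-upTo; ++-identityʳ)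
open import Data.List.Relation.Unary.Any as Any using (here; there; satisfied)
open import Data.Maybe using (Maybe; just; nothing)
open import Data.Maybe.Properties using (just-injective)
open import Data.Nat as ℕ using (ℕ; zero; suc; _≤_; _<_; z≤n; s≤s; _∸_; _⊓_; ⌊_/2⌋; ⌈_/2⌉)
import Data.Nat.Properties as ℕ
open import Data.Nat.Solver using (module +-*-Solver)
open import Data.Product using (Σ-syntax; _×_; _,_; proj₁; proj₂; ∃; ∃₂)
open import Data.Sum using (_⊎_; inj₁; inj₂)
open import Data.Vec as Vec using (Vec; []; _∷_; lookup; _++_)
open import Data.Vec.Properties using (lookup-++ˡ; lookup-++ʳ; lookup-zipWith; lookup-map; lookup-replicate)
open import Function using (_∘_; id)
open import Level using (0ℓ)
open import Relation.Nullary using (yes; no)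
import Relation.Binary.PropositionalEquality as ≡
open ≡ using (_≡_; _≢_)

-- The KL recursion concerns P of all contractions M^A and of their contractions in turn. All of
-- these are indexed by edge sets of the one fan, so that no isomorphism of matroids, no removal of
-- parallel edges and no direct sum has to be formalised. The characteristic polynomials are signed
-- sums over arbitrary S, not only over flats, which is why words of blocks describe every edge set.
-- The reversed polynomial is not computed from P: it has its own formula q, obtained by exchanging
-- the two weights, and enters through the balanced sums and the vanishing of its low coefficients.
-- Polynomials are read as coefficient functions in ℤ[[t]], a commutative ring under pointwise
-- equality, where trailing zeros disappear and degree bounds become vanishing statements. The fan
-- is chordal, so that its flats are recognised triangle by triangle. In the generating function the
-- denominator has constant term 2, not a unit of ℤ[t]; hence the quotient is expressed by
-- multiplying out, and uniqueness of the square root rests on 2 being regular.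

Ring : Set₁
Ring = CommutativeRing 0ℓ 0ℓ

-- Convolution and rings of power series

module Convolution (R : Ring) where
  open CommutativeRing R
  open import Relation.Binary.Reasoning.Setoid setoid
  open import Algebra.Solver.Ring.NaturalCoefficients.Default commutativeSemiring using (solve; _:=_; _:+_; _:*_)

  conv : ℕ → (ℕ → Carrier) → (ℕ → Carrier) → Carrier
  conv zero    f g = f 0 * g 0
  conv (suc n) f g = f 0 * g (suc n) + conv n (f ∘ suc) g

  -- The bounds on the indices allow an induction hypothesis known only for smaller lengths to be
  -- used under a convolution, as in `first-passage`.
  conv-cong-≤ : ∀ n {f f′ g g′} → (∀ i → i ≤ n → f i ≈ f′ i) → (∀ i → i ≤ n → g i ≈ g′ i) →
                conv n f g ≈ conv n f′ g′
  conv-cong-≤ zero    f≈ g≈ = *-cong (f≈ 0 z≤n) (g≈ 0 z≤n)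
  conv-cong-≤ (suc n) f≈ g≈ =
    +-cong (*-cong (f≈ 0 z≤n) (g≈ (suc n) ℕ.≤-refl))
           (conv-cong-≤ n (λ i i≤n → f≈ (suc i) (s≤s i≤n)) (λ i i≤n → g≈ i (ℕ.m≤n⇒m≤1+n i≤n)))

  conv-cong : ∀ n {f f′ g g′} → (∀ i → f i ≈ f′ i) → (∀ i → g i ≈ g′ i) → conv n f g ≈ conv n f′ g′
  conv-cong n f≈ g≈ = conv-cong-≤ n (λ i _ → f≈ i) (λ i _ → g≈ i)

  conv-vanish : ∀ n {f g} → (∀ i j → i ℕ.+ j ≡ n → f i ≈ 0# ⊎ g j ≈ 0#) → conv n f g ≈ 0#
  conv-vanish n {f} {g} v = go n v
    where
    annihilate : ∀ {x y} → x ≈ 0# ⊎ y ≈ 0# → x * y ≈ 0#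
    annihilate (inj₁ x≈0) = trans (*-congʳ x≈0) (zeroˡ _)
    annihilate (inj₂ y≈0) = trans (*-congˡ y≈0) (zeroʳ _)

    go : ∀ n {f} → (∀ i j → i ℕ.+ j ≡ n → f i ≈ 0# ⊎ g j ≈ 0#) → conv n f g ≈ 0#
    go zero    v = annihilate (v 0 0 ≡.refl)
    go (suc n) v = trans (+-cong (annihilate (v 0 (suc n) ≡.refl))
                                 (go n (λ i j e → v (suc i) j (≡.cong suc e))))
                         (+-identityˡ 0#)

  conv-zeroˡ : ∀ n g → conv n (λ _ → 0#) g ≈ 0#
  conv-zeroˡ n g = conv-vanish n (λ _ _ _ → inj₁ refl)

  conv-snoc : ∀ n f g → conv (suc n) f g ≈ conv n f (g ∘ suc) + f (suc n) * g 0
  conv-snoc zero    f g = refl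
  conv-snoc (suc n) f g = begin
    f 0 * g (2 ℕ.+ n) + conv (suc n) (f ∘ suc) g
      ≈⟨ +-congˡ (conv-snoc n (f ∘ suc) g) ⟩
    f 0 * g (2 ℕ.+ n) + (conv n (f ∘ suc) (g ∘ suc) + f (2 ℕ.+ n) * g 0)
      ≈⟨ sym (+-assoc _ _ _) ⟩
    conv (suc n) f (g ∘ suc) + f (2 ℕ.+ n) * g 0 ∎

  conv-comm : ∀ n f g → conv n f g ≈ conv n g f
  conv-comm zero    f g = *-comm _ _
  conv-comm (suc n) f g = begin
    f 0 * g (suc n) + conv n (f ∘ suc) g  ≈⟨ +-cong (*-comm _ _) (conv-comm n _ _) ⟩
    g (suc n) * f 0 + conv n g (f ∘ suc)  ≈⟨ +-comm _ _ ⟩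
    conv n g (f ∘ suc) + g (suc n) * f 0  ≈⟨ sym (conv-snoc n g f) ⟩
    conv (suc n) g f                      ∎

  conv-distribʳ : ∀ n h f g → conv n (λ i → f i + g i) h ≈ conv n f h + conv n g h
  conv-distribʳ zero    h f g = distribʳ _ _ _
  conv-distribʳ (suc n) h f g = trans (+-congˡ (conv-distribʳ n h (f ∘ suc) (g ∘ suc)))
    (solve 5 (λ x y z p q → (x :+ y) :* z :+ (p :+ q) := (x :* z :+ p) :+ (y :* z :+ q)) refl
       (f 0) (g 0) (h (suc n)) _ _)

  conv-scaleˡ : ∀ n c f g → conv n (λ i → c * f i) g ≈ c * conv n f g
  conv-scaleˡ zero    c f g = *-assoc _ _ _
  conv-scaleˡ (suc n) c f g = trans (+-cong (*-assoc _ _ _) (conv-scaleˡ n c (f ∘ suc) g)) (sym (distribˡ _ _ _))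

  conv-assoc : ∀ n f g h → conv n (λ i → conv i f g) h ≈ conv n f (λ i → conv i g h)
  conv-assoc zero    f g h = *-assoc _ _ _
  conv-assoc (suc n) f g h = begin
    f 0 * g 0 * h (suc n) + conv n (λ i → f 0 * g (suc i) + conv i (f ∘ suc) g) h
      ≈⟨ +-congˡ (conv-distribʳ n h _ _) ⟩
    f 0 * g 0 * h (suc n) + (conv n (λ i → f 0 * g (suc i)) h + conv n (λ i → conv i (f ∘ suc) g) h)
      ≈⟨ +-congˡ (+-cong (conv-scaleˡ n (f 0) (g ∘ suc) h) (conv-assoc n (f ∘ suc) g h)) ⟩
    f 0 * g 0 * h (suc n) + (f 0 * conv n (g ∘ suc) h + conv n (f ∘ suc) (λ i → conv i g h))
      ≈⟨ solve 5 (λ x y z p q → x :* y :* z :+ (x :* p :+ q) := x :* (y :* z :+ p) :+ q) refl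
           (f 0) (g 0) (h (suc n)) _ _ ⟩
    f 0 * conv (suc n) g h + conv n (f ∘ suc) (λ i → conv i g h) ∎

  const : Carrier → ℕ → Carrier
  const c zero    = c
  const c (suc _) = 0#

  conv-constˡ : ∀ n c g → conv n (const c) g ≈ c * g n
  conv-constˡ zero    c g = refl
  conv-constˡ (suc n) c g = trans (+-congˡ (conv-zeroˡ n g)) (+-identityʳ _)

powerSeries : Ring → Ring
powerSeries R = record
  { Carrier = ℕ → Carrier
  ; _≈_ = λ f g → ∀ n → f n ≈ g n
  ; _+_ = λ f g n → f n + g n
  ; _*_ = λ f g n → conv n f g
  ; -_ = λ f n → - f n
  ; 0# = λ _ → 0#
  ; 1# = const 1#
  ; isCommutativeRing = record
    { isRing = record
      { +-isAbelianGroup = record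
        { isGroup = record
          { isMonoid = record
            { isSemigroup = record
              { isMagma = record
                { isEquivalence = record
                  { refl = λ _ → refl ; sym = λ e n → sym (e n) ; trans = λ e e′ n → trans (e n) (e′ n) }
                ; ∙-cong = λ e e′ n → +-cong (e n) (e′ n) }
              ; assoc = λ f g h n → +-assoc (f n) (g n) (h n) }
            ; identity = (λ f n → +-identityˡ (f n)) , (λ f n → +-identityʳ (f n)) }
          ; inverse = (λ f n → -‿inverseˡ (f n)) , (λ f n → -‿inverseʳ (f n))
          ; ⁻¹-cong = λ e n → -‿cong (e n) }
        ; comm = λ f g n → +-comm (f n) (g n) }
      ; *-cong = λ e e′ n → conv-cong n e e′
      ; *-assoc = λ f g h n → conv-assoc n f g h
      ; *-identity = idˡ , (λ f n → trans (conv-comm n f (const 1#)) (idˡ f n))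
      ; distrib = (λ f g h n → trans (conv-comm n f (λ i → g i + h i))
                                 (trans (conv-distribʳ n f g h) (+-cong (conv-comm n g f) (conv-comm n h f))))
                , (λ f g h n → conv-distribʳ n f g h) }
    ; *-comm = λ f g n → conv-comm n f g } }
  where
  open CommutativeRing R
  open Convolution R
  idˡ : ∀ f n → conv n (const 1#) f ≈ f n
  idˡ f n = trans (conv-constˡ n 1# f) (*-identityˡ (f n))

-- Weighted Motzkin paths

module Motzkin (R : Ring) where
  open CommutativeRing R
  open Convolution R
  open import Relation.Binary.Reasoning.Setoid setoid
  open import Algebra.Solver.Ring.NaturalCoefficients.Default commutativeSemiring using (solve; _:=_; _:+_; _:*_) renaming (con to :con)

  -- Motzkin paths with weight c on level steps, d on up steps and 1 on down steps:
  -- paths c d n k is the total weight of the paths of length n from height k to height 0.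
  transfer : Carrier → Carrier → (ℕ → Carrier) → ℕ → Carrier
  transfer c d x zero    = c * x 0 + d * x 1
  transfer c d x (suc k) = c * x (suc k) + d * x (2 ℕ.+ k) + x k

  paths : Carrier → Carrier → ℕ → ℕ → Carrier
  paths c d zero    = const 1#
  paths c d (suc n) = transfer c d (paths c d n)

  transfer-cong : ∀ {c c′ d d′} → c ≈ c′ → d ≈ d′ → ∀ {x x′} → (∀ k → x k ≈ x′ k) →
                  ∀ k → transfer c d x k ≈ transfer c′ d′ x′ k
  transfer-cong c≈ d≈ x≈ zero    = +-cong (*-cong c≈ (x≈ 0)) (*-cong d≈ (x≈ 1))
  transfer-cong c≈ d≈ x≈ (suc k) = +-cong (+-cong (*-cong c≈ (x≈ (suc k))) (*-cong d≈ (x≈ (2 ℕ.+ k)))) (x≈ k)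

  paths-cong : ∀ {c c′ d d′} → c ≈ c′ → d ≈ d′ → ∀ n k → paths c d n k ≈ paths c′ d′ n k
  paths-cong c≈ d≈ zero    k = refl
  paths-cong c≈ d≈ (suc n) k = transfer-cong c≈ d≈ (paths-cong c≈ d≈ n) k

  module _ (c d : Carrier) where
    private
      h : ℕ → ℕ → Carrier
      h = paths c d

      excursions : ℕ → Carrier
      excursions n = h n 0

    -- Cut a path from height k + 1 at its first visit to height k.
    first-passage : ∀ n k → h (suc n) (suc k) ≈ conv n excursions (λ j → h j k)
    first-passage n k = below n n ℕ.≤-refl k
      where
      -- The bound `N` makes the induction strong: `shift` needs the claim at all smaller lengths
      -- and at several heights.
      below : ∀ N n → n ≤ N → ∀ k → h (suc n) (suc k) ≈ conv n excursions (λ j → h j k)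
      below N zero _ k = solve 3 (λ c d x → c :* :con 0 :+ d :* :con 0 :+ x := :con 1 :* x) refl c d (h 0 k)
      below (suc N) (suc n) (s≤s n≤N) k = begin
        c * h (suc n) (suc k) + d * h (suc n) (2 ℕ.+ k) + h (suc n) k
          ≈⟨ +-congʳ (+-cong (*-congˡ (below N n n≤N k)) (*-congˡ (below N n n≤N (suc k)))) ⟩
        c * conv n excursions (λ j → h j k) + d * conv n excursions (λ j → h j (suc k)) + h (suc n) k
          ≈⟨ +-congʳ (+-congˡ (*-congˡ (shift n n≤N))) ⟩
        c * conv n excursions (λ j → h j k) + d * conv n (λ j → h j 1) (λ j → h j k) + h (suc n) k
          ≈⟨ +-cong (+-cong (sym (conv-scaleˡ n c _ _)) (sym (conv-scaleˡ n d _ _))) (sym (*-identityˡ _)) ⟩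
        conv n (λ j → c * h j 0) (λ j → h j k) + conv n (λ j → d * h j 1) (λ j → h j k) + 1# * h (suc n) k
          ≈⟨ +-congʳ (sym (conv-distribʳ n _ _ _)) ⟩
        conv n (λ j → h (suc j) 0) (λ j → h j k) + 1# * h (suc n) k
          ≈⟨ +-comm _ _ ⟩
        conv (suc n) excursions (λ j → h j k) ∎
        where
        -- The path from height k + 1 is cut at its first visit to k and the pieces are regrouped:
        -- two excursions in succession are, by the claim at height 0, a path from height 1.
        shift : ∀ n → n ≤ N → conv n excursions (λ j → h j (suc k)) ≈ conv n (λ j → h j 1) (λ j → h j k)
        shift zero    _ = solve 1 (λ x → :con 1 :* :con 0 := :con 0 :* x) refl (h 0 k)
        shift (suc n) n<N = begin
          conv (suc n) excursions (λ j → h j (suc k))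
            ≈⟨ trans (conv-snoc n _ _) (trans (+-congˡ (zeroʳ _)) (+-identityʳ _)) ⟩
          conv n excursions (λ j → h (suc j) (suc k))
            ≈⟨ conv-cong-≤ n (λ _ _ → refl) (λ j j≤n → below N j (≤N j j≤n) k) ⟩
          conv n excursions (λ j → conv j excursions (λ i → h i k))
            ≈⟨ sym (conv-assoc n _ _ _) ⟩
          conv n (λ j → conv j excursions excursions) (λ j → h j k)
            ≈⟨ conv-cong-≤ n (λ j j≤n → sym (below N j (≤N j j≤n) 0)) (λ _ _ → refl) ⟩
          conv n (λ j → h (suc j) 1) (λ j → h j k)
            ≈⟨ sym (trans (+-congʳ (zeroˡ _)) (+-identityˡ _)) ⟩
          conv (suc n) (λ j → h j 1) (λ j → h j k) ∎
          where
          ≤N : ∀ j → j ≤ n → j ≤ N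
          ≤N j j≤n = ℕ.≤-trans (ℕ.m≤n⇒m≤1+n j≤n) n<N

-- Sums over the flats above an edge set, in terms of words

-- A word w : List Bool records the blocks of a subset S of the fan, true for a block joined to
-- the hub. A flat F ⊇ S arises from S by merging blocks; m counts the non-hub parts of the
-- current run, and fanSum w m sums the weights b^(rk F − rk S) runKL F. For (a , b) = (1 , t)
-- runKL is the KL polynomial of the contraction, for (a , b) = (t , 1) its reversal.
module FanSum (R : Ring) (a b : CommutativeRing.Carrier R) where
  open CommutativeRing R
  open Convolution R
  open Motzkin R
  open import Relation.Binary.Reasoning.Setoid setoid
  open import Algebra.Solver.Ring.NaturalCoefficients.Default commutativeSemiring using (solve; _:=_; _:+_; _:*_) renaming (con to :con)

  -- For (1 , t) this is the Motzkin polynomial of length m - 1. For (t , 1) it is the reversal in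
  -- degree m: a path with j up steps has m - 1 - 2j level steps, so its weight is t^(1 + (m - 1 -
  -- 2j) + j) = t^(m - j).
  fanKL : ℕ → Carrier
  fanKL zero    = 1#
  fanKL (suc m) = a * paths a (a * b) m 0

  runKL : ℕ → List Bool → Carrier
  runKL m []          = fanKL m
  runKL m (true ∷ w)  = fanKL m * runKL 0 w
  runKL m (false ∷ w) = runKL (suc m) w

  -- A block off the hub in S joins the hub and closes the run (factor b), opens a new part, or
  -- merges with the preceding part (factor b). For m = 0 the preceding block lies on the hub, and
  -- merging with it is the same as joining the hub.
  fanSum : List Bool → ℕ → Carrier
  fanSum []          m       = fanKL m
  fanSum (true ∷ w)  m       = fanKL m * fanSum w 0
  fanSum (false ∷ w) zero    = b * fanSum w 0 + fanSum w 1
  fanSum (false ∷ w) (suc m) = b * fanKL (suc m) * fanSum w 0 + fanSum w (2 ℕ.+ m) + b * fanSum w (suc m)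

  Z : ℕ → Carrier
  Z n = paths (a + b) (a * b) n 0

  Zrun : List Bool → ℕ → Carrier
  Zrun []          n = Z n
  Zrun (true ∷ w)  n = Z n * Zrun w 0
  Zrun (false ∷ w) n = Zrun w (suc n)

  -- For a run of N blocks, n of them already passed, the sum of Z_i Z_(N-1-i) in the Motzkin
  -- recursion is split at i = n: here i < n, in `tails` i ≥ n. The later runs contribute a common
  -- factor.
  Zpairs : List Bool → ℕ → Carrier
  Zpairs w zero    = 0#
  Zpairs w (suc n) = conv n Z (Zrun w)

  private
    T : (ℕ → Carrier) → ℕ → Carrier
    T = transfer a (a * b)

    T⁺ : (ℕ → Carrier) → ℕ → Carrier
    T⁺ = transfer (a + b) (a * b)

    T⁺≈T+b : ∀ x k → T⁺ x k ≈ T x k + b * x k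
    T⁺≈T+b x zero    = solve 5 (λ a b d x y → (a :+ b) :* x :+ d :* y := (a :* x :+ d :* y) :+ b :* x) refl a b (a * b) _ _
    T⁺≈T+b x (suc k) = solve 6 (λ a b d x y z → (a :+ b) :* x :+ d :* y :+ z := (a :* x :+ d :* y :+ z) :+ b :* x) refl a b (a * b) _ _ _

    T⁺-linear : ∀ x y k → T⁺ (λ i → x i + b * y i) k ≈ T⁺ x k + b * T⁺ y k
    T⁺-linear x y zero    = solve 7 (λ c d b x y z w → c :* (x :+ b :* y) :+ d :* (z :+ b :* w) :=
                              (c :* x :+ d :* z) :+ b :* (c :* y :+ d :* w)) refl (a + b) (a * b) b _ _ _ _
    T⁺-linear x y (suc k) = solve 9 (λ c d b x y z w u v → c :* (x :+ b :* y) :+ d :* (z :+ b :* w) :+ (u :+ b :* v) :=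
                              (c :* x :+ d :* z :+ u) :+ b :* (c :* y :+ d :* w :+ v)) refl (a + b) (a * b) b _ _ _ _ _ _

    -- fanSum w (suc m) depends on m through the vector of paths of length m, linearly; a join
    -- adds b to the transfer operator, which turns the level weight a into a + b.
    Φ : List Bool → (ℕ → Carrier) → Carrier
    Φ []          x = x 0
    Φ (true ∷ w)  x = x 0 * fanSum w 0
    Φ (false ∷ w) x = b * x 0 * fanSum w 0 + Φ w (T⁺ x)

    Φ-cong : ∀ w {x y} → (∀ k → x k ≈ y k) → Φ w x ≈ Φ w y
    Φ-cong []          e = e 0
    Φ-cong (true ∷ w)  e = *-congʳ (e 0)
    Φ-cong (false ∷ w) e = +-cong (*-congʳ (*-congˡ (e 0))) (Φ-cong w (transfer-cong refl refl e))

    Φ-linear : ∀ w x y → Φ w (λ k → x k + b * y k) ≈ Φ w x + b * Φ w y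
    Φ-linear []          x y = refl
    Φ-linear (true ∷ w)  x y = solve 4 (λ b x y f → (x :+ b :* y) :* f := x :* f :+ b :* (y :* f)) refl b (x 0) (y 0) (fanSum w 0)
    Φ-linear (false ∷ w) x y = trans (+-congˡ (trans (Φ-cong w (T⁺-linear x y)) (Φ-linear w (T⁺ x) (T⁺ y))))
      (solve 6 (λ b x y f p q → b :* (x :+ b :* y) :* f :+ (p :+ b :* q) := (b :* x :* f :+ p) :+ b :* (b :* y :* f :+ q))
         refl b (x 0) (y 0) (fanSum w 0) _ _)

    fanSum≈Φ : ∀ w m → fanSum w (suc m) ≈ a * Φ w (paths a (a * b) m)
    fanSum≈Φ []          m = refl
    fanSum≈Φ (true ∷ w)  m = *-assoc _ _ _
    fanSum≈Φ (false ∷ w) m = begin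
      b * (a * x 0) * fanSum w 0 + fanSum w (2 ℕ.+ m) + b * fanSum w (suc m)
        ≈⟨ +-cong (+-congˡ (fanSum≈Φ w (suc m))) (*-congˡ (fanSum≈Φ w m)) ⟩
      b * (a * x 0) * fanSum w 0 + a * Φ w (T x) + b * (a * Φ w x)
        ≈⟨ solve 6 (λ a b x f p q → b :* (a :* x) :* f :+ a :* p :+ b :* (a :* q) := a :* (b :* x :* f :+ (p :+ b :* q)))
             refl a b (x 0) (fanSum w 0) _ _ ⟩
      a * (b * x 0 * fanSum w 0 + (Φ w (T x) + b * Φ w x))
        ≈⟨ *-congˡ (+-congˡ (sym (trans (Φ-cong w (T⁺≈T+b x)) (Φ-linear w (T x) x)))) ⟩
      a * (b * x 0 * fanSum w 0 + Φ w (T⁺ x)) ∎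
      where
      x : ℕ → Carrier
      x = paths a (a * b) m

    tails : List Bool → ℕ → Carrier
    tails []          n = 0#
    tails (true ∷ w)  n = 0#
    tails (false ∷ w) n = Z n * Zrun w 0 + tails w (suc n)

    Zpairs-false : ∀ w n → Zpairs w (suc n) ≈ Zpairs (false ∷ w) n + Z n * Zrun w 0
    Zpairs-false w zero    = sym (+-identityˡ _)
    Zpairs-false w (suc n) = conv-snoc n Z (Zrun w)

  Z-suc : ∀ n → Z (suc n) ≈ (a + b) * Z n + a * b * Zpairs [] n
  Z-suc zero    = refl
  Z-suc (suc n) = +-congˡ (*-congˡ (first-passage (a + b) (a * b) n 0))

  private
    -- This is the recursion `Z-suc` for the whole current run, whose length is n plus the number of
    -- leading `false` of `w`.
    Zrun-suc : ∀ w n → Zrun w (suc n) ≈ (a + b) * Zrun w n + a * b * (Zpairs w n + tails w n)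
    Zrun-suc [] n = trans (Z-suc n) (+-congˡ (*-congˡ (sym (+-identityʳ _))))
    Zrun-suc (true ∷ w) n = begin
      Z (suc n) * Zrun w 0                              ≈⟨ *-congʳ (Z-suc n) ⟩
      ((a + b) * Z n + a * b * Zpairs [] n) * Zrun w 0
        ≈⟨ solve 5 (λ c d z s f → (c :* z :+ d :* s) :* f := c :* (z :* f) :+ d :* (s :* f :+ :con 0)) refl
             (a + b) (a * b) (Z n) (Zpairs [] n) (Zrun w 0) ⟩
      (a + b) * (Z n * Zrun w 0) + a * b * (Zpairs [] n * Zrun w 0 + 0#)
        ≈⟨ +-congˡ (*-congˡ (+-congʳ (scale n))) ⟩
      (a + b) * (Z n * Zrun w 0) + a * b * (Zpairs (true ∷ w) n + 0#) ∎
      where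
      scale : ∀ n → Zpairs [] n * Zrun w 0 ≈ Zpairs (true ∷ w) n
      scale zero    = zeroˡ _
      scale (suc n) = begin
        conv n Z Z * Zrun w 0               ≈⟨ trans (*-comm _ _) (*-congˡ (conv-comm n Z Z)) ⟩
        Zrun w 0 * conv n Z Z               ≈⟨ sym (conv-scaleˡ n (Zrun w 0) Z Z) ⟩
        conv n (λ i → Zrun w 0 * Z i) Z     ≈⟨ conv-comm n _ _ ⟩
        conv n Z (λ i → Zrun w 0 * Z i)     ≈⟨ conv-cong n (λ _ → refl) (λ _ → *-comm _ _) ⟩
        conv n Z (Zrun (true ∷ w))          ∎
    Zrun-suc (false ∷ w) n = trans (Zrun-suc w (suc n))
      (+-congˡ (*-congˡ (trans (+-congʳ (Zpairs-false w n)) (+-assoc _ _ _))))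

  mutual
    fanSum≈Zrun : ∀ w → fanSum w 0 ≈ Zrun w 0
    fanSum≈Zrun []          = refl
    fanSum≈Zrun (true ∷ w)  = *-congˡ (fanSum≈Zrun w)
    fanSum≈Zrun (false ∷ w) = begin
      b * fanSum w 0 + fanSum w 1
        -- Paths of length 0 do not see the level weight, so the vector of `fanSum≈Φ` for a and that
        -- of `Φ≈Zrun` for a + b coincide here.
        ≈⟨ +-cong (*-congˡ (fanSum≈Zrun w)) (trans (fanSum≈Φ w 0) (*-congˡ (Φ≈Zrun w 0))) ⟩
      b * Zrun w 0 + a * (Zrun w 0 + b * tails w 0)
        ≈⟨ solve 4 (λ a b z t → b :* z :+ a :* (z :+ b :* t) := (a :+ b) :* z :+ a :* b :* (:con 0 :+ t)) refl a b _ _ ⟩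
      (a + b) * Zrun w 0 + a * b * (0# + tails w 0)
        ≈⟨ sym (Zrun-suc w 0) ⟩
      Zrun w 1 ∎

    private
      -- Each term of `tails` comes from a block of the run that joins the hub, with factor b, and
      -- so cuts the run in two.
      Φ≈Zrun : ∀ w n → Φ w (paths (a + b) (a * b) n) ≈ Zrun w n + b * tails w n
      Φ≈Zrun []          n = solve 2 (λ b z → z := z :+ b :* :con 0) refl b (Z n)
      Φ≈Zrun (true ∷ w)  n = trans (*-congˡ (fanSum≈Zrun w)) (solve 2 (λ b z → z := z :+ b :* :con 0) refl b _)
      Φ≈Zrun (false ∷ w) n = trans (+-cong (*-congˡ (fanSum≈Zrun w)) (Φ≈Zrun w (suc n)))
        (solve 5 (λ b z f s t → b :* z :* f :+ (s :+ b :* t) := s :+ b :* (z :* f :+ t)) refl b (Z n) _ _ _)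

  Zrun-replicate : ∀ k n → Zrun (replicate k false) n ≡ Z (k ℕ.+ n)
  Zrun-replicate zero    n = ≡.refl
  Zrun-replicate (suc k) n = ≡.trans (Zrun-replicate k (suc n)) (≡.cong Z (ℕ.+-suc k n))

module _ (R : Ring) where
  open CommutativeRing R
  open FanSum R
  open Motzkin R

  Zrun-sym : ∀ a b w n → Zrun a b w n ≈ Zrun b a w n
  Zrun-sym a b []          n = paths-cong (+-comm a b) (*-comm a b) n 0
  Zrun-sym a b (true ∷ w)  n = *-cong (paths-cong (+-comm a b) (*-comm a b) n 0) (Zrun-sym a b w 0)
  Zrun-sym a b (false ∷ w) n = Zrun-sym a b w (suc n)

  fanSum-sym : ∀ a b w → fanSum a b w 0 ≈ fanSum b a w 0
  fanSum-sym a b w = trans (fanSum≈Zrun a b w) (trans (Zrun-sym a b w 0) (sym (fanSum≈Zrun b a w)))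

-- Sums over subsets and Möbius inversion

sub : ∀ {m} → Subset m → Subset m → Bool
sub []          []          = true
sub (false ∷ S) (_ ∷ F)     = sub S F
sub (true ∷ S)  (true ∷ F)  = sub S F
sub (true ∷ S)  (false ∷ F) = false

disjoint : ∀ {m} → Subset m → Subset m → Bool
disjoint []          []          = true
disjoint (false ∷ S) (_ ∷ A)     = disjoint S A
disjoint (true ∷ S)  (false ∷ A) = disjoint S A
disjoint (true ∷ S)  (true ∷ A)  = false

module SubsetSum (R : Ring) where
  open CommutativeRing R
  open import Relation.Binary.Reasoning.Setoid setoid
  open import Algebra.Properties.Ring ring using (-‿distribˡ-*; -‿distribʳ-*)
  open import Algebra.Properties.CommutativeSemigroup +-commutativeSemigroup using (interchange)

  when : Bool → Carrier → Carrier
  when true  x = x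
  when false x = 0#

  when-cong : ∀ c {x y} → (c ≡ true → x ≈ y) → when c x ≈ when c y
  when-cong true  e = e ≡.refl
  when-cong false e = refl

  when-∧ : ∀ c d x → when (c ∧ d) x ≡ when c (when d x)
  when-∧ true  d x = ≡.refl
  when-∧ false d x = ≡.refl

  when-+ : ∀ c x y → when c (x + y) ≈ when c x + when c y
  when-+ true  x y = refl
  when-+ false x y = sym (+-identityˡ 0#)

  when-* : ∀ c x y → when c (x * y) ≈ x * when c y
  when-* true  x y = refl
  when-* false x y = sym (zeroʳ x)

  ∑ : ∀ {m} → (Subset m → Carrier) → Carrier
  ∑ {zero}  f = f []
  ∑ {suc m} f = ∑ (f ∘ (false ∷_)) + ∑ (f ∘ (true ∷_))

  ∑-cong : ∀ {m} {f g : Subset m → Carrier} → (∀ S → f S ≈ g S) → ∑ f ≈ ∑ g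
  ∑-cong {zero}  e = e []
  ∑-cong {suc m} e = +-cong (∑-cong (e ∘ (false ∷_))) (∑-cong (e ∘ (true ∷_)))

  ∑-zero : ∀ m → ∑ {m} (λ _ → 0#) ≈ 0#
  ∑-zero zero    = refl
  ∑-zero (suc m) = trans (+-cong (∑-zero m) (∑-zero m)) (+-identityˡ 0#)

  ∑-+ : ∀ {m} (f g : Subset m → Carrier) → ∑ (λ S → f S + g S) ≈ ∑ f + ∑ g
  ∑-+ {zero}  f g = refl
  ∑-+ {suc m} f g = trans (+-cong (∑-+ (f ∘ (false ∷_)) (g ∘ (false ∷_))) (∑-+ (f ∘ (true ∷_)) (g ∘ (true ∷_))))
                          (interchange _ _ _ _)

  ∑-* : ∀ {m} x (f : Subset m → Carrier) → ∑ (λ S → x * f S) ≈ x * ∑ f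
  ∑-* {zero}  x f = refl
  ∑-* {suc m} x f = trans (+-cong (∑-* x (f ∘ (false ∷_))) (∑-* x (f ∘ (true ∷_)))) (sym (distribˡ _ _ _))

  ∑-when-* : ∀ {m} (c : Subset m → Bool) x (f : Subset m → Carrier) → ∑ (λ S → when (c S) (x * f S)) ≈ x * ∑ (λ S → when (c S) (f S))
  ∑-when-* c x f = trans (∑-cong (λ S → when-* (c S) x (f S))) (∑-* x (λ S → when (c S) (f S)))

  ∑-when-+ : ∀ {m} (c : Subset m → Bool) (f g : Subset m → Carrier) →
             ∑ (λ S → when (c S) (f S + g S)) ≈ ∑ (λ S → when (c S) (f S)) + ∑ (λ S → when (c S) (g S))
  ∑-when-+ c f g = trans (∑-cong (λ S → when-+ (c S) (f S) (g S))) (∑-+ (λ S → when (c S) (f S)) (λ S → when (c S) (g S)))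

  ∑-nonempty : ∀ {m} (f : Subset m → Carrier) → ∑ (λ S → when (not (∣ S ∣ ℕ.≡ᵇ 0)) (f S)) + f ⊥ ≈ ∑ f
  ∑-nonempty {zero}  f = +-identityˡ _
  ∑-nonempty {suc m} f = trans (+-assoc _ _ _) (trans (+-congˡ (+-comm _ _))
    (trans (sym (+-assoc _ _ _)) (+-congʳ (∑-nonempty (f ∘ (false ∷_))))))

  ∑-sub-⊥ : ∀ {m} (f : Subset m → Carrier) → ∑ (λ S → when (sub S ⊥) (f S)) ≈ f ⊥
  ∑-sub-⊥ {zero}  f = refl
  ∑-sub-⊥ {suc m} f = trans (+-cong (∑-sub-⊥ (f ∘ (false ∷_))) (∑-zero m)) (+-identityʳ _)

  private
    drop-zeroʳ : ∀ m {x} → x + ∑ {m} (λ _ → 0#) ≈ x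
    drop-zeroʳ m = trans (+-congˡ (∑-zero m)) (+-identityʳ _)

    drop-zeroˡ : ∀ m {x} → ∑ {m} (λ _ → 0#) + x ≈ x
    drop-zeroˡ m = trans (+-congʳ (∑-zero m)) (+-identityˡ _)

  -- The sum over S ⊆ F ⊆ ∁ A, rewritten as a sum over S ⊆ ∁ A and F′ = F ∪ A ⊇ S ∪ A.
  ∑-contract : ∀ {m} (A : Subset m) (h : Subset m → Subset m → Carrier) →
    ∑ (λ F → when (disjoint F A) (∑ (λ S → when (sub S F) (h S (F ∪ A))))) ≈
    ∑ (λ S → when (disjoint S A) (∑ (λ F′ → when (sub (S ∪ A) F′) (h S F′))))
  ∑-contract []          h = refl
  ∑-contract {suc m} (true ∷ A)  h = begin
    ∑ (λ F → when (disjoint F A) (∑ (λ S → when (sub S F) (h (false ∷ S) (true ∷ (F ∪ A)))) + ∑ {m} (λ _ → 0#))) + ∑ {m} (λ _ → 0#)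
      ≈⟨ trans (drop-zeroʳ m) (∑-cong (λ F → when-cong (disjoint F A) (λ _ → drop-zeroʳ m))) ⟩
    ∑ (λ F → when (disjoint F A) (∑ (λ S → when (sub S F) (h (false ∷ S) (true ∷ (F ∪ A))))))
      ≈⟨ ∑-contract A (λ S F′ → h (false ∷ S) (true ∷ F′)) ⟩
    ∑ (λ S → when (disjoint S A) (∑ (λ F′ → when (sub (S ∪ A) F′) (h (false ∷ S) (true ∷ F′)))))
      ≈⟨ sym (trans (drop-zeroʳ m) (∑-cong (λ S → when-cong (disjoint S A) (λ _ → drop-zeroˡ m)))) ⟩
    ∑ (λ S → when (disjoint S A) (∑ {m} (λ _ → 0#) + ∑ (λ F′ → when (sub (S ∪ A) F′) (h (false ∷ S) (true ∷ F′))))) + ∑ {m} (λ _ → 0#) ∎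
  ∑-contract {suc m} (false ∷ A) h = begin
    ∑ (λ F → when (disjoint F A) (∑ (x F) + ∑ {m} (λ _ → 0#))) + ∑ (λ F → when (disjoint F A) (∑ (y F) + ∑ (z F)))
      ≈⟨ +-cong (∑-cong (λ F → when-cong (disjoint F A) (λ _ → drop-zeroʳ m))) (∑-when-+ (λ F → disjoint F A) (λ F → ∑ (y F)) (λ F → ∑ (z F))) ⟩
    ∑ (λ F → when (disjoint F A) (∑ (x F))) + (∑ (λ F → when (disjoint F A) (∑ (y F))) + ∑ (λ F → when (disjoint F A) (∑ (z F))))
      ≈⟨ +-cong (∑-contract A _) (+-cong (∑-contract A _) (∑-contract A _)) ⟩
    ∑ (λ S → when (disjoint S A) (∑ (x′ S))) + (∑ (λ S → when (disjoint S A) (∑ (y′ S))) + ∑ (λ S → when (disjoint S A) (∑ (z′ S))))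
      ≈⟨ sym (+-assoc _ _ _) ⟩
    ∑ (λ S → when (disjoint S A) (∑ (x′ S))) + ∑ (λ S → when (disjoint S A) (∑ (y′ S))) + ∑ (λ S → when (disjoint S A) (∑ (z′ S)))
      ≈⟨ sym (+-cong (∑-when-+ (λ S → disjoint S A) (λ S → ∑ (x′ S)) (λ S → ∑ (y′ S))) (∑-cong (λ S → when-cong (disjoint S A) (λ _ → drop-zeroˡ m)))) ⟩
    ∑ (λ S → when (disjoint S A) (∑ (x′ S) + ∑ (y′ S))) + ∑ (λ S → when (disjoint S A) (∑ {m} (λ _ → 0#) + ∑ (z′ S))) ∎
    where
    x y z x′ y′ z′ : Subset _ → Subset _ → Carrier
    x F S = when (sub S F) (h (false ∷ S) (false ∷ (F ∪ A)))
    y F S = when (sub S F) (h (false ∷ S) (true ∷ (F ∪ A)))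
    z F S = when (sub S F) (h (true ∷ S) (true ∷ (F ∪ A)))
    x′ S F′ = when (sub (S ∪ A) F′) (h (false ∷ S) (false ∷ F′))
    y′ S F′ = when (sub (S ∪ A) F′) (h (false ∷ S) (true ∷ F′))
    z′ S F′ = when (sub (S ∪ A) F′) (h (true ∷ S) (true ∷ F′))

  sign : ∀ {m} → Subset m → Carrier
  sign []          = 1#
  sign (false ∷ S) = sign S
  sign (true ∷ S)  = - sign S

  -- An element of F outside A may or may not belong to S, and the two signs cancel; what survives
  -- is F = A.
  ∑-sign : ∀ {m} (A : Subset m) (g : Subset m → Carrier) →
    ∑ (λ S → when (disjoint S A) (∑ (λ F → when (sub (S ∪ A) F) (sign S * g F)))) ≈ g A
  ∑-sign []          g = *-identityˡ _
  ∑-sign {suc m} (true ∷ A)  g = begin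
    ∑ (λ S → when (disjoint S A) (∑ {m} (λ _ → 0#) + ∑ (λ F → when (sub (S ∪ A) F) (sign S * g (true ∷ F))))) + ∑ {m} (λ _ → 0#)
      ≈⟨ trans (drop-zeroʳ m) (∑-cong (λ S → when-cong (disjoint S A) (λ _ → drop-zeroˡ m))) ⟩
    ∑ (λ S → when (disjoint S A) (∑ (λ F → when (sub (S ∪ A) F) (sign S * g (true ∷ F)))))
      ≈⟨ ∑-sign A (g ∘ (true ∷_)) ⟩
    g (true ∷ A) ∎
  ∑-sign {suc m} (false ∷ A) g = begin
    ∑ (λ S → when (disjoint S A) (∑ (x S) + ∑ (y S))) + ∑ (λ S → when (disjoint S A) (∑ {m} (λ _ → 0#) + ∑ (z S)))
      ≈⟨ +-cong (∑-when-+ (λ S → disjoint S A) (λ S → ∑ (x S)) (λ S → ∑ (y S))) (∑-cong (λ S → when-cong (disjoint S A) (λ _ → trans (drop-zeroˡ m) (z≈ S)))) ⟩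
    ∑ (λ S → when (disjoint S A) (∑ (x S))) + ∑ (λ S → when (disjoint S A) (∑ (y S))) + ∑ (λ S → when (disjoint S A) (∑ (z′ S)))
      ≈⟨ +-cong (+-cong (∑-sign A (g ∘ (false ∷_))) (∑-sign A (g ∘ (true ∷_)))) (∑-sign A (λ F → - g (true ∷ F))) ⟩
    g (false ∷ A) + g (true ∷ A) + - g (true ∷ A)
      ≈⟨ trans (+-assoc _ _ _) (trans (+-congˡ (-‿inverseʳ _)) (+-identityʳ _)) ⟩
    g (false ∷ A) ∎
    where
    x y z z′ : Subset _ → Subset _ → Carrier
    x S F = when (sub (S ∪ A) F) (sign S * g (false ∷ F))
    y S F = when (sub (S ∪ A) F) (sign S * g (true ∷ F))
    z S F = when (sub (S ∪ A) F) (- sign S * g (true ∷ F))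
    z′ S F = when (sub (S ∪ A) F) (sign S * - g (true ∷ F))
    z≈ : ∀ S → ∑ (z S) ≈ ∑ (z′ S)
    z≈ S = ∑-cong (λ F → when-cong (sub (S ∪ A) F) (λ _ → trans (sym (-‿distribˡ-* _ _)) (-‿distribʳ-* _ _)))

-- Coefficients of polynomials given as lists

ℤ⟦t⟧ : Ring
ℤ⟦t⟧ = powerSeries ℤ.+-*-commutativeRing

private
  module ℤ* = Convolution ℤ.+-*-commutativeRing

coeff-+ : ∀ p q k → coeff (p +P q) k ≡ coeff p k ℤ.+ coeff q k
coeff-+ []      q       k       = ≡.sym (ℤ.+-identityˡ _)
coeff-+ (a ∷ p) []      k       = ≡.sym (ℤ.+-identityʳ _)
coeff-+ (a ∷ p) (b ∷ q) zero    = ≡.refl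
coeff-+ (a ∷ p) (b ∷ q) (suc k) = coeff-+ p q k

coeff-neg : ∀ p k → coeff (negP p) k ≡ ℤ.- coeff p k
coeff-neg []      k       = ≡.refl
coeff-neg (a ∷ p) zero    = ≡.refl
coeff-neg (a ∷ p) (suc k) = coeff-neg p k

coeff-scale : ∀ c p k → coeff (map (c ℤ.*_) p) k ≡ c ℤ.* coeff p k
coeff-scale c []      k       = ≡.sym (ℤ.*-zeroʳ c)
coeff-scale c (a ∷ p) zero    = ≡.refl
coeff-scale c (a ∷ p) (suc k) = coeff-scale c p k

coeff-* : ∀ p q k → coeff (p *P q) k ≡ ℤ*.conv k (coeff p) (coeff q)
coeff-* []      q k       = ≡.sym (ℤ*.conv-zeroˡ k (coeff q))
coeff-* (a ∷ p) q zero    = ≡.trans (coeff-+ (map (a ℤ.*_) q) _ 0)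
                              (≡.trans (ℤ.+-identityʳ _) (coeff-scale a q 0))
coeff-* (a ∷ p) q (suc k) = ≡.trans (coeff-+ (map (a ℤ.*_) q) _ (suc k))
                              (≡.cong₂ ℤ._+_ (coeff-scale a q (suc k)) (coeff-* p q k))

coeff-take-< : ∀ n p j → j < n → coeff (truncP n p) j ≡ coeff p j
coeff-take-< (suc n) []      j       _         = ≡.refl
coeff-take-< (suc n) (a ∷ p) zero    _         = ≡.refl
coeff-take-< (suc n) (a ∷ p) (suc j) (s≤s j<n) = coeff-take-< n p j j<n

coeff-take-≥ : ∀ n p j → n ≤ j → coeff (truncP n p) j ≡ + 0
coeff-take-≥ zero    p       j       _         = ≡.refl
coeff-take-≥ (suc n) []      j       _         = ≡.refl
coeff-take-≥ (suc n) (a ∷ p) (suc j) (s≤s n≤j) = coeff-take-≥ n p j n≤j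

coeff-oneP : ∀ k → coeff oneP k ≡ ℤ*.const (+ 1) k
coeff-oneP zero    = ≡.refl
coeff-oneP (suc k) = ≡.refl

open CommutativeRing ℤ⟦t⟧ using () renaming (Carrier to Coeffs) public

t^ : ℕ → Coeffs
t^ n = coeff (tPow n)

module _ where
  open CommutativeRing ℤ⟦t⟧
  open SubsetSum ℤ⟦t⟧
  open import Algebra.Properties.Ring ring using (-‿distribˡ-*)

  ∑L : {A : Set} → List A → (A → Carrier) → Carrier
  ∑L xs f = foldr (λ x s → f x + s) 0# xs

  coeff-sum-filter : {A : Set} (c : A → Bool) (g : A → Poly) (xs : List A) →
                     coeff (sumP (map g (filterB c xs))) ≈ ∑L xs (λ x → when (c x) (coeff (g x)))
  coeff-sum-filter c g []       k = ≡.refl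
  coeff-sum-filter c g (x ∷ xs) k with c x
  ... | true  = ≡.trans (coeff-+ (g x) _ k) (≡.cong (λ s → coeff (g x) k ℤ.+ s) (coeff-sum-filter c g xs k))
  ... | false = ≡.trans (coeff-sum-filter c g xs k) (≡.sym (ℤ.+-identityˡ _))

  ∑L-++ : {A : Set} (f : A → Carrier) (xs ys : List A) → ∑L (xs List.++ ys) f ≈ ∑L xs f + ∑L ys f
  ∑L-++ f []       ys = sym (+-identityˡ (∑L ys f))
  ∑L-++ f (x ∷ xs) ys = trans (+-congˡ {f x} (∑L-++ f xs ys)) (sym (+-assoc (f x) (∑L xs f) (∑L ys f)))

  ∑L-map : {A B : Set} (f : B → Carrier) (g : A → B) (xs : List A) → ∑L (map g xs) f ≡ ∑L xs (f ∘ g)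
  ∑L-map f g []       = ≡.refl
  ∑L-map f g (x ∷ xs) = ≡.cong (λ s → f (g x) + s) (∑L-map f g xs)

  ∑L-allSubsets : ∀ m (f : Subset m → Carrier) → ∑L (allSubsets m) f ≈ ∑ f
  ∑L-allSubsets zero    f = +-identityʳ (f [])
  ∑L-allSubsets (suc m) f = trans (∑L-++ f (map (false ∷_) (allSubsets m)) (map (true ∷_) (allSubsets m)))
    (+-cong (half false) (half true))
    where
    half : ∀ s → ∑L (map (s ∷_) (allSubsets m)) f ≈ ∑ (f ∘ (s ∷_))
    half s = trans (reflexive (∑L-map f (s ∷_) (allSubsets m))) (∑L-allSubsets m (f ∘ (s ∷_)))

  coeff-sum-subsets : ∀ {m} (c : Subset m → Bool) (g : Subset m → Poly) →
                      coeff (sumP (map g (filterB c (allSubsets m)))) ≈ ∑ (λ S → when (c S) (coeff (g S)))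
  coeff-sum-subsets c g = trans (coeff-sum-filter c g (allSubsets _)) (∑L-allSubsets _ (λ S → when (c S) (coeff (g S))))

  coeff-signPow : ∀ {m} (S : Subset m) p → coeff (map (signPow ∣ S ∣ ℤ.*_) p) ≈ sign S * coeff p
  coeff-signPow S p k = ≡.trans (coeff-scale (signPow ∣ S ∣) p k) (go S k)
    where
    go : ∀ {m} (S : Subset m) k → signPow ∣ S ∣ ℤ.* coeff p k ≡ (sign S * coeff p) k
    go []          k = ≡.sym (ℤ*.conv-constˡ k (+ 1) (coeff p))
    go (false ∷ S) k = go S k
    go (true ∷ S)  k = ≡.trans (≡.sym (ℤ.neg-distribˡ-* (signPow ∣ S ∣) (coeff p k)))
                         (≡.trans (≡.cong ℤ.-_ (go S k)) (-‿distribˡ-* (sign S) (coeff p) k))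

-- Boolean quantifiers, subsets and arithmetic

allF : ∀ {m} → (Fin m → Bool) → Bool
allF {zero}  f = true
allF {suc m} f = f zero ∧ allF (f ∘ suc)

allB-tabulate : ∀ {m} {A : Set} (f : A → Bool) (g : Fin m → A) → allB f (tabulate g) ≡ allF (f ∘ g)
allB-tabulate {zero}  f g = ≡.refl
allB-tabulate {suc m} f g = ≡.cong (f (g zero) ∧_) (allB-tabulate f (g ∘ suc))

allB-allFin : ∀ {m} (f : Fin m → Bool) → allB f (allFin m) ≡ allF f
allB-allFin f = allB-tabulate f id

allF-cong : ∀ {m} {f g : Fin m → Bool} → (∀ e → f e ≡ g e) → allF f ≡ allF g
allF-cong {zero}  e = ≡.refl
allF-cong {suc m} e = ≡.cong₂ _∧_ (e zero) (allF-cong (e ∘ suc))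

allF-lookup : ∀ {m} (f : Fin m → Bool) → allF f ≡ true → ∀ e → f e ≡ true
allF-lookup {suc m} f all e with f zero in eq
allF-lookup {suc m} f all zero    | true = eq
allF-lookup {suc m} f all (suc e) | true = allF-lookup (f ∘ suc) all e

allF-tabulate : ∀ {m} (f : Fin m → Bool) → (∀ e → f e ≡ true) → allF f ≡ true
allF-tabulate {zero}  f all = ≡.refl
allF-tabulate {suc m} f all = ≡.trans (≡.cong (_∧ allF (f ∘ suc)) (all zero)) (allF-tabulate (f ∘ suc) (all ∘ suc))

⊆ᵇ≡sub : ∀ {m} (S F : Subset m) → S ⊆ᵇ F ≡ sub S F
⊆ᵇ≡sub S F = ≡.trans (allB-allFin (λ e → not (lookup S e) ∨ lookup F e)) (go S F)
  where
  go : ∀ {m} (S F : Subset m) → allF (λ e → not (lookup S e) ∨ lookup F e) ≡ sub S F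
  go []          []          = ≡.refl
  go (false ∷ S) (_ ∷ F)     = go S F
  go (true ∷ S)  (true ∷ F)  = go S F
  go (true ∷ S)  (false ∷ F) = ≡.refl

sub-∁ : ∀ {m} (F A : Subset m) → sub F (∁ A) ≡ disjoint F A
sub-∁ []          []          = ≡.refl
sub-∁ (false ∷ F) (_ ∷ A)     = sub-∁ F A
sub-∁ (true ∷ F)  (false ∷ A) = sub-∁ F A
sub-∁ (true ∷ F)  (true ∷ A)  = ≡.refl

sub-⊤ : ∀ {m} (F : Subset m) → sub F ⊤ ≡ true
sub-⊤ []          = ≡.refl
sub-⊤ (false ∷ F) = sub-⊤ F
sub-⊤ (true ∷ F)  = sub-⊤ F

disjoint-⊥ : ∀ {m} (A : Subset m) → disjoint ⊥ A ≡ true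
disjoint-⊥ []      = ≡.refl
disjoint-⊥ (_ ∷ A) = disjoint-⊥ A

∁-∪ : ∀ {m} (A F : Subset m) → ∁ A ∩ ∁ F ≡ ∁ (F ∪ A)
∁-∪ []          []          = ≡.refl
∁-∪ (true ∷ A)  (true ∷ F)  = ≡.cong (false ∷_) (∁-∪ A F)
∁-∪ (true ∷ A)  (false ∷ F) = ≡.cong (false ∷_) (∁-∪ A F)
∁-∪ (false ∷ A) (true ∷ F)  = ≡.cong (false ∷_) (∁-∪ A F)
∁-∪ (false ∷ A) (false ∷ F) = ≡.cong (true ∷_) (∁-∪ A F)

disjoint-lookup : ∀ {m} (F A : Subset m) → disjoint F A ≡ true → ∀ e → lookup F e ≡ true → lookup A e ≡ false
disjoint-lookup (true ∷ F)  (false ∷ A) d zero    _ = ≡.refl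
disjoint-lookup (false ∷ F) (_ ∷ A)     d (suc e) l = disjoint-lookup F A d e l
disjoint-lookup (true ∷ F)  (false ∷ A) d (suc e) l = disjoint-lookup F A d e l

⁅⁆-absorb : ∀ {m} (F : Subset m) e → lookup F e ≡ true → ⁅ e ⁆ ∪ F ≡ F
⁅⁆-absorb (true ∷ F) zero    _ = ≡.cong (true ∷_) (∪-identityˡ F)
⁅⁆-absorb (x ∷ F)    (suc e) l = ≡.cong (x ∷_) (⁅⁆-absorb F e l)

nonempty-element : ∀ {m} (F : Subset m) → not (∣ F ∣ ℕ.≡ᵇ 0) ≡ true → ∃ λ e → lookup F e ≡ true
nonempty-element (true ∷ F)  _ = zero , ≡.refl
nonempty-element (false ∷ F) n with nonempty-element F n
... | e , l = suc e , l

filterB-filterB : {A : Set} (c d : A → Bool) (xs : List A) → filterB c (filterB d xs) ≡ filterB (λ x → c x ∧ d x) xs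
filterB-filterB c d []       = ≡.refl
filterB-filterB c d (x ∷ xs) with d x
filterB-filterB c d (x ∷ xs) | true with c x
... | true  = ≡.cong (x ∷_) (filterB-filterB c d xs)
... | false = filterB-filterB c d xs
filterB-filterB c d (x ∷ xs) | false with c x
... | true  = filterB-filterB c d xs
... | false = filterB-filterB c d xs

≡ᵇ-∸ : ∀ a x y → a ≤ x → a ≤ y → (x ∸ a ℕ.≡ᵇ y ∸ a) ≡ (x ℕ.≡ᵇ y)
≡ᵇ-∸ zero    x       y       _         _         = ≡.refl
≡ᵇ-∸ (suc a) (suc x) (suc y) (s≤s a≤x) (s≤s a≤y) = ≡ᵇ-∸ a x y a≤x a≤y

∸-∸-cancel : ∀ a x y → a ≤ y → (x ∸ a) ∸ (y ∸ a) ≡ x ∸ y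
∸-∸-cancel a x y a≤y = ≡.trans (ℕ.∸-+-assoc x a (y ∸ a)) (≡.cong (x ∸_) (ℕ.m+[n∸m]≡n a≤y))

≡ᵇ-refl : ∀ x → (x ℕ.≡ᵇ x) ≡ true
≡ᵇ-refl zero    = ≡.refl
≡ᵇ-refl (suc x) = ≡ᵇ-refl x

∧-true : ∀ {x y} → x ∧ y ≡ true → x ≡ true × y ≡ true
∧-true {true} e = ≡.refl , e

≤⌊/2⌋⇒2*≤ : ∀ j r → j ≤ ⌊ r /2⌋ → j ℕ.+ j ≤ r
≤⌊/2⌋⇒2*≤ j r j≤ = ≡.subst (j ℕ.+ j ≤_) (ℕ.⌊n/2⌋+⌈n/2⌉≡n r)
                     (ℕ.+-mono-≤ j≤ (ℕ.≤-trans j≤ (ℕ.⌊n/2⌋≤⌈n/2⌉ r)))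

⌊/2⌋<⇒<2* : ∀ j r → ⌊ r /2⌋ < j → r < j ℕ.+ j
⌊/2⌋<⇒<2* j r <j = ≡.subst (_< j ℕ.+ j) (ℕ.⌊n/2⌋+⌈n/2⌉≡n r)
                     (ℕ.+-mono-<-≤ <j (ℕ.≤-trans (⌈/2⌉≤ r) <j))
  where
  ⌈/2⌉≤ : ∀ r → ⌈ r /2⌉ ≤ suc ⌊ r /2⌋
  ⌈/2⌉≤ zero          = z≤n
  ⌈/2⌉≤ (suc zero)    = s≤s z≤n
  ⌈/2⌉≤ (suc (suc r)) = s≤s (⌈/2⌉≤ r)

-- Characterisation of Kazhdan-Lusztig polynomials

-- KL polynomials are characterised by their defining identity in the following dual form: with
-- q F playing the role of t^(rk M^F) p F (t⁻¹), it suffices that both sums over F ⊇ S agree for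
-- every S, since the alternating sum of these identities over S isolates F = A.
module KLUniqueness
  {m : ℕ} (rank : Subset m → ℕ)
  (rank-mono : ∀ S U → rank S ≤ rank (S ∪ U))
  (p q : Subset m → Coeffs) where

  open CommutativeRing ℤ⟦t⟧
  open SubsetSum ℤ⟦t⟧
  open import Relation.Binary.Reasoning.Setoid setoid

  matroid : Subset m → (Subset m → ℕ) → Matroid
  matroid g r = record { carrier = m ; ground = g ; rk = r }

  flat : Subset m → Bool
  flat = isFlatᵇ (matroid ⊤ rank)

  corank : Subset m → ℕ
  corank F = rank ⊤ ∸ rank F

  flat≡ : ∀ F → flat F ≡ allF (λ e → lookup F e ∨ not (rank (F ∪ ⁅ e ⁆) ℕ.≡ᵇ rank F))
  flat≡ F = ≡.cong₂ _∧_ (≡.trans (⊆ᵇ≡sub F ⊤) (sub-⊤ F))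
    (≡.trans (allB-allFin (λ e → not (lookup (⊤ {m}) e) ∨ open-at e))
      (allF-cong {m} (λ e → ≡.cong (λ x → not x ∨ open-at e) (lookup-replicate {n = m} e true))))
    where
    open-at : Fin m → Bool
    open-at e = lookup F e ∨ not (rank (F ∪ ⁅ e ⁆) ℕ.≡ᵇ rank F)

  private
    rank-mono′ : ∀ S A → rank A ≤ rank (S ∪ A)
    rank-mono′ S A = ≡.subst (λ X → rank A ≤ rank X) (∪-comm A S) (rank-mono A S)

    swap : ∀ (F A X : Subset m) → (F ∪ X) ∪ A ≡ (F ∪ A) ∪ X
    swap F A X = ≡.trans (∪-assoc F X A) (≡.trans (≡.cong (F ∪_) (∪-comm X A)) (≡.sym (∪-assoc F A X)))

    -- This makes the fuel of `KL′` suffice: an element of F lies outside the flat A, so adding it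
    -- already raises the rank.
    flat-strict : ∀ A F → flat A ≡ true → disjoint F A ≡ true → not (∣ F ∣ ℕ.≡ᵇ 0) ≡ true → rank A < rank (F ∪ A)
    flat-strict A F fl d n with nonempty-element F n
    ... | e , l = ℕ.≤-trans (ℕ.≤∧≢⇒< (rank-mono A ⁅ e ⁆) (λ eq → changed (≡.sym eq)))
                    (≡.subst (λ X → rank (A ∪ ⁅ e ⁆) ≤ rank X)
                      (≡.trans (∪-assoc A ⁅ e ⁆ F) (≡.trans (≡.cong (A ∪_) (⁅⁆-absorb F e l)) (∪-comm A F)))
                      (rank-mono (A ∪ ⁅ e ⁆) F))
      where
      changed : rank (A ∪ ⁅ e ⁆) ≢ rank A
      changed eq with ≡.trans (≡.sym (allF-lookup _ (≡.trans (≡.sym (flat≡ A)) fl) e))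
                        (≡.cong₂ (λ x y → x ∨ not y) (disjoint-lookup F A d e l)
                          (≡.trans (≡.cong (ℕ._≡ᵇ rank A) eq) (≡ᵇ-refl (rank A))))
      ... | ()

    ∁∪≡⊤ : ∀ (A : Subset m) → ∁ A ∪ A ≡ ⊤
    ∁∪≡⊤ A = ≡.trans (∪-comm (∁ A) A) (p∪∁p≡⊤ A)

    -- Repeated contraction nests truncated subtractions, and the resulting rank function agrees
    -- with that of M^A only pointwise; hence the parameter `r` with its equation.
    module Contraction (A : Subset m) (r : Subset m → ℕ) (r≡ : ∀ S → r S ≡ rank (S ∪ A) ∸ rank A) where

      corank-contraction : corank A ≡ r (∁ A)
      corank-contraction = ≡.sym (≡.trans (r≡ (∁ A)) (≡.cong (λ X → rank X ∸ rank A) (∁∪≡⊤ A)))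

      flat-contraction : ∀ F → isFlatᵇ (matroid (∁ A) r) F ≡ disjoint F A ∧ flat (F ∪ A)
      flat-contraction F = ≡.cong₂ _∧_ (≡.trans (⊆ᵇ≡sub F (∁ A)) (sub-∁ F A))
        (≡.trans (allB-allFin (λ e → not (lookup (∁ A) e) ∨ lookup F e ∨ not (r (F ∪ ⁅ e ⁆) ℕ.≡ᵇ r F)))
          (≡.trans (allF-cong pointwise) (≡.sym (flat≡ (F ∪ A)))))
        where
        same : ∀ e → (r (F ∪ ⁅ e ⁆) ℕ.≡ᵇ r F) ≡ (rank ((F ∪ A) ∪ ⁅ e ⁆) ℕ.≡ᵇ rank (F ∪ A))
        same e = ≡.trans (≡.cong₂ ℕ._≡ᵇ_ (≡.trans (r≡ _) (≡.cong (λ X → rank X ∸ rank A) (swap F A ⁅ e ⁆))) (r≡ F))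
          (≡ᵇ-∸ (rank A) _ _ (ℕ.≤-trans (rank-mono′ F A) (rank-mono (F ∪ A) ⁅ e ⁆)) (rank-mono′ F A))

        bool : ∀ x y z → not (not x) ∨ y ∨ z ≡ (y ∨ x) ∨ z
        bool true  y z = ≡.cong (_∨ z) (≡.sym (∨-zeroʳ y))
        bool false y z = ≡.cong (_∨ z) (≡.sym (∨-identityʳ y))

        pointwise : ∀ e → not (lookup (∁ A) e) ∨ lookup F e ∨ not (r (F ∪ ⁅ e ⁆) ℕ.≡ᵇ r F) ≡
                          lookup (F ∪ A) e ∨ not (rank ((F ∪ A) ∪ ⁅ e ⁆) ℕ.≡ᵇ rank (F ∪ A))
        pointwise e rewrite lookup-map e not A | lookup-zipWith _∨_ e F A | same e =
          bool (lookup A e) (lookup F e) _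

      χ : Subset m → Carrier
      χ F = ∑ (λ S → when (sub S F) (sign S * t^ (rank (F ∪ A) ∸ rank (S ∪ A))))

      charPoly-contraction : ∀ g F → coeff (charPoly (loc (matroid g r) F)) ≈ χ F
      charPoly-contraction g F = trans
        (coeff-sum-subsets (λ S → S ⊆ᵇ F) (λ S → map (signPow ∣ S ∣ ℤ.*_) (tPow (r F ∸ r S))))
        (∑-cong (λ S → trans
          (reflexive (≡.cong (λ c → when c (coeff (map (signPow ∣ S ∣ ℤ.*_) (tPow (r F ∸ r S))))) (⊆ᵇ≡sub S F)))
          (when-cong (sub S F) (λ _ → trans (coeff-signPow S (tPow (r F ∸ r S)))
            (reflexive (≡.cong (λ n → sign S * t^ n)
              (≡.trans (≡.cong₂ _∸_ (r≡ F) (r≡ S)) (∸-∸-cancel (rank A) _ _ (rank-mono′ S A)))))))))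

  module _
    (balanced : ∀ S → ∑ (λ F → when (sub S F) (when (flat F) (t^ (rank F ∸ rank S) * p F)))
                      ≈ ∑ (λ F → when (sub S F) (when (flat F) (q F))))
    (p-top  : ∀ F → corank F ≡ 0 → p F ≈ 1#)
    (p-high : ∀ F j → 0 < corank F → corank F ≤ j ℕ.+ j → p F j ≡ + 0)
    (q-low  : ∀ F j → j ℕ.+ j < corank F → q F j ≡ + 0) where

    private
      module _ (A : Subset m) (flatA : flat A ≡ true) (r : Subset m → ℕ) (r≡ : ∀ S → r S ≡ rank (S ∪ A) ∸ rank A) where
        open Contraction A r r≡

        term : Subset m → Carrier
        term F = when (disjoint F A ∧ flat (F ∪ A)) (χ F * p (F ∪ A))

        summand : Subset m → Subset m → Carrier
        summand S F′ = when (flat F′) (sign S * (t^ (rank F′ ∸ rank (S ∪ A)) * p F′))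

        push : ∀ F → term F ≈ when (disjoint F A) (∑ (λ S → when (sub S F) (summand S (F ∪ A))))
        push F = trans (reflexive (when-∧ (disjoint F A) (flat (F ∪ A)) (χ F * p (F ∪ A))))
          (when-cong (disjoint F A) (λ _ → inner (flat (F ∪ A))))
          where
          f : Subset m → Carrier
          f S = sign S * t^ (rank (F ∪ A) ∸ rank (S ∪ A))

          inner : ∀ c → when c (χ F * p (F ∪ A)) ≈
            ∑ (λ S → when (sub S F) (when c (sign S * (t^ (rank (F ∪ A) ∸ rank (S ∪ A)) * p (F ∪ A)))))
          inner true = trans (*-comm (χ F) (p (F ∪ A))) (trans
            (sym (∑-when-* (λ S → sub S F) (p (F ∪ A)) f))
            (∑-cong (λ S → when-cong (sub S F) (λ _ → trans (*-comm (p (F ∪ A)) (f S)) (*-assoc (sign S) _ (p (F ∪ A)))))))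
          inner false = sym (trans (∑-cong (λ S → when-0 (sub S F))) (∑-zero m))
            where
            when-0 : ∀ c → when c 0# ≈ 0#
            when-0 true  = refl
            when-0 false = refl

        -- Expanding χ turns the right side of the KL identity for M^A into an alternating sum over
        -- S of the left sides of `balanced` at S ∪ A. Replacing these by the right sides leaves a
        -- sum that `∑-sign` collapses.
        ∑-term : ∑ term ≈ q A
        ∑-term = begin
          ∑ term
            ≈⟨ ∑-cong push ⟩
          ∑ (λ F → when (disjoint F A) (∑ (λ S → when (sub S F) (summand S (F ∪ A)))))
            ≈⟨ ∑-contract A summand ⟩
          ∑ (λ S → when (disjoint S A) (∑ (λ F → when (sub (S ∪ A) F) (summand S F))))
            ≈⟨ ∑-cong (λ S → when-cong (disjoint S A) (λ _ → exchange S)) ⟩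
          ∑ (λ S → when (disjoint S A) (∑ (λ F → when (sub (S ∪ A) F) (sign S * when (flat F) (q F)))))
            ≈⟨ ∑-sign A (λ F → when (flat F) (q F)) ⟩
          when (flat A) (q A)
            ≈⟨ reflexive (≡.cong (λ c → when c (q A)) flatA) ⟩
          q A ∎
          where
          exchange : ∀ S → ∑ (λ F → when (sub (S ∪ A) F) (summand S F)) ≈
                           ∑ (λ F → when (sub (S ∪ A) F) (sign S * when (flat F) (q F)))
          exchange S = begin
            ∑ (λ F → when (sub (S ∪ A) F) (summand S F))
              ≈⟨ ∑-cong (λ F → when-cong (sub (S ∪ A) F) (λ _ → when-* (flat F) (sign S) _)) ⟩
            ∑ (λ F → when (sub (S ∪ A) F) (sign S * when (flat F) (t^ (rank F ∸ rank (S ∪ A)) * p F)))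
              ≈⟨ ∑-when-* (sub (S ∪ A)) (sign S) (λ F → when (flat F) (t^ (rank F ∸ rank (S ∪ A)) * p F)) ⟩
            sign S * ∑ (λ F → when (sub (S ∪ A) F) (when (flat F) (t^ (rank F ∸ rank (S ∪ A)) * p F)))
              ≈⟨ *-congˡ {sign S} (balanced (S ∪ A)) ⟩
            sign S * ∑ (λ F → when (sub (S ∪ A) F) (when (flat F) (q F)))
              ≈⟨ sym (∑-when-* (sub (S ∪ A)) (sign S) (λ F → when (flat F) (q F))) ⟩
            ∑ (λ F → when (sub (S ∪ A) F) (sign S * when (flat F) (q F))) ∎

        -- F = ∅ is the flat that `KL′` leaves out of its sum; the one S ⊆ ∅ contributes 1 to χ.
        term-⊥ : term ⊥ ≈ p A
        term-⊥ = trans (reflexive (≡.cong₂ (λ c X → when c (χ ⊥ * p X))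
                   (≡.cong₂ _∧_ (disjoint-⊥ A) (≡.trans (≡.cong flat (∪-identityˡ A)) flatA)) (∪-identityˡ A)))
          (trans (*-congʳ {p A} χ-⊥) (*-identityˡ (p A)))
          where
          χ-⊥ : χ ⊥ ≈ 1#
          χ-⊥ = trans (∑-sub-⊥ (λ S → sign S * t^ (rank (⊥ ∪ A) ∸ rank (S ∪ A))))
            (trans (*-cong {sign {m} ⊥} (reflexive (sign-⊥ m))
                     (trans (reflexive (≡.cong t^ (ℕ.n∸n≡0 (rank (⊥ ∪ A))))) coeff-oneP))
                   (*-identityˡ 1#))
            where
            sign-⊥ : ∀ m → sign {m} ⊥ ≡ 1#
            sign-⊥ zero    = ≡.refl
            sign-⊥ (suc m) = sign-⊥ m

    -- `con (con M A) F` is the contraction at F ∪ A only up to equations between ground sets and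
    -- ranks, so `g` and `r` are generalised. Fuel is merely bounded below, since one step may lower
    -- the corank by more than one.
    KL′-contraction : ∀ k A g r → flat A ≡ true → g ≡ ∁ A → (∀ S → r S ≡ rank (S ∪ A) ∸ rank A) →
                      corank A ≤ k → coeff (KL′ k (matroid g r)) ≈ p A
    KL′-contraction zero A g r flatA g≡ r≡ ≤k = trans coeff-oneP (sym (p-top A (ℕ.n≤0⇒n≡0 ≤k)))
    KL′-contraction (suc k) A g r flatA ≡.refl r≡ ≤k with r (∁ A) in eq
    ... | zero  = trans coeff-oneP (sym (p-top A (≡.trans (Contraction.corank-contraction A r r≡) eq)))
    ... | suc c = coefficient
      where
      open Contraction A r r≡

      corank≡ : corank A ≡ suc c
      corank≡ = ≡.trans corank-contraction eq

      N : Matroid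
      N = matroid (∁ A) r

      factor : Subset m → Poly
      factor F = charPoly (loc N F) *P KL′ k (con N F)

      X : Poly
      X = sumP (map factor (nonemptyFlats N))

      nonempty : Subset m → Bool
      nonempty F = not (∣ F ∣ ℕ.≡ᵇ 0)

      factor≈ : ∀ F → nonempty F ≡ true → disjoint F A ∧ flat (F ∪ A) ≡ true →
                  coeff (factor F) ≈ χ F * p (F ∪ A)
      factor≈ F n d = trans (coeff-* (charPoly (loc N F)) (KL′ k (con N F)))
        (*-cong (charPoly-contraction (∁ A) F)
          (KL′-contraction k (F ∪ A) (∁ A ∩ ∁ F) (λ S → r (S ∪ F) ∸ r F) (proj₂ (∧-true {disjoint F A} d)) (∁-∪ A F)
            (λ S → ≡.trans (≡.cong₂ _∸_ (r≡ (S ∪ F)) (r≡ F))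
              (≡.trans (∸-∸-cancel (rank A) _ _ (rank-mono′ F A)) (≡.cong (λ Y → rank Y ∸ rank (F ∪ A)) (∪-assoc S F A))))
            (ℕ.≤-pred (ℕ.≤-trans (ℕ.∸-monoʳ-< (flat-strict A F flatA (proj₁ (∧-true {disjoint F A} d)) n)
              (≡.subst (λ Y → rank (F ∪ A) ≤ rank Y) (∪-zeroʳ (F ∪ A)) (rank-mono (F ∪ A) ⊤))) ≤k))))

      coeff-X : coeff X ≈ ∑ (λ F → when (nonempty F) (term A flatA r r≡ F))
      coeff-X = trans (reflexive (≡.cong (λ xs → coeff (sumP (map factor xs)))
                  (filterB-filterB nonempty (isFlatᵇ N) (allSubsets m))))
        (trans (coeff-sum-subsets (λ F → nonempty F ∧ isFlatᵇ N F) factor)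
          (∑-cong (λ F → trans (reflexive (when-∧ (nonempty F) (isFlatᵇ N F) (coeff (factor F))))
            (when-cong (nonempty F) (λ n → trans (reflexive (≡.cong (λ c → when c (coeff (factor F))) (flat-contraction F)))
              (when-cong (disjoint F A ∧ flat (F ∪ A)) (factor≈ F n)))))))

      X+p≡q : ∀ j → coeff X j ℤ.+ p A j ≡ q A j
      X+p≡q = begin
        coeff X + p A
          ≈⟨ +-cong coeff-X (sym (term-⊥ A flatA r r≡)) ⟩
        ∑ (λ F → when (nonempty F) (term A flatA r r≡ F)) + term A flatA r r≡ ⊥
          ≈⟨ ∑-nonempty (term A flatA r r≡) ⟩
        ∑ (term A flatA r r≡)
          ≈⟨ ∑-term A flatA r r≡ ⟩
        q A ∎

      coefficient : ∀ j → coeff (negP (truncP ⌊ suc (suc c) /2⌋ X)) j ≡ p A j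
      coefficient j = ≡.trans (coeff-neg (truncP ⌊ suc (suc c) /2⌋ X) j) (cases (j ℕ.<? ⌊ suc (suc c) /2⌋))
        where
        cases : _ → ℤ.- coeff (truncP ⌊ suc (suc c) /2⌋ X) j ≡ p A j
        -- With corank c + 1 the truncation keeps j ≤ ⌊c/2⌋, so 2j ≤ c and the coefficient of q A is
        -- 0; X + p A = q A then gives the sign in `negP`. Beyond it 2j > c, and p A vanishes by its
        -- degree bound.
        cases (yes j<) = ≡.trans (≡.cong ℤ.-_ (coeff-take-< ⌊ suc (suc c) /2⌋ X j j<))
          (≡.sym (ℤRing.+-inverseʳ-unique (coeff X j) (p A j) (≡.trans (X+p≡q j)
            (q-low A j (≡.subst (j ℕ.+ j <_) (≡.sym corank≡) (s≤s (≤⌊/2⌋⇒2*≤ j c (ℕ.≤-pred j<))))))))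
        cases (no j≮) = ≡.trans (≡.cong ℤ.-_ (coeff-take-≥ ⌊ suc (suc c) /2⌋ X j (ℕ.≮⇒≥ j≮)))
          (≡.sym (p-high A j (≡.subst (0 <_) (≡.sym corank≡) (s≤s z≤n))
            (≡.subst (_≤ j ℕ.+ j) (≡.sym corank≡) (⌊/2⌋<⇒<2* j c (ℕ.≮⇒≥ j≮)))))

    Zpoly-formula : coeff (Zpoly (matroid ⊤ rank)) ≈ ∑ (λ F → when (flat F) (t^ (rank F) * p F))
    Zpoly-formula = trans (coeff-sum-subsets flat (λ F → tPow (rank F) *P KL (con (matroid ⊤ rank) F)))
      (∑-cong (λ F → when-cong (flat F) (λ fl → trans (coeff-* (tPow (rank F)) (KL (con (matroid ⊤ rank) F)))
        (*-congˡ {t^ (rank F)} (KL′-contraction _ F (⊤ ∩ ∁ F) _ fl (∩-identityˡ (∁ F)) (λ _ → ≡.refl)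
          (ℕ.≤-reflexive (≡.cong (λ X → rank X ∸ rank F)
            (≡.sym (≡.trans (≡.cong (_∪ F) (∩-identityˡ (∁ F))) (∁∪≡⊤ F))))))))))

-- Edge sets of the fan and their blocks

-- A subset of the edges of the fan F_(k+1) is given by the bit c of the spoke {0,1}, the bits A
-- of the path edges {i+1,i+2} and the bits B of the spokes {0,i+2}, for i < k.

blocks : ∀ {k} → Bool → Subset k → Subset k → List Bool
blocks c []          []      = c ∷ []
blocks c (true ∷ A)  (x ∷ B) = blocks (c ∨ x) A B
blocks c (false ∷ A) (x ∷ B) = c ∷ blocks x A B

free : List Bool → ℕ
free []          = 0
free (true ∷ w)  = free w
free (false ∷ w) = suc (free w)

freeBlocks : ∀ {k} → Bool → Subset k → Subset k → ℕ
freeBlocks c A B = free (blocks c A B)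

implies : Bool → Bool → Bool
implies x y = not x ∨ y

implies-true : ∀ x → implies x true ≡ true
implies-true x = ∨-zeroʳ (not x)

-- Excludes exactly two edges in the triangle made of two neighbouring spokes and the path edge
-- between them. As the fan is chordal, these triangles decide flatness.
consistent : Bool → Bool → Bool → Bool
consistent true  y true  = y
consistent true  y false = not y
consistent false y true  = not y
consistent false y false = true

local : ∀ {k} → Bool → Subset k → Subset k → Bool
local c []      []      = true
local c (y ∷ A) (x ∷ B) = consistent c y x ∧ local x A B

-- Containment of S in F and flatness of F are interleaved vertex by vertex, so that a sum over F
-- splits according to its first bits.
above : ∀ {k} → Bool → (A B A′ B′ : Subset k) → Bool
above c []      []      []        []        = true
above c (y ∷ A) (x ∷ B) (y′ ∷ A′) (x′ ∷ B′) = implies y y′ ∧ implies x x′ ∧ consistent c y′ x′ ∧ above x′ A B A′ B′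

above≡ : ∀ {k} c (A B A′ B′ : Subset k) → above c A B A′ B′ ≡ (sub A A′ ∧ sub B B′) ∧ local c A′ B′
above≡ c []      []      []        []        = ≡.refl
above≡ c (y ∷ A) (x ∷ B) (y′ ∷ A′) (x′ ∷ B′) =
  ≡.trans (≡.cong (λ z → implies y y′ ∧ implies x x′ ∧ consistent c y′ x′ ∧ z) (above≡ x′ A B A′ B′))
    (≡.trans (bool (implies y y′) (implies x x′) (consistent c y′ x′) (sub A A′) (sub B B′) (local x′ A′ B′))
      (≡.sym (≡.cong₂ (λ p q → (p ∧ q) ∧ (consistent c y′ x′ ∧ local x′ A′ B′)) (sub-∷ y y′ A A′) (sub-∷ x x′ B B′))))
  where
  sub-∷ : ∀ {k} y y′ (A A′ : Subset k) → sub (y ∷ A) (y′ ∷ A′) ≡ implies y y′ ∧ sub A A′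
  sub-∷ false y′    A A′ = ≡.refl
  sub-∷ true  true  A A′ = ≡.refl
  sub-∷ true  false A A′ = ≡.refl

  bool : ∀ i j o a b l → i ∧ j ∧ o ∧ (a ∧ b) ∧ l ≡ ((i ∧ a) ∧ (j ∧ b)) ∧ (o ∧ l)
  bool false j     o     a     b l = ≡.refl
  bool true  false o     false b l = ≡.refl
  bool true  false o     true  b l = ≡.refl
  bool true  true  false false b l = ≡.refl
  bool true  true  false true  false l = ≡.refl
  bool true  true  false true  true  l = ≡.refl
  bool true  true  true  a     b l = ≡.refl

free-∷-≤ : ∀ x w → free w ≤ free (x ∷ w)
free-∷-≤ true  w = ℕ.≤-refl
free-∷-≤ false w = ℕ.n≤1+n _

free-∷-mono : ∀ {c c′ v w} → implies c c′ ≡ true → free w ≤ free v → free (c′ ∷ w) ≤ free (c ∷ v)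
free-∷-mono {c}     {true}  {v} _ le = ℕ.≤-trans le (free-∷-≤ c v)
free-∷-mono {false} {false} _ le = s≤s le

freeBlocks-mono : ∀ {k} {c c′} (A B A′ B′ : Subset k) → implies c c′ ≡ true → sub A A′ ≡ true → sub B B′ ≡ true →
                  freeBlocks c′ A′ B′ ≤ freeBlocks c A B
freeBlocks-mono {c = c} {c′} [] [] [] [] i _ _ = free-∷-mono {c} {c′} i z≤n
freeBlocks-mono {c = c} {c′} (y ∷ A) (x ∷ B) (y′ ∷ A′) (x′ ∷ B′) i sA sB = go y y′ sA
  where
  tailB : ∀ {k} x x′ (B B′ : Subset k) → sub (x ∷ B) (x′ ∷ B′) ≡ true → implies x x′ ≡ true × sub B B′ ≡ true
  tailB false x′   B B′ s = ≡.refl , s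
  tailB true  true B B′ s = ≡.refl , s

  i′ : implies x x′ ≡ true
  i′ = proj₁ (tailB x x′ B B′ sB)

  s′ : sub B B′ ≡ true
  s′ = proj₂ (tailB x x′ B B′ sB)

  ∨-mono : ∀ {c c′ x x′} → implies c c′ ≡ true → implies x x′ ≡ true → implies (c ∨ x) (c′ ∨ x′) ≡ true
  ∨-mono {false} {false} _ j = j
  ∨-mono {false} {true}  {x} _ j = implies-true x
  ∨-mono {true}  {true}  _ j = ≡.refl

  go : ∀ y y′ → sub (y ∷ A) (y′ ∷ A′) ≡ true →
       free (blocks c′ (y′ ∷ A′) (x′ ∷ B′)) ≤ free (blocks c (y ∷ A) (x ∷ B))
  go true  true  s = freeBlocks-mono A B A′ B′ (∨-mono {c} {c′} {x} {x′} i i′) s s′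
  go false false s = free-∷-mono {c} {c′} i (freeBlocks-mono A B A′ B′ i′ s s′)
  go false true  s = ℕ.≤-trans (freeBlocks-mono A B A′ B′ (∨-mono {false} {c′} {x} {x′} ≡.refl i′) s s′)
                               (free-∷-≤ c _)

-- From sums over flats to sums over words

module FlatSum (R : Ring) (a b : CommutativeRing.Carrier R) where
  open CommutativeRing R
  open SubsetSum R
  open FanSum R a b
  open import Relation.Binary.Reasoning.Setoid setoid
  open import Algebra.Solver.Ring.NaturalCoefficients.Default commutativeSemiring using (solve; _:=_; _:+_; _:*_) renaming (con to :con)

  pow : ℕ → Carrier
  pow zero    = 1#
  pow (suc n) = b * pow n

  pow-+ : ∀ m n → pow (m ℕ.+ n) ≈ pow m * pow n
  pow-+ zero    n = sym (*-identityˡ _)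
  pow-+ (suc m) n = trans (*-congˡ (pow-+ m n)) (sym (*-assoc _ _ _))

  ∑² : ∀ {k} → (Subset k → Subset k → Carrier) → Carrier
  ∑² f = ∑ (λ A → ∑ (f A))

  ∑²-cong : ∀ {k} {f g : Subset k → Subset k → Carrier} → (∀ A B → f A B ≈ g A B) → ∑² f ≈ ∑² g
  ∑²-cong e = ∑-cong (λ A → ∑-cong (e A))

  ∑²-zero : ∀ k → ∑² {k} (λ _ _ → 0#) ≈ 0#
  ∑²-zero k = trans (∑-cong {k} (λ _ → ∑-zero k)) (∑-zero k)

  ∑²-* : ∀ {k} x (f : Subset k → Subset k → Carrier) → ∑² (λ A B → x * f A B) ≈ x * ∑² f
  ∑²-* x f = trans (∑-cong (λ A → ∑-* x (f A))) (∑-* x (λ A → ∑ (f A)))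

  ∑²-split : ∀ {k} (f : Subset (suc k) → Subset (suc k) → Carrier) →
    ∑² f ≈ (∑² (λ A B → f (false ∷ A) (false ∷ B)) + ∑² (λ A B → f (false ∷ A) (true ∷ B)))
         + (∑² (λ A B → f (true ∷ A) (false ∷ B)) + ∑² (λ A B → f (true ∷ A) (true ∷ B)))
  ∑²-split f = +-cong (∑-+ (λ A → ∑ (λ B → f (false ∷ A) (false ∷ B))) (λ A → ∑ (λ B → f (false ∷ A) (true ∷ B))))
                      (∑-+ (λ A → ∑ (λ B → f (true ∷ A) (false ∷ B))) (λ A → ∑ (λ B → f (true ∷ A) (true ∷ B))))

  -- `c` is the bit of F, while `N` is to be the number of free blocks of S, whose own bit may
  -- differ from `c`; it is therefore a separate argument.
  summand : ∀ {k} (c : Bool) (m N : ℕ) (A B A′ B′ : Subset k) → Carrier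
  summand c m N A B A′ B′ = when (above c A B A′ B′) (pow (N ∸ freeBlocks c A′ B′) * runKL m (blocks c A′ B′))

  flatSum : ∀ {k} (c : Bool) (m N : ℕ) (A B : Subset k) → Carrier
  flatSum c m N A B = ∑² (summand c m N A B)

  -- The part of fanSum w m contributed by the flats in which the first block of w joins the hub
  -- (h = true), respectively stays off the hub and continues a run of m parts (h = false).
  firstBlock : (h : Bool) → ℕ → List Bool → Carrier
  firstBlock true  m []          = fanKL m
  firstBlock true  m (x ∷ w)     = pow (free (x ∷ [])) * (fanKL m * fanSum w 0)
  firstBlock false m []          = 0#
  firstBlock false m (true ∷ w)  = 0#
  firstBlock false m (false ∷ w) = fanSum w (suc m)

  -- Once the hub has closed a run of m parts, the next block either stays on the hub or begins a
  -- new run.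
  firstBlock-hub : ∀ m w → fanKL m * fanSum w 0 ≈ firstBlock true m w + fanKL m * firstBlock false 0 w
  firstBlock-hub m []          = solve 1 (λ x → x :* :con 1 := x :+ x :* :con 0) refl (fanKL m)
  firstBlock-hub m (true ∷ w)  = solve 2 (λ x f → x :* (:con 1 :* f) := :con 1 :* (x :* f) :+ x :* :con 0) refl (fanKL m) (fanSum w 0)
  firstBlock-hub m (false ∷ w) = solve 4 (λ b x f g → x :* (b :* f :+ g) := b :* :con 1 :* (x :* f) :+ x :* g) refl
                                   b (fanKL m) (fanSum w 0) (fanSum w 1)

  -- While a run is open, the next block begins a new part, joins the hub, or merges with the last
  -- part at the cost of b.
  firstBlock-run : ∀ m w → fanSum w (suc m) ≈
    (firstBlock false (suc m) w + firstBlock true (suc m) w) + b * firstBlock false m w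
  firstBlock-run m []          = solve 2 (λ b x → x := :con 0 :+ x :+ b :* :con 0) refl b (fanKL (suc m))
  firstBlock-run m (true ∷ w)  = solve 3 (λ b x f → x :* f := :con 0 :+ :con 1 :* (x :* f) :+ b :* :con 0) refl b (fanKL (suc m)) (fanSum w 0)
  firstBlock-run m (false ∷ w) = solve 5 (λ b x f g h → b :* x :* f :+ g :+ b :* h := g :+ b :* :con 1 :* (x :* f) :+ b :* h) refl
                                   b (fanKL (suc m)) (fanSum w 0) _ _

  firstBlock-spoke : ∀ {k} m (A B : Subset k) → firstBlock false m (blocks true A B) ≈ 0#
  firstBlock-spoke m []          []      = refl
  firstBlock-spoke m (true ∷ A)  (x ∷ B) = firstBlock-spoke m A B
  firstBlock-spoke m (false ∷ A) (x ∷ B) = refl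

  private
    only₃ : ∀ {x y z w} → x ≈ 0# → y ≈ 0# → w ≈ 0# → (x + y) + (z + w) ≈ z
    only₃ e f g = trans (+-cong (+-cong e f) (+-congˡ g)) (solve 1 (λ x → (:con 0 :+ :con 0) :+ (x :+ :con 0) := x) refl _)

    only₄ : ∀ {x y z w} → x ≈ 0# → y ≈ 0# → z ≈ 0# → (x + y) + (z + w) ≈ w
    only₄ e f g = trans (+-cong (+-cong e f) (+-congʳ g)) (solve 1 (λ x → (:con 0 :+ :con 0) :+ (:con 0 :+ x) := x) refl _)

    drop₂₃ : ∀ {x y z w} → y ≈ 0# → z ≈ 0# → (x + y) + (z + w) ≈ x + w
    drop₂₃ e f = trans (+-cong (+-congˡ e) (+-congʳ f)) (solve 2 (λ x w → (x :+ :con 0) :+ (:con 0 :+ w) := x :+ w) refl _ _)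

    drop₄ : ∀ {x y z w} → w ≈ 0# → (x + y) + (z + w) ≈ (x + y) + z
    drop₄ e = +-congˡ (trans (+-congˡ e) (+-identityʳ _))

    above-mono : ∀ {k} s c (A B A′ B′ : Subset k) → implies s c ≡ true → above c A B A′ B′ ≡ true →
                 freeBlocks c A′ B′ ≤ freeBlocks s A B
    above-mono s c A B A′ B′ i ab = freeBlocks-mono A B A′ B′ i
      (proj₁ (∧-true (proj₁ (∧-true {sub A A′ ∧ sub B B′} split)))) (proj₂ (∧-true {sub A A′} (proj₁ (∧-true {sub A A′ ∧ sub B B′} split))))
      where
      split : (sub A A′ ∧ sub B B′) ∧ local c A′ B′ ≡ true
      split = ≡.trans (≡.sym (above≡ c A B A′ B′)) ab

    free-∷ : ∀ x w → free (x ∷ w) ≡ free (x ∷ []) ℕ.+ free w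
    free-∷ true  w = ≡.refl
    free-∷ false w = ≡.refl

    -- Closing a block s of S while F keeps its current block.
    summand-close : ∀ {k} s x c m (A B : Subset k) → implies x c ≡ true → ∀ A′ B′ →
      summand c m (free (s ∷ blocks x A B)) A B A′ B′ ≈
      pow (free (s ∷ [])) * summand c m (freeBlocks x A B) A B A′ B′
    summand-close s x c m A B i A′ B′ = trans
      (when-cong (above c A B A′ B′) (λ ab → trans (*-congʳ (trans (reflexive (≡.cong pow
        (≡.trans (≡.cong (_∸ freeBlocks c A′ B′) (free-∷ s (blocks x A B)))
                 (ℕ.+-∸-assoc (free (s ∷ [])) (above-mono x c A B A′ B′ i ab)))))
        (pow-+ (free (s ∷ [])) _))) (*-assoc _ _ _)))
      (when-* (above c A B A′ B′) _ _)

  -- Induction along the path. Containment and triangles leave at most three of the four choices for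
  -- the first path edge and spoke of F, and these match the cases of `fanSum`. The hypothesis says
  -- that F meets the hub where S does.
  flatSum≈ : ∀ {k} s c m (A B : Subset k) → implies s c ≡ true →
             flatSum c m (freeBlocks s A B) A B ≈ firstBlock c m (blocks s A B)
  flatSum≈ true  true  m [] [] _ = refl
  flatSum≈ false true  m [] [] _ = refl
  flatSum≈ false false m [] [] _ = *-identityˡ _
  flatSum≈ {suc k} s true m (true ∷ A) (true ∷ B) _ =
    trans (∑²-split (summand true m (freeBlocks (s ∨ true) A B) (true ∷ A) (true ∷ B)))
      (trans (only₄ (∑²-zero k) (∑²-zero k) (∑²-zero k)) (flatSum≈ (s ∨ true) true m A B (implies-true (s ∨ true))))
  flatSum≈ {suc k} s true m (true ∷ A) (false ∷ B) _ =
    trans (∑²-split (summand true m (freeBlocks (s ∨ false) A B) (true ∷ A) (false ∷ B)))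
      (trans (only₄ (∑²-zero k) (∑²-zero k) (∑²-zero k)) (flatSum≈ (s ∨ false) true m A B (implies-true (s ∨ false))))
  flatSum≈ {suc k} false false m (true ∷ A) (true ∷ B) _ =
    trans (∑²-split (summand false m (freeBlocks true A B) (true ∷ A) (true ∷ B)))
      (trans (only₄ (∑²-zero k) (∑²-zero k) (∑²-zero k)) (trans (∑²-zero k) (sym (firstBlock-spoke m A B))))
  flatSum≈ {suc k} false false m (true ∷ A) (false ∷ B) _ =
    trans (∑²-split (summand false m (freeBlocks false A B) (true ∷ A) (false ∷ B)))
      (trans (only₃ (∑²-zero k) (∑²-zero k) (∑²-zero k)) (flatSum≈ false false m A B ≡.refl))
  flatSum≈ {suc k} s true m (false ∷ A) (x ∷ B) _ = begin
    ∑² (summand true m N (false ∷ A) (x ∷ B))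
      ≈⟨ ∑²-split (summand true m N (false ∷ A) (x ∷ B)) ⟩
    (∑² (λ A′ B′ → summand true m N (false ∷ A) (x ∷ B) (false ∷ A′) (false ∷ B′)) + ∑² (λ A′ B′ → summand true m N (false ∷ A) (x ∷ B) (false ∷ A′) (true ∷ B′)))
    + (∑² (λ A′ B′ → summand true m N (false ∷ A) (x ∷ B) (true ∷ A′) (false ∷ B′)) + ∑² (λ A′ B′ → summand true m N (false ∷ A) (x ∷ B) (true ∷ A′) (true ∷ B′)))
      -- From a vertex of F on the hub, the path edge and the next spoke are both absent, which
      -- begins a run, or both present.
      ≈⟨ pieces x ⟩
    pow (free (s ∷ [])) * (fanKL m * firstBlock false 0 (blocks x A B)) + pow (free (s ∷ [])) * firstBlock true m (blocks x A B)
      ≈⟨ trans (sym (distribˡ _ _ _)) (*-congˡ (trans (+-comm _ _) (sym (firstBlock-hub m (blocks x A B))))) ⟩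
    pow (free (s ∷ [])) * (fanKL m * fanSum (blocks x A B) 0) ∎
    where
    N : ℕ
    N = free (s ∷ blocks x A B)

    stay : ∀ x → implies x true ≡ true →
           ∑² (summand true m (free (s ∷ blocks x A B)) A B) ≈ pow (free (s ∷ [])) * firstBlock true m (blocks x A B)
    stay x i = trans (∑²-cong (summand-close s x true m A B i))
      (trans (∑²-* (pow (free (s ∷ []))) (summand true m (freeBlocks x A B) A B)) (*-congˡ (flatSum≈ x true m A B i)))

    leave : ∑² (λ A′ B′ → summand true m (free (s ∷ blocks false A B)) (false ∷ A) (false ∷ B) (false ∷ A′) (false ∷ B′)) ≈
            pow (free (s ∷ [])) * (fanKL m * firstBlock false 0 (blocks false A B))
    leave = trans (∑²-cong (λ A′ B′ → trans (when-cong (above false A B A′ B′) (λ _ →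
                solve 3 (λ p f g → p :* (f :* g) := f :* (p :* g)) refl _ (fanKL m) _))
                (trans (when-* (above false A B A′ B′) (fanKL m) _) (trans (*-congˡ (summand-close s false false 0 A B ≡.refl A′ B′))
                  (solve 3 (λ p f g → f :* (p :* g) := p :* f :* g) refl (pow (free (s ∷ []))) (fanKL m) (summand false 0 (freeBlocks false A B) A B A′ B′))))))
      (trans (∑²-* (pow (free (s ∷ [])) * fanKL m) (summand false 0 (freeBlocks false A B) A B))
        (trans (*-assoc _ _ _) (*-congˡ (*-congˡ (flatSum≈ false false 0 A B ≡.refl)))))

    pieces : ∀ x →
      (∑² (λ A′ B′ → summand true m (free (s ∷ blocks x A B)) (false ∷ A) (x ∷ B) (false ∷ A′) (false ∷ B′)) + ∑² (λ A′ B′ → summand true m (free (s ∷ blocks x A B)) (false ∷ A) (x ∷ B) (false ∷ A′) (true ∷ B′)))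
      + (∑² (λ A′ B′ → summand true m (free (s ∷ blocks x A B)) (false ∷ A) (x ∷ B) (true ∷ A′) (false ∷ B′)) + ∑² (λ A′ B′ → summand true m (free (s ∷ blocks x A B)) (false ∷ A) (x ∷ B) (true ∷ A′) (true ∷ B′)))
      ≈ pow (free (s ∷ [])) * (fanKL m * firstBlock false 0 (blocks x A B)) + pow (free (s ∷ [])) * firstBlock true m (blocks x A B)
    pieces true  = trans (drop₂₃ (∑²-zero k) (∑²-zero k)) (+-cong
      (trans (∑²-zero k) (sym (trans (*-congˡ (trans (*-congˡ (firstBlock-spoke 0 A B)) (zeroʳ _))) (zeroʳ _))))
      (stay true ≡.refl))
    pieces false = trans (drop₂₃ (∑²-zero k) (∑²-zero k)) (+-cong leave (stay false ≡.refl))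
  flatSum≈ {suc k} false false m (false ∷ A) (true ∷ B) _ =
    trans (∑²-split (summand false m (suc (freeBlocks true A B)) (false ∷ A) (true ∷ B)))
      -- The fourth choice has the path edge and the second spoke but not the first: two edges of a
      -- triangle.
      (trans (drop₄ (∑²-zero k)) (trans
        (+-cong (+-cong (trans (∑²-zero k) (sym (firstBlock-spoke (suc m) A B))) (flatSum≈ true true (suc m) A B ≡.refl))
                (trans (∑²-zero k) (sym (trans (*-congˡ (firstBlock-spoke m A B)) (zeroʳ b)))))
        (sym (firstBlock-run m (blocks true A B)))))
  flatSum≈ {suc k} false false m (false ∷ A) (false ∷ B) _ =
    trans (∑²-split (summand false m (suc (freeBlocks false A B)) (false ∷ A) (false ∷ B)))
      (trans (drop₄ (∑²-zero k)) (trans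
        (+-cong (+-cong (flatSum≈ false false (suc m) A B ≡.refl) (flatSum≈ false true (suc m) A B ≡.refl))
                (trans (∑²-cong (λ A′ B′ → trans (summand-close false false false m A B ≡.refl A′ B′) (*-congʳ (*-identityʳ b))))
                  (trans (∑²-* b (summand false m (freeBlocks false A B) A B)) (*-congˡ (flatSum≈ false false m A B ≡.refl)))))
        (sym (firstBlock-run m (blocks false A B)))))

  flatSum-total : ∀ {k} c (A B : Subset k) →
    when (not c) (flatSum false 0 (freeBlocks c A B) A B) + flatSum true 0 (freeBlocks c A B) A B ≈ fanSum (blocks c A B) 0
  flatSum-total c A B = trans (+-cong (off c) (flatSum≈ c true 0 A B (implies-true c)))
    (trans (trans (+-comm _ _) (+-congˡ (sym (*-identityˡ _)))) (trans (sym (firstBlock-hub 0 (blocks c A B))) (*-identityˡ _)))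
    where
    off : ∀ c → when (not c) (flatSum false 0 (freeBlocks c A B) A B) ≈ firstBlock false 0 (blocks c A B)
    off true  = sym (firstBlock-spoke 0 A B)
    off false = flatSum≈ false false 0 A B ≡.refl

-- Flats of the fan

freeBlocks-spoke : ∀ {k} (A B : Subset k) → local false A B ≡ true → suc (freeBlocks true A B) ≡ freeBlocks false A B
freeBlocks-spoke []          []          _ = ≡.refl
freeBlocks-spoke (false ∷ A) (_ ∷ B)     _ = ≡.refl
-- In a flat the path edge without the first spoke excludes the second spoke too, so no vertex of
-- the block has one.
freeBlocks-spoke (true ∷ A)  (false ∷ B) l = freeBlocks-spoke A B l

freeBlocks-spoke-< : ∀ {k} (A B : Subset k) → local false A B ≡ true → freeBlocks true A B < freeBlocks false A B
freeBlocks-spoke-< A B l = ℕ.≤-reflexive (freeBlocks-spoke A B l)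

freeBlocks-path-< : ∀ {k} c (A B : Subset k) i → local c A B ≡ true → lookup A i ≡ false →
                    freeBlocks c (A ∪ ⁅ i ⁆) B < freeBlocks c A B
freeBlocks-path-< c (y ∷ A) (x ∷ B) (suc i) l a = go c y x l
  where
  go : ∀ c y x → local c (y ∷ A) (x ∷ B) ≡ true →
       freeBlocks c ((y ∷ A) ∪ (false ∷ ⁅ i ⁆)) (x ∷ B) < freeBlocks c (y ∷ A) (x ∷ B)
  go true  true  true  l = freeBlocks-path-< true A B i l a
  go false true  false l = freeBlocks-path-< false A B i l a
  go true  false false l = freeBlocks-path-< false A B i l a
  go false false x     l = s≤s (freeBlocks-path-< x A B i (proj₂ (∧-true {consistent false false x} l)) a)
freeBlocks-path-< c (false ∷ A) (x ∷ B) zero l _ rewrite ∪-identityʳ A = go c x l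
  where
  go : ∀ c x → local c (false ∷ A) (x ∷ B) ≡ true → freeBlocks (c ∨ x) A B < free (c ∷ blocks x A B)
  go true  false l = freeBlocks-spoke-< A B l
  go false x     l = ℕ.≤-refl

freeBlocks-spokes-< : ∀ {k} c (A B : Subset k) i → local c A B ≡ true → lookup B i ≡ false →
                      freeBlocks c A (B ∪ ⁅ i ⁆) < freeBlocks c A B
freeBlocks-spokes-< c (y ∷ A) (x ∷ B) (suc i) l b rewrite ∨-identityʳ x = go c y x l
  where
  go : ∀ c y x → local c (y ∷ A) (x ∷ B) ≡ true → freeBlocks c (y ∷ A) (x ∷ (B ∪ ⁅ i ⁆)) < freeBlocks c (y ∷ A) (x ∷ B)
  go true  true  true  l = freeBlocks-spokes-< true A B i l b
  go false true  false l = freeBlocks-spokes-< false A B i l b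
  go true  false false l = freeBlocks-spokes-< false A B i l b
  go false false x     l = s≤s (freeBlocks-spokes-< x A B i (proj₂ (∧-true {consistent false false x} l)) b)
freeBlocks-spokes-< c (y ∷ A) (false ∷ B) zero l _ rewrite ∪-identityʳ B = go c y l
  where
  go : ∀ c y → local c (y ∷ A) (false ∷ B) ≡ true → freeBlocks c (y ∷ A) (true ∷ B) < freeBlocks c (y ∷ A) (false ∷ B)
  go true  false l = freeBlocks-spoke-< A B l
  go false false l = s≤s (freeBlocks-spoke-< A B l)
  go false true  l = freeBlocks-spoke-< A B l

-- A missing edge whose addition keeps the rank. The first spoke has its own case because, one
-- vertex earlier on the path, its bit becomes the head of the spokes.
Violation : ∀ {k} → Bool → Subset k → Subset k → Set
Violation c A B = (c ≡ false × freeBlocks true A B ≡ freeBlocks c A B)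
                ⊎ (∃ λ i → lookup A i ≡ false × freeBlocks c (A ∪ ⁅ i ⁆) B ≡ freeBlocks c A B)
                ⊎ (∃ λ i → lookup B i ≡ false × freeBlocks c A (B ∪ ⁅ i ⁆) ≡ freeBlocks c A B)

-- In a triangle with exactly two edges, the third joins vertices that already lie in one component.
violation : ∀ {k} c (A B : Subset k) → local c A B ≡ false → Violation c A B
violation c [] [] ()
violation true  (false ∷ A) (true ∷ B)  l = inj₂ (inj₁ (zero , ≡.refl , ≡.cong (λ X → freeBlocks true X B) (∪-identityʳ A)))
violation true  (true ∷ A)  (false ∷ B) l = inj₂ (inj₂ (zero , ≡.refl , ≡.cong (freeBlocks true A) (∪-identityʳ B)))
violation false (true ∷ A)  (true ∷ B)  l = inj₁ (≡.refl , ≡.refl)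
violation true  (true ∷ A)  (true ∷ B)  l with violation true A B l
... | inj₂ (inj₁ (i , a , e)) = inj₂ (inj₁ (suc i , a , e))
... | inj₂ (inj₂ (i , b , e)) = inj₂ (inj₂ (suc i , b , e))
violation false (true ∷ A)  (false ∷ B) l with violation false A B l
... | inj₁ (_ , e)            = inj₁ (≡.refl , e)
... | inj₂ (inj₁ (i , a , e)) = inj₂ (inj₁ (suc i , a , e))
... | inj₂ (inj₂ (i , b , e)) = inj₂ (inj₂ (suc i , b , e))
violation true  (false ∷ A) (false ∷ B) l with violation false A B l
... | inj₁ (_ , e)            = inj₂ (inj₂ (zero , ≡.refl , ≡.trans (≡.cong (freeBlocks true A) (∪-identityʳ B)) e))
... | inj₂ (inj₁ (i , a , e)) = inj₂ (inj₁ (suc i , a , e))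
... | inj₂ (inj₂ (i , b , e)) = inj₂ (inj₂ (suc i , b , e))
violation false (false ∷ A) (true ∷ B)  l with violation true A B l
... | inj₂ (inj₁ (i , a , e)) = inj₂ (inj₁ (suc i , a , ≡.cong suc e))
... | inj₂ (inj₂ (i , b , e)) = inj₂ (inj₂ (suc i , b , ≡.cong suc e))
violation false (false ∷ A) (false ∷ B) l with violation false A B l
... | inj₁ (_ , e)            = inj₂ (inj₂ (zero , ≡.refl , ≡.cong suc (≡.trans (≡.cong (freeBlocks true A) (∪-identityʳ B)) e)))
... | inj₂ (inj₁ (i , a , e)) = inj₂ (inj₁ (suc i , a , ≡.cong suc e))
... | inj₂ (inj₂ (i , b , e)) = inj₂ (inj₂ (suc i , b , ≡.cong suc e))

freeBlocks-≤ : ∀ {k} c (A B : Subset k) → freeBlocks c A B ≤ suc k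
freeBlocks-≤ true  []          []      = z≤n
freeBlocks-≤ false []          []      = ℕ.≤-refl
freeBlocks-≤ c     (true ∷ A)  (x ∷ B) = ℕ.m≤n⇒m≤1+n (freeBlocks-≤ (c ∨ x) A B)
freeBlocks-≤ true  (false ∷ A) (x ∷ B) = ℕ.m≤n⇒m≤1+n (freeBlocks-≤ x A B)
freeBlocks-≤ false (false ∷ A) (x ∷ B) = s≤s (freeBlocks-≤ x A B)

≢⇒≡ᵇ-false : ∀ x y → x ≢ y → (x ℕ.≡ᵇ y) ≡ false
≢⇒≡ᵇ-false zero    zero    ne = ⊥-elim (ne ≡.refl)
≢⇒≡ᵇ-false zero    (suc y) ne = ≡.refl
≢⇒≡ᵇ-false (suc x) zero    ne = ≡.refl
≢⇒≡ᵇ-false (suc x) (suc y) ne = ≢⇒≡ᵇ-false x y (ne ∘ ≡.cong suc)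

∪-⁅↑ˡ⁆ : ∀ {k n} (A : Subset k) (X : Subset n) i → (A ++ X) ∪ ⁅ i ↑ˡ n ⁆ ≡ (A ∪ ⁅ i ⁆) ++ X
∪-⁅↑ˡ⁆ (a ∷ A) X zero    = ≡.cong ((a ∨ true) ∷_) (≡.trans (∪-identityʳ (A ++ X)) (≡.cong (_++ X) (≡.sym (∪-identityʳ A))))
∪-⁅↑ˡ⁆ (a ∷ A) X (suc i) = ≡.cong ((a ∨ false) ∷_) (∪-⁅↑ˡ⁆ A X i)

∪-⁅↑ʳ⁆ : ∀ {k n} (A : Subset k) (X : Subset n) i → (A ++ X) ∪ ⁅ k ↑ʳ i ⁆ ≡ A ++ (X ∪ ⁅ i ⁆)
∪-⁅↑ʳ⁆ []      X i = ≡.refl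
∪-⁅↑ʳ⁆ (a ∷ A) X i = ≡.cong₂ _∷_ (∨-identityʳ a) (∪-⁅↑ʳ⁆ A X i)

∪-++ : ∀ {k n} (A A′ : Subset k) (X X′ : Subset n) → (A ++ X) ∪ (A′ ++ X′) ≡ (A ∪ A′) ++ (X ∪ X′)
∪-++ []      []        X X′ = ≡.refl
∪-++ (a ∷ A) (a′ ∷ A′) X X′ = ≡.cong ((a ∨ a′) ∷_) (∪-++ A A′ X X′)

sub-++ : ∀ {k n} (A A′ : Subset k) (X X′ : Subset n) → sub (A ++ X) (A′ ++ X′) ≡ sub A A′ ∧ sub X X′
sub-++ []          []           X X′ = ≡.refl
sub-++ (false ∷ A) (_ ∷ A′)     X X′ = sub-++ A A′ X X′
sub-++ (true ∷ A)  (true ∷ A′)  X X′ = sub-++ A A′ X X′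
sub-++ (true ∷ A)  (false ∷ A′) X X′ = ≡.refl

allF-+ : ∀ k {n} (f : Fin (k ℕ.+ n) → Bool) → allF f ≡ allF (λ i → f (i ↑ˡ n)) ∧ allF (λ i → f (k ↑ʳ i))
allF-+ zero    f = ≡.refl
allF-+ (suc k) f = ≡.trans (≡.cong (f zero ∧_) (allF-+ k (f ∘ suc))) (≡.sym (∧-assoc (f zero) _ _))

module FanFlats (k : ℕ) (rank : Subset (k ℕ.+ suc k) → ℕ)
  (rank≡ : ∀ A c B → rank (A ++ (c ∷ B)) ≡ suc k ∸ freeBlocks c A B) where

  opens : (F : Subset (k ℕ.+ suc k)) → Fin (k ℕ.+ suc k) → Bool
  opens F e = lookup F e ∨ not (rank (F ∪ ⁅ e ⁆) ℕ.≡ᵇ rank F)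

  flat≡local : ∀ A c B → allF (opens (A ++ (c ∷ B))) ≡ local c A B
  flat≡local A c B = ≡.trans (≡.trans (allF-+ k (opens F))
      (≡.cong₂ _∧_ (allF-cong path) (≡.cong₂ _∧_ spoke (allF-cong spokes))))
      (go (local c A B) ≡.refl)
    where
    F : Subset (k ℕ.+ suc k)
    F = A ++ (c ∷ B)

    drops : ℕ → Bool
    drops j = not (j ℕ.≡ᵇ freeBlocks c A B)

    pathᵇ spokesᵇ : Fin k → Bool
    pathᵇ i = lookup A i ∨ drops (freeBlocks c (A ∪ ⁅ i ⁆) B)
    spokesᵇ i = lookup B i ∨ drops (freeBlocks c A (B ∪ ⁅ i ⁆))
    spokeᵇ : Bool
    spokeᵇ = c ∨ drops (freeBlocks true A B)

    ≡ᵇ-∸ˡ : ∀ n x y → x ≤ n → y ≤ n → (n ∸ x ℕ.≡ᵇ n ∸ y) ≡ (x ℕ.≡ᵇ y)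
    ≡ᵇ-∸ˡ n x y x≤n y≤n with x ℕ.≟ y
    ... | yes ≡.refl = ≡.trans (≡ᵇ-refl (n ∸ x)) (≡.sym (≡ᵇ-refl x))
    ... | no x≢y   = ≡.trans (≢⇒≡ᵇ-false _ _ (λ e → x≢y (ℕ.∸-cancelˡ-≡ x≤n y≤n e))) (≡.sym (≢⇒≡ᵇ-false x y x≢y))

    opens≡ : ∀ e x A′ c′ B′ → lookup F e ≡ x → F ∪ ⁅ e ⁆ ≡ A′ ++ (c′ ∷ B′) → opens F e ≡ x ∨ drops (freeBlocks c′ A′ B′)
    opens≡ e x A′ c′ B′ l u = ≡.cong₂ (λ x y → x ∨ not y) l
      (≡.trans (≡.cong₂ ℕ._≡ᵇ_ (≡.trans (≡.cong rank u) (rank≡ A′ c′ B′)) (rank≡ A c B))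
        (≡ᵇ-∸ˡ (suc k) _ _ (freeBlocks-≤ c′ A′ B′) (freeBlocks-≤ c A B)))

    path : ∀ i → opens F (i ↑ˡ suc k) ≡ pathᵇ i
    path i = opens≡ _ _ (A ∪ ⁅ i ⁆) c B (lookup-++ˡ A (c ∷ B) i) (∪-⁅↑ˡ⁆ A (c ∷ B) i)

    spoke : opens F (k ↑ʳ zero) ≡ spokeᵇ
    spoke = opens≡ _ _ A true B (lookup-++ʳ A (c ∷ B) zero)
      (≡.trans (∪-⁅↑ʳ⁆ A (c ∷ B) zero) (≡.cong₂ (λ x X → A ++ (x ∷ X)) (∨-zeroʳ c) (∪-identityʳ B)))

    spokes : ∀ i → opens F (k ↑ʳ suc i) ≡ spokesᵇ i
    spokes i = opens≡ _ _ A c (B ∪ ⁅ i ⁆) (lookup-++ʳ A (c ∷ B) (suc i))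
      (≡.trans (∪-⁅↑ʳ⁆ A (c ∷ B) (suc i)) (≡.cong (λ x → A ++ (x ∷ (B ∪ ⁅ i ⁆))) (∨-identityʳ c)))

    drops-< : ∀ x j → (x ≡ false → j < freeBlocks c A B) → x ∨ drops j ≡ true
    drops-< true  j lt = ≡.refl
    drops-< false j lt = ≡.cong not (≢⇒≡ᵇ-false j _ (ℕ.<⇒≢ (lt ≡.refl)))

    kept : ∀ x j → x ≡ false → j ≡ freeBlocks c A B → x ∨ drops j ≡ false
    kept x j ≡.refl ≡.refl = ≡.cong not (≡ᵇ-refl j)

    allF-false : ∀ {m} (f : Fin m → Bool) i → f i ≡ false → allF f ≡ false
    allF-false f zero    e = ≡.cong (_∧ allF (f ∘ suc)) e
    allF-false f (suc i) e with f zero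
    ... | true  = allF-false (f ∘ suc) i e
    ... | false = ≡.refl

    go : ∀ l → local c A B ≡ l → allF pathᵇ ∧ (spokeᵇ ∧ allF spokesᵇ) ≡ l
    go true l = ≡.cong₂ _∧_
      (allF-tabulate pathᵇ (λ i → drops-< (lookup A i) _ (freeBlocks-path-< c A B i l)))
      (≡.cong₂ _∧_ (drops-< c (freeBlocks true A B) (λ { ≡.refl → freeBlocks-spoke-< A B l }))
        (allF-tabulate spokesᵇ (λ i → drops-< (lookup B i) _ (freeBlocks-spokes-< c A B i l))))
    go false l with violation c A B l
    ... | inj₁ (c≡ , e) = ≡.trans (≡.cong (λ z → allF pathᵇ ∧ (z ∧ allF spokesᵇ)) (kept c _ c≡ e)) (∧-zeroʳ (allF pathᵇ))
    ... | inj₂ (inj₁ (i , a , e)) = ≡.cong (_∧ (spokeᵇ ∧ allF spokesᵇ)) (allF-false pathᵇ i (kept (lookup A i) _ a e))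
    ... | inj₂ (inj₂ (i , b , e)) = ≡.trans (≡.cong (λ z → allF pathᵇ ∧ (spokeᵇ ∧ z)) (allF-false spokesᵇ i (kept (lookup B i) _ b e)))
        (≡.trans (≡.cong (allF pathᵇ ∧_) (∧-zeroʳ spokeᵇ)) (∧-zeroʳ (allF pathᵇ)))

-- Connected components by label propagation

-- The label iteration behind components is private, so relabel is left to be inferred from the
-- goal of components≡, in which the number of rounds and the initial labels are abstracted.
mutual
  relabel : (G : Graph) → Subset (m G) → ℕ → (ℕ → ℕ) → ℕ → ℕ
  relabel = _

  components≡ : ∀ G S → components G S ≡
                length (filterB (λ x → relabel G S (V G) (λ y → y) x ℕ.≡ᵇ x) (upTo (V G)))
  components≡ G S with V G | (λ (y : ℕ) → y) | ℕ._≡ᵇ_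
  ... | v | lab | _≟_ = ≡.refl

module Relabelling (G : Graph) (S : Subset (m G)) where

  Edge : ℕ → ℕ → Set
  Edge u v = ∃ λ e → lookup S e ≡ true × ends G e ≡ (u , v)

  round : (ℕ → ℕ) → ℕ → ℕ
  round lab = relabel G S 1 lab

  private
    nbrs : (ℕ → ℕ) → ℕ → Fin (m G) → List ℕ
    nbrs lab x e = if e ∈ᵇ S
                   then ((if proj₁ (ends G e) ℕ.≡ᵇ x then lab (proj₂ (ends G e)) ∷ [] else [])
                   List.++ (if proj₂ (ends G e) ℕ.≡ᵇ x then lab (proj₁ (ends G e)) ∷ [] else []))
                   else []

    min-≤-init : ∀ z xs → foldr _⊓_ z xs ≤ z
    min-≤-init z []       = ℕ.≤-refl
    min-≤-init z (x ∷ xs) = ℕ.≤-trans (ℕ.m⊓n≤n x _) (min-≤-init z xs)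

    min-≤-∈ : ∀ z {y xs} → y ∈ xs → foldr _⊓_ z xs ≤ y
    min-≤-∈ z (here ≡.refl)       = ℕ.m⊓n≤m _ _
    min-≤-∈ z (there {x} y∈xs) = ℕ.≤-trans (ℕ.m⊓n≤n x _) (min-≤-∈ z y∈xs)

    ≤-min : ∀ {l z} xs → l ≤ z → (∀ {y} → y ∈ xs → l ≤ y) → l ≤ foldr _⊓_ z xs
    ≤-min []       l≤z l≤ = l≤z
    ≤-min (x ∷ xs) l≤z l≤ = ℕ.⊓-glb (l≤ (here ≡.refl)) (≤-min xs l≤z (l≤ ∘ there))

    ∈-nbrs : ∀ lab x e {y} → y ∈ nbrs lab x e →
             ∃ λ u → y ≡ lab u × (Edge x u ⊎ Edge u x)
    ∈-nbrs lab x e y∈ with lookup S e in inS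
    ∈-nbrs lab x e y∈ | true with ∈-++⁻ (if proj₁ (ends G e) ℕ.≡ᵇ x then lab (proj₂ (ends G e)) ∷ [] else []) y∈
    ∈-nbrs lab x e y∈ | true | inj₁ y∈ˡ with proj₁ (ends G e) ℕ.≡ᵇ x in eq
    ∈-nbrs lab x e y∈ | true | inj₁ (here y≡) | true =
      _ , y≡ , inj₁ (e , inS , ≡.cong (_, proj₂ (ends G e)) (ℕ.≡ᵇ⇒≡ _ x (≡.subst Bool.T (≡.sym eq) _)))
    ∈-nbrs lab x e y∈ | true | inj₂ y∈ʳ with proj₂ (ends G e) ℕ.≡ᵇ x in eq
    ∈-nbrs lab x e y∈ | true | inj₂ (here y≡) | true =
      _ , y≡ , inj₂ (e , inS , ≡.cong (proj₁ (ends G e) ,_) (ℕ.≡ᵇ⇒≡ _ x (≡.subst Bool.T (≡.sym eq) _)))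

    nbrs-∈ : ∀ lab {u v} → Edge u v → (∃ λ e → lab v ∈ nbrs lab u e) × (∃ λ e → lab u ∈ nbrs lab v e)
    nbrs-∈ lab {u} {v} (e , inS , eq) = (e , left) , (e , right)
      where
      left : lab v ∈ nbrs lab u e
      left rewrite inS | eq | ≡ᵇ-refl u = here ≡.refl
      right : lab u ∈ nbrs lab v e
      right rewrite inS | eq | ≡ᵇ-refl v = ∈-++⁺ʳ (if u ℕ.≡ᵇ v then lab v ∷ [] else []) (here ≡.refl)

    collect : ∀ lab x {y} → (∃ λ e → y ∈ nbrs lab x e) → y ∈ concatMap (nbrs lab x) (allFin (m G))
    collect lab x (e , y∈) = ∈-concatMap⁺ (nbrs lab x) (Any.map (λ { ≡.refl → y∈ }) (∈-allFin e))

  round-≤ : ∀ lab x → round lab x ≤ lab x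
  round-≤ lab x = min-≤-init (lab x) (concatMap (nbrs lab x) (allFin (m G)))

  round-edge : ∀ lab {u v} → Edge u v → round lab u ≤ lab v × round lab v ≤ lab u
  round-edge lab {u} {v} uv = min-≤-∈ (lab u) (collect lab u (proj₁ (nbrs-∈ lab uv)))
                            , min-≤-∈ (lab v) (collect lab v (proj₂ (nbrs-∈ lab uv)))

  ≤-round : ∀ lab {l x} → l ≤ lab x → (∀ u → Edge x u ⊎ Edge u x → l ≤ lab u) → l ≤ round lab x
  ≤-round lab {l} {x} l≤x l≤ = ≤-min _ l≤x bound
    where
    bound : ∀ {y} → y ∈ concatMap (nbrs lab x) (allFin (m G)) → l ≤ y
    bound y∈ with satisfied (∈-concatMap⁻ (nbrs lab x) {xs = allFin (m G)} y∈)
    ... | e , y∈e with ∈-nbrs lab x e y∈e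
    ... | u , ≡.refl , xu = l≤ u xu

  label : ℕ → ℕ → ℕ
  label j = relabel G S j (λ y → y)

  -- `relabel` applies its first round to the initial labels and recurses on the result; the
  -- estimates need the last round outermost.
  label-suc : ∀ j x → label (suc j) x ≡ round (label j) x
  label-suc j = go j (λ y → y)
    where
    go : ∀ j lab x → relabel G S (suc j) lab x ≡ round (relabel G S j lab) x
    go zero    lab x = ≡.refl
    go (suc j) lab x = go j (round lab) x

  label-≤ : ∀ j x → label (suc j) x ≤ label j x
  label-≤ j x = ℕ.≤-trans (ℕ.≤-reflexive (label-suc j x)) (round-≤ (label j) x)

  label-edge : ∀ j {u v} → Edge u v → label (suc j) u ≤ label j v × label (suc j) v ≤ label j u
  label-edge j {u} {v} uv = ℕ.≤-trans (ℕ.≤-reflexive (label-suc j u)) (proj₁ (round-edge (label j) uv))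
                          , ℕ.≤-trans (ℕ.≤-reflexive (label-suc j v)) (proj₂ (round-edge (label j) uv))

  -- Labels travel along edges only, so inside a set closed under edges they never fall below its
  -- least vertex.
  ≤-label : (P : ℕ → Set) → (∀ {u v} → Edge u v → (P u → P v) × (P v → P u)) → ∀ {l} → (∀ v → P v → l ≤ v) →
            ∀ j v → P v → l ≤ label j v
  ≤-label P closed l≤ zero    v Pv = l≤ v Pv
  ≤-label P closed l≤ (suc j) v Pv = ≡.subst (_ ≤_) (≡.sym (label-suc j v))
    (≤-round (label j) (≤-label P closed l≤ j v Pv) (λ u → λ where
      (inj₁ vu) → ≤-label P closed l≤ j u (proj₁ (closed vu) Pv)
      (inj₂ uv) → ≤-label P closed l≤ j u (proj₂ (closed uv) Pv)))

-- Components of subgraphs of the fan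

bitAt : ∀ {n} → Vec Bool n → ℕ → Bool
bitAt []      _       = false
bitAt (x ∷ X) zero    = x
bitAt (x ∷ X) (suc j) = bitAt X j

bitAt-lookup : ∀ {n} (X : Vec Bool n) i → bitAt X (toℕ i) ≡ lookup X i
bitAt-lookup (x ∷ X) zero    = ≡.refl
bitAt-lookup (x ∷ X) (suc i) = bitAt-lookup X i

bitAt-true : ∀ {n} (X : Vec Bool n) j → bitAt X j ≡ true → ∃ λ i → toℕ i ≡ j × lookup X i ≡ true
bitAt-true (x ∷ X) zero    e = zero , ≡.refl , e
bitAt-true (x ∷ X) (suc j) e with bitAt-true X j e
... | i , i≡ , l = suc i , ≡.cong suc i≡ , l

-- `flag` is the head of `blocks`, and `laterBlocks` counts the free blocks of its tail; in this
-- form they match a count that inspects one vertex at a time.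
flag : ∀ {k} → Bool → Subset k → Subset k → Bool
flag c []      []      = c
flag c (y ∷ A) (x ∷ B) = c ∨ (y ∧ flag x A B)

laterBlocks : ∀ {k} → Subset k → Subset k → ℕ
laterBlocks []          []      = 0
laterBlocks (true ∷ A)  (x ∷ B) = laterBlocks A B
laterBlocks (false ∷ A) (x ∷ B) = freeBlocks x A B

flag-∨ : ∀ {k} c x (A B : Subset k) → flag (c ∨ x) A B ≡ c ∨ flag x A B
flag-∨ false x A B = ≡.refl
flag-∨ true  x []      []      = ≡.refl
flag-∨ true  x (y ∷ A) (z ∷ B) = ≡.refl

freeBlocks≡ : ∀ {k} c (A B : Subset k) → freeBlocks c A B ≡ free (flag c A B ∷ []) ℕ.+ laterBlocks A B
freeBlocks≡ true  []          []      = ≡.refl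
freeBlocks≡ false []          []      = ≡.refl
freeBlocks≡ c     (true ∷ A)  (x ∷ B) = ≡.trans (freeBlocks≡ (c ∨ x) A B)
  (≡.cong (λ z → free (z ∷ []) ℕ.+ laterBlocks A B) (flag-∨ c x A B))
freeBlocks≡ true  (false ∷ A) (x ∷ B) = ≡.refl
freeBlocks≡ false (false ∷ A) (x ∷ B) = ≡.refl

module FanComponents (k : ℕ) (end : Fin (k ℕ.+ suc k) → ℕ × ℕ)
  (end-path  : ∀ i → end (i ↑ˡ suc k) ≡ (suc (toℕ i) , suc (suc (toℕ i))))
  (end-spoke : ∀ i → end (k ↑ʳ i) ≡ (0 , suc (toℕ i))) where

  G : Graph
  G = record { V = suc (suc k) ; m = k ℕ.+ suc k ; ends = end }

  module _ (A₀ : Subset k) (c₀ : Bool) (B₀ : Subset k) where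
    private
      S : Subset (k ℕ.+ suc k)
      S = A₀ ++ (c₀ ∷ B₀)

      open Relabelling G S

      -- The leading `false` aligns indices with vertices: `pathBit w` concerns {w, w + 1},
      -- `spokeBit w` concerns {0, w}.
      pathBit spokeBit : ℕ → Bool
      pathBit  = bitAt (false ∷ A₀)
      spokeBit = bitAt (false ∷ c₀ ∷ B₀)

      path-edge : ∀ w → pathBit w ≡ true → Edge w (suc w)
      path-edge (suc w) e with bitAt-true A₀ w e
      ... | i , ≡.refl , l = i ↑ˡ suc k , ≡.trans (lookup-++ˡ A₀ (c₀ ∷ B₀) i) l , end-path i

      spoke-edge : ∀ w → spokeBit w ≡ true → Edge 0 w
      spoke-edge (suc w) e with bitAt-true (c₀ ∷ B₀) w e
      ... | i , ≡.refl , l = k ↑ʳ i , ≡.trans (lookup-++ʳ A₀ (c₀ ∷ B₀) i) l , end-spoke i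

      edge-cases : ∀ {u v} → Edge u v → (v ≡ suc u × pathBit u ≡ true) ⊎ (u ≡ 0 × spokeBit v ≡ true)
      edge-cases (e , inS , eq) with splitAt k e in se
      ... | inj₁ i with splitAt⁻¹-↑ˡ {i = e} se
      ... | ≡.refl with ≡.trans (≡.sym eq) (end-path i)
      ... | ≡.refl = inj₁ (≡.refl , ≡.trans (bitAt-lookup A₀ i) (≡.trans (≡.sym (lookup-++ˡ A₀ (c₀ ∷ B₀) i)) inS))
      edge-cases (e , inS , eq) | inj₂ i with splitAt⁻¹-↑ʳ {i = e} se
      ... | ≡.refl with ≡.trans (≡.sym eq) (end-spoke i)
      ... | ≡.refl = inj₂ (≡.refl , ≡.trans (bitAt-lookup (c₀ ∷ B₀) i) (≡.trans (≡.sym (lookup-++ʳ A₀ (c₀ ∷ B₀) i)) inS))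

      -- Inductions run over the part of the path from vertex o on, while the labels remain those of
      -- the whole fan.
      record Suffix {l} (o : ℕ) (c : Bool) (A B : Subset l) : Set where
        field
          path  : ∀ w → pathBit (o ℕ.+ w) ≡ bitAt A w
          spoke : ∀ w → spokeBit (o ℕ.+ w) ≡ bitAt (c ∷ B) w
      open Suffix

      tail : ∀ {l o c y x} {A B : Subset l} → Suffix o c (y ∷ A) (x ∷ B) → Suffix (suc o) x A B
      tail {o = o} s .path  w = ≡.trans (≡.cong pathBit (≡.sym (ℕ.+-suc o w))) (path s (suc w))
      tail {o = o} s .spoke w = ≡.trans (≡.cong spokeBit (≡.sym (ℕ.+-suc o w))) (spoke s (suc w))

      head-path : ∀ {l o c y x} {A B : Subset l} → Suffix o c (y ∷ A) (x ∷ B) → pathBit o ≡ y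
      head-path {o = o} s = ≡.trans (≡.cong pathBit (≡.sym (ℕ.+-identityʳ o))) (path s 0)

      head-spoke : ∀ {l o c} {A B : Subset l} → Suffix o c A B → spokeBit o ≡ c
      head-spoke {o = o} s = ≡.trans (≡.cong spokeBit (≡.sym (ℕ.+-identityʳ o))) (spoke s 0)

      -- The nearest spoke is at most l path edges away, and each edge costs one round.
      reaches-hub : ∀ {l} o c (A B : Subset l) → Suffix o c A B → flag c A B ≡ true → label (suc l) o ≤ 0
      reaches-hub o true [] [] s f = proj₂ (label-edge 0 (spoke-edge o (head-spoke s)))
      reaches-hub o false [] [] s ()
      reaches-hub {suc l} o true (y ∷ A) (x ∷ B) s f =
        ℕ.≤-trans (proj₂ (label-edge (suc l) (spoke-edge o (head-spoke s)))) (≤-label-0 (suc l))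
        where
        ≤-label-0 : ∀ j → label j 0 ≤ 0
        ≤-label-0 zero    = z≤n
        ≤-label-0 (suc j) = ℕ.≤-trans (label-≤ j 0) (≤-label-0 j)
      reaches-hub {suc l} o false (true ∷ A) (x ∷ B) s f =
        ℕ.≤-trans (proj₁ (label-edge (suc l) (path-edge o (head-path s)))) (reaches-hub (suc o) x A B (tail s) f)

      Connected : ℕ → ℕ → Set
      Connected o v = o ≤ v × (∀ w → o ≤ w → w < v → pathBit w ≡ true)

      no-spoke : ∀ {l} o c (A B : Subset l) → Suffix o c A B → flag c A B ≡ false →
                 ∀ v → Connected o v → spokeBit v ≢ true
      no-spoke o c A B s f v (o≤v , con) sp with o ℕ.≟ v
      no-spoke o c []      []      s f v (o≤v , con) sp | yes ≡.refl with ≡.trans (≡.sym sp) (≡.trans (head-spoke s) f)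
      ... | ()
      no-spoke o c (y ∷ A) (x ∷ B) s f v (o≤v , con) sp | yes ≡.refl
        with ≡.trans (≡.sym f) (≡.cong (_∨ (y ∧ flag x A B)) (≡.trans (≡.sym (head-spoke s)) sp))
      ... | ()
      no-spoke o c []      []      s f v (o≤v , con) sp | no o≢v
        with ≡.trans (≡.sym (con o ℕ.≤-refl (ℕ.≤∧≢⇒< o≤v o≢v))) (≡.trans (≡.cong pathBit (≡.sym (ℕ.+-identityʳ o))) (path s 0))
      ... | ()
      no-spoke o false (y ∷ A) (x ∷ B) s f v (o≤v , con) sp | no o≢v =
        no-spoke (suc o) x A B (tail s)
          (≡.trans (≡.cong (_∧ flag x A B) (≡.trans (≡.sym (con o ℕ.≤-refl (ℕ.≤∧≢⇒< o≤v o≢v))) (head-path s))) f)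
          v (ℕ.≤∧≢⇒< o≤v o≢v , λ w o<w → con w (ℕ.<⇒≤ o<w)) sp

      -- An interval of path vertices can be left to the left, which the absent path edge forbids,
      -- to the right, which only lengthens it, or by a spoke, which the second hypothesis forbids.
      closed : ∀ o → pathBit o ≡ false → (∀ v → Connected (suc o) v → spokeBit v ≢ true) →
               ∀ {u v} → Edge u v → (Connected (suc o) u → Connected (suc o) v) × (Connected (suc o) v → Connected (suc o) u)
      closed o po ns {u} {v} uv with edge-cases uv
      ... | inj₂ (≡.refl , sp) = (λ { (() , _) }) , (λ Cv → ⊥-elim (ns v Cv sp))
      ... | inj₁ (≡.refl , pu) = up , down
        where
        up : Connected (suc o) u → Connected (suc o) (suc u)
        up (o<u , con) = ℕ.m≤n⇒m≤1+n o<u , next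
          where
          next : ∀ w → suc o ≤ w → w < suc u → pathBit w ≡ true
          next w o<w (s≤s w≤u) with w ℕ.≟ u
          ... | yes ≡.refl = pu
          ... | no w≢u   = con w o<w (ℕ.≤∧≢⇒< w≤u w≢u)
        down : Connected (suc o) (suc u) → Connected (suc o) u
        down (s≤s o≤u , con) with o ℕ.≟ u
        ... | yes ≡.refl with ≡.trans (≡.sym po) pu
        ... | ()
        down (s≤s o≤u , con) | no o≢u = ℕ.≤∧≢⇒< o≤u o≢u , λ w o<w w<u → con w o<w (ℕ.m≤n⇒m≤1+n w<u)

      label-mono : ∀ i j → i ≤ j → ∀ x → label j x ≤ label i x
      label-mono _ zero z≤n x = ℕ.≤-refl
      label-mono i (suc j) i≤ x with i ℕ.≟ suc j
      ... | yes ≡.refl = ℕ.≤-refl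
      ... | no i≢    = ℕ.≤-trans (label-≤ j x) (label-mono i j (ℕ.≤-pred (ℕ.≤∧≢⇒< i≤ i≢)) x)

      rounds : ℕ
      rounds = suc (suc k)

      isLeast : ℕ → Bool
      isLeast x = label rounds x ℕ.≡ᵇ x

      -- A path edge to o lowers the label in one round, the hub does so within l + 1 rounds, and l
      -- ≤ k makes these available. Otherwise the block starting at o + 1 is closed under edges.
      least-vertex : ∀ {l} o c (A B : Subset l) → l ≤ k → Suffix (suc o) c A B →
                     isLeast (suc o) ≡ not (pathBit o) ∧ not (flag c A B)
      least-vertex o c A B l≤k s with pathBit o in po
      ... | true = ≢⇒≡ᵇ-false _ _ (ℕ.<⇒≢ (s≤s (ℕ.≤-trans (label-mono 1 rounds (s≤s z≤n) (suc o)) (proj₂ (label-edge 0 (path-edge o po))))))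
      ... | false with flag c A B in fl
      ... | true  = ≢⇒≡ᵇ-false _ _ (ℕ.<⇒≢ (s≤s (ℕ.≤-trans (label-mono _ rounds (s≤s (ℕ.m≤n⇒m≤1+n l≤k)) (suc o))
                      (ℕ.≤-trans (reaches-hub (suc o) c A B s fl) z≤n))))
      ... | false = ≡.trans (≡.cong (ℕ._≡ᵇ suc o) (ℕ.≤-antisym (label-mono 0 rounds z≤n (suc o))
                      (≤-label (Connected (suc o)) (closed o po (no-spoke (suc o) c A B s fl)) (λ _ → proj₁) rounds (suc o)
                        (ℕ.≤-refl , λ w o<w w<o → ⊥-elim (ℕ.<⇒≱ w<o o<w))))) (≡ᵇ-refl (suc o))

      count-∷ : ∀ x xs → length (filterB isLeast (x ∷ xs)) ≡ free (not (isLeast x) ∷ []) ℕ.+ length (filterB isLeast xs)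
      count-∷ x xs with isLeast x
      ... | true  = ≡.refl
      ... | false = ≡.refl

      count : ∀ {l} o c (A B : Subset l) (g : ℕ → ℕ) → l ≤ k → Suffix o c A B → (∀ i → g i ≡ suc o ℕ.+ i) →
              length (filterB isLeast (applyUpTo g l)) ≡ laterBlocks A B
      count o c []      []      g l≤k s g≡ = ≡.refl
      count {suc l} o c (y ∷ A) (x ∷ B) g l<k s g≡ = ≡.trans (count-∷ (g 0) (applyUpTo (g ∘ suc) l))
        (≡.trans (≡.cong₂ ℕ._+_ (≡.cong (λ z → free (not z ∷ [])) least)
          (count (suc o) x A B (g ∘ suc) (ℕ.<⇒≤ l<k) (tail s) (λ i → ≡.trans (g≡ (suc i)) (≡.cong suc (ℕ.+-suc o i)))))
          (tally y))
        where
        least : isLeast (g 0) ≡ not y ∧ not (flag x A B)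
        least = ≡.trans (≡.cong isLeast (≡.trans (g≡ 0) (ℕ.+-identityʳ (suc o))))
          (≡.trans (least-vertex o x A B (ℕ.<⇒≤ l<k) (tail s)) (≡.cong (λ z → not z ∧ not (flag x A B)) (head-path s)))

        tally : ∀ y → free (not (not y ∧ not (flag x A B)) ∷ []) ℕ.+ laterBlocks A B ≡ laterBlocks (y ∷ A) (x ∷ B)
        tally true = ≡.refl
        tally false = ≡.trans (≡.cong (λ z → free (z ∷ []) ℕ.+ laterBlocks A B) (not-involutive (flag x A B))) (≡.sym (freeBlocks≡ x A B))

      whole : Suffix 1 c₀ A₀ B₀
      whole .path  w = ≡.refl
      whole .spoke w = ≡.refl

    -- The additional component is that of the hub.
    components-fan : components G S ≡ suc (freeBlocks c₀ A₀ B₀)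
    components-fan = ≡.trans (components≡ G S) (≡.trans (count-∷ 0 (applyUpTo suc (suc k))) (≡.cong₂ ℕ._+_ zero-least
      (≡.trans (count-∷ 1 (applyUpTo (λ i → 2 ℕ.+ i) k)) (≡.trans (≡.cong₂ ℕ._+_ one-least (count 1 c₀ A₀ B₀ (λ i → 2 ℕ.+ i) ℕ.≤-refl whole (λ _ → ≡.refl)))
        (≡.sym (freeBlocks≡ c₀ A₀ B₀))))))
      where
      zero-least : free (not (isLeast 0) ∷ []) ≡ 1
      zero-least = ≡.cong (λ z → free (not (z ℕ.≡ᵇ 0) ∷ [])) (ℕ.n≤0⇒n≡0 (label-mono 0 rounds z≤n 0))

      one-least : free (not (isLeast 1) ∷ []) ≡ free (flag c₀ A₀ B₀ ∷ [])
      one-least = ≡.cong (λ z → free (z ∷ [])) (≡.trans (≡.cong not (least-vertex 0 c₀ A₀ B₀ ℕ.≤-refl whole)) (not-involutive (flag c₀ A₀ B₀)))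

-- Degree bounds

module Bounds where
  open CommutativeRing ℤ⟦t⟧
  open Convolution ℤ.+-*-commutativeRing using (conv-vanish)
  open Motzkin ℤ⟦t⟧ using (paths; transfer)
  open FanSum ℤ⟦t⟧ using (fanKL; runKL)

  τ : Carrier
  τ = coeff tP

  τ*-suc : ∀ f j → (τ * f) (suc j) ≡ f j
  τ*-suc f j = ≡.trans (ℤ.+-identityˡ _) (≡.trans (*-congʳ {f} coeff-oneP j) (*-identityˡ f j))

  -- `d` bounds twice the exponent, which avoids halves and makes the bounds additive under
  -- products.
  VanishAbove VanishBelow : ℕ → Carrier → Set
  VanishAbove d f = ∀ j → d < j ℕ.+ j → f j ≡ + 0
  VanishBelow d f = ∀ j → j ℕ.+ j < d → f j ≡ + 0

  private
    +-zero² : ∀ {x y} → x ≡ + 0 → y ≡ + 0 → x ℤ.+ y ≡ + 0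
    +-zero² ≡.refl ≡.refl = ≡.refl

    double : ∀ i j → (i ℕ.+ j) ℕ.+ (i ℕ.+ j) ≡ (i ℕ.+ i) ℕ.+ (j ℕ.+ j)
    double = +-*-Solver.solve 2 (λ i j → (i :+ j) :+ (i :+ j) := (i :+ i) :+ (j :+ j)) ≡.refl
      where open +-*-Solver using (_:+_; _:=_)

  vanishAbove-* : ∀ {d e f g} → VanishAbove d f → VanishAbove e g → VanishAbove (d ℕ.+ e) (f * g)
  vanishAbove-* {d} {e} {f} {g} F G n d+e< = conv-vanish n split
    where
    split : ∀ i j → i ℕ.+ j ≡ n → f i ≡ + 0 ⊎ g j ≡ + 0
    split i j ≡.refl with d ℕ.<? i ℕ.+ i
    ... | yes d< = inj₁ (F i d<)
    ... | no  d≮ = inj₂ (G j (ℕ.+-cancelˡ-< d e (j ℕ.+ j) (ℕ.<-≤-trans (≡.subst (d ℕ.+ e <_) (double i j) d+e<)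
                     (ℕ.+-monoˡ-≤ (j ℕ.+ j) (ℕ.≮⇒≥ d≮)))))

  vanishBelow-* : ∀ {d e f g} → VanishBelow d f → VanishBelow e g → VanishBelow (d ℕ.+ e) (f * g)
  vanishBelow-* {d} {e} {f} {g} F G n <d+e = conv-vanish n split
    where
    split : ∀ i j → i ℕ.+ j ≡ n → f i ≡ + 0 ⊎ g j ≡ + 0
    split i j ≡.refl with i ℕ.+ i ℕ.<? d
    ... | yes <d = inj₁ (F i <d)
    ... | no  ≮d = inj₂ (G j (ℕ.+-cancelˡ-< d (j ℕ.+ j) e (ℕ.≤-<-trans (ℕ.+-monoˡ-≤ (j ℕ.+ j) (ℕ.≮⇒≥ ≮d))
                     (≡.subst (_< d ℕ.+ e) (double i j) <d+e))))

  vanishAbove-weaken : ∀ {d e f} → d ≤ e → VanishAbove d f → VanishAbove e f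
  vanishAbove-weaken d≤e F j e< = F j (ℕ.≤-<-trans d≤e e<)

  private
    double-suc : ∀ j → suc j ℕ.+ suc j ≡ 2 ℕ.+ (j ℕ.+ j)
    double-suc j = ≡.cong suc (ℕ.+-suc j j)

  -- Here t marks up steps: with j of them a path from height k has j + k down steps, so 2j + k ≤ n.
  pathsAbove : ∀ n k j → n < j ℕ.+ j ℕ.+ k → paths 1# (1# * τ) n k j ≡ + 0
  pathsAbove zero    zero    (suc j) _ = ≡.refl
  pathsAbove zero    (suc k) j       _ = ≡.refl
  pathsAbove (suc n) zero    (suc j) lt = +-zero²
    (≡.trans (*-identityˡ (x 0) (suc j)) (pathsAbove n 0 (suc j) (ℕ.<-trans (ℕ.n<1+n n) lt)))
    (≡.trans (*-congʳ {x 1} (*-identityˡ τ) (suc j)) (≡.trans (τ*-suc (x 1) j) (pathsAbove n 1 j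
      (ℕ.≤-pred (≡.subst (suc n <_) (≡.trans (ℕ.+-identityʳ _) (≡.trans (double-suc j) (≡.cong suc (ℕ.+-comm 1 _)))) lt)))))
    where
    x : ℕ → Carrier
    x = paths 1# (1# * τ) n
  pathsAbove (suc n) (suc k) j lt = +-zero² (+-zero²
    (≡.trans (*-identityˡ (x (suc k)) j) (pathsAbove n (suc k) j (ℕ.<-trans (ℕ.n<1+n n) lt)))
    (≡.trans (*-congʳ {x (2 ℕ.+ k)} (*-identityˡ τ) j) (up j lt)))
    (pathsAbove n k j (ℕ.≤-pred (≡.subst (suc n <_) (ℕ.+-suc (j ℕ.+ j) k) lt)))
    where
    x : ℕ → Carrier
    x = paths 1# (1# * τ) n
    up : ∀ j → suc n < j ℕ.+ j ℕ.+ suc k → (τ * x (2 ℕ.+ k)) j ≡ + 0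
    up zero    lt = ≡.refl
    up (suc j) lt = ≡.trans (τ*-suc (x (2 ℕ.+ k)) j) (pathsAbove n (2 ℕ.+ k) j
      (ℕ.≤-pred (≡.subst (suc n <_) (≡.trans (≡.cong (ℕ._+ suc k) (double-suc j)) (≡.cong suc (≡.sym (ℕ.+-suc (j ℕ.+ j) (suc k))))) lt)))

  -- Here t marks level and up steps: with j of them there are at most j + k down steps, so n ≤ 2j +
  -- k.
  pathsBelow : ∀ n k j → j ℕ.+ j ℕ.+ k < n → paths τ (τ * 1#) n k j ≡ + 0
  pathsBelow (suc n) k j lt = step k j lt
    where
    x : ℕ → Carrier
    x = paths τ (τ * 1#) n

    level : ∀ k j → j ℕ.+ j ℕ.+ k < suc n → (τ * x k) j ≡ + 0
    level k zero    lt = ≡.refl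
    level k (suc j) lt = ≡.trans (τ*-suc (x k) j) (pathsBelow n k j
      (ℕ.≤-pred (ℕ.≤-trans (s≤s (s≤s (ℕ.n≤1+n _))) (≡.subst (λ i → i ℕ.+ k < suc n) (double-suc j) lt))))

    up : ∀ k j → j ℕ.+ j ℕ.+ k < suc n → (τ * 1# * x (suc k)) j ≡ + 0
    up k zero    lt = *-congʳ {x (suc k)} (*-identityʳ τ) 0
    up k (suc j) lt = ≡.trans (*-congʳ {x (suc k)} (*-identityʳ τ) (suc j)) (≡.trans (τ*-suc (x (suc k)) j) (pathsBelow n (suc k) j
      (ℕ.≤-pred (≡.subst (_< suc n) (≡.trans (≡.cong (ℕ._+ k) (double-suc j)) (≡.cong suc (≡.sym (ℕ.+-suc (j ℕ.+ j) k)))) lt))))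

    step : ∀ k j → j ℕ.+ j ℕ.+ k < suc n → transfer τ (τ * 1#) x k j ≡ + 0
    step zero    j lt = +-zero² (level 0 j lt) (up 0 j lt)
    step (suc k) j lt = +-zero² (+-zero² (level (suc k) j lt) (up (suc k) j lt))
      (pathsBelow n k j (ℕ.≤-pred (≡.subst (_< suc n) (ℕ.+-suc (j ℕ.+ j) k) lt)))

  -- The paths have length m - 1 for m > 0, which makes the bound 2j < m strict.
  fanKLAbove : ∀ m → VanishAbove (m ∸ 1) (fanKL 1# τ m)
  fanKLAbove zero    (suc j) _  = ≡.refl
  fanKLAbove (suc m) j       lt = ≡.trans (*-identityˡ (paths 1# (1# * τ) m 0) j)
    (pathsAbove m 0 j (≡.subst (m <_) (≡.sym (ℕ.+-identityʳ _)) lt))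

  fanKLBelow : ∀ m → VanishBelow m (fanKL τ 1# m)
  fanKLBelow (suc m) zero    lt = ≡.refl
  fanKLBelow (suc m) (suc j) lt = ≡.trans (τ*-suc (paths τ (τ * 1#) m 0) j) (pathsBelow m 0 j
    (ℕ.≤-pred (ℕ.≤-trans (s≤s (s≤s (ℕ.≤-trans (ℕ.≤-reflexive (ℕ.+-identityʳ _)) (ℕ.n≤1+n _)))) (≡.subst (_< suc m) (double-suc j) lt))))

  runKLAbove : ∀ m w → VanishAbove (m ℕ.+ free w ∸ 1) (runKL 1# τ m w)
  runKLAbove m []          = ≡.subst (λ d → VanishAbove (d ∸ 1) (fanKL 1# τ m)) (≡.sym (ℕ.+-identityʳ m)) (fanKLAbove m)
  runKLAbove m (true ∷ w)  = vanishAbove-weaken {f = fanKL 1# τ m * runKL 1# τ 0 w} (pred-+ m (free w))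
    (vanishAbove-* {m ∸ 1} {free w ∸ 1} {fanKL 1# τ m} {runKL 1# τ 0 w} (fanKLAbove m) (runKLAbove 0 w))
    where
    pred-+ : ∀ m n → (m ∸ 1) ℕ.+ (n ∸ 1) ≤ m ℕ.+ n ∸ 1
    pred-+ zero    n = ℕ.≤-refl
    pred-+ (suc m) n = ℕ.+-monoʳ-≤ m (ℕ.m∸n≤m n 1)
  runKLAbove m (false ∷ w) = ≡.subst (λ d → VanishAbove (d ∸ 1) (runKL 1# τ (suc m) w)) (≡.sym (ℕ.+-suc m (free w))) (runKLAbove (suc m) w)

  runKLBelow : ∀ m w → VanishBelow (m ℕ.+ free w) (runKL τ 1# m w)
  runKLBelow m []          = ≡.subst (λ d → VanishBelow d (fanKL τ 1# m)) (≡.sym (ℕ.+-identityʳ m)) (fanKLBelow m)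
  runKLBelow m (true ∷ w)  = vanishBelow-* {m} {free w} {fanKL τ 1# m} {runKL τ 1# 0 w} (fanKLBelow m) (runKLBelow 0 w)
  runKLBelow m (false ∷ w) = ≡.subst (λ d → VanishBelow d (runKL τ 1# (suc m) w)) (≡.sym (ℕ.+-suc m (free w))) (runKLBelow (suc m) w)

  runKL-hub : ∀ w → free w ≡ 0 → runKL 1# τ 0 w ≈ 1#
  runKL-hub []         _ = refl
  runKL-hub (true ∷ w) e = trans (*-identityˡ (runKL 1# τ 0 w)) (runKL-hub w e)

open Bounds using (τ) public

-- The Z-polynomial of the fan

module _ where
  open CommutativeRing ℤ⟦t⟧
  private
    module p = FanSum ℤ⟦t⟧ 1# τ
    module q = FanSum ℤ⟦t⟧ τ 1#
    module pF = FlatSum ℤ⟦t⟧ 1# τ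
    module qF = FlatSum ℤ⟦t⟧ τ 1#
  open SubsetSum ℤ⟦t⟧

  t^≈pow : ∀ n → t^ n ≈ pF.pow n
  t^≈pow zero    = coeff-oneP
  t^≈pow (suc n) = trans shift (*-congˡ {τ} (t^≈pow n))
    where
    shift : t^ (suc n) ≈ τ * t^ n
    shift zero    = ≡.refl
    shift (suc j) = ≡.sym (Bounds.τ*-suc (t^ n) j)

  -- For (t , 1) joins carry no weight, so the sum over flats has the bare q on the right side of
  -- `balanced`.
  1≈pow : ∀ n → 1# ≈ qF.pow n
  1≈pow zero    = refl
  1≈pow (suc n) = trans (1≈pow n) (sym (*-identityˡ (qF.pow n)))

  cut : ∀ k {n} → Subset (k ℕ.+ n) → Subset k × Subset n
  cut zero    F       = [] , F
  cut (suc k) (x ∷ F) = x ∷ proj₁ (cut k F) , proj₂ (cut k F)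

  cut-++ : ∀ {k n} (A : Subset k) (X : Subset n) → cut k (A ++ X) ≡ (A , X)
  cut-++ []      X = ≡.refl
  cut-++ (a ∷ A) X = ≡.cong (λ z → a ∷ proj₁ z , proj₂ z) (cut-++ A X)

  ++-cut : ∀ k {n} (F : Subset (k ℕ.+ n)) → ∃₂ λ (A : Subset k) (X : Subset n) → F ≡ A ++ X
  ++-cut zero    F       = [] , F , ≡.refl
  ++-cut (suc k) (x ∷ F) with ++-cut k F
  ... | A , X , ≡.refl = x ∷ A , X , ≡.refl

  word : ∀ {k} → Subset (k ℕ.+ suc k) → List Bool
  word {k} F = blocks (Vec.head (proj₂ (cut k F))) (proj₁ (cut k F)) (Vec.tail (proj₂ (cut k F)))

  word-++ : ∀ {k} (A : Subset k) c B → word (A ++ (c ∷ B)) ≡ blocks c A B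
  word-++ A c B = ≡.cong (λ z → blocks (Vec.head (proj₂ z)) (proj₁ z) (Vec.tail (proj₂ z))) (cut-++ A (c ∷ B))

  ∑-++ : ∀ k {n} (f : Subset (k ℕ.+ n) → Carrier) → ∑ f ≈ ∑ (λ (A : Subset k) → ∑ (λ (X : Subset n) → f (A ++ X)))
  ∑-++ zero    f = refl
  ∑-++ (suc k) f = +-cong (∑-++ k (f ∘ (false ∷_))) (∑-++ k (f ∘ (true ∷_)))

  word-⊥ : ∀ k → word {k} ⊥ ≡ replicate (suc k) false
  word-⊥ k = ≡.trans (≡.cong word (⊥-++ k)) (≡.trans (word-++ {k} ⊥ false ⊥) (go k))
    where
    ⊥-++ : ∀ k {n} → ⊥ {k ℕ.+ n} ≡ ⊥ {k} ++ ⊥ {n}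
    ⊥-++ zero    = ≡.refl
    ⊥-++ (suc k) = ≡.cong (false ∷_) (⊥-++ k)
    go : ∀ k → blocks false (⊥ {k}) (⊥ {k}) ≡ replicate (suc k) false
    go zero    = ≡.refl
    go (suc k) = ≡.cong (false ∷_) (go k)

  free-word-⊤ : ∀ k → free (word {k} ⊤) ≡ 0
  free-word-⊤ k = ≡.trans (≡.cong (free ∘ word) (⊤-++ k)) (≡.trans (≡.cong free (word-++ {k} ⊤ true ⊤)) (go k))
    where
    ⊤-++ : ∀ k {n} → ⊤ {k ℕ.+ n} ≡ ⊤ {k} ++ ⊤ {n}
    ⊤-++ zero    = ≡.refl
    ⊤-++ (suc k) = ≡.cong (true ∷_) (⊤-++ k)
    go : ∀ k → freeBlocks true (⊤ {k}) (⊤ {k}) ≡ 0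
    go zero    = ≡.refl
    go (suc k) = go k

  free-word-≤ : ∀ {k} (F : Subset (k ℕ.+ suc k)) → free (word F) ≤ suc k
  free-word-≤ {k} F = freeBlocks-≤ _ (proj₁ (cut k F)) (Vec.tail (proj₂ (cut k F)))

  free-word-mono : ∀ {k} (S U : Subset (k ℕ.+ suc k)) → free (word (S ∪ U)) ≤ free (word S)
  free-word-mono {k} S U with ++-cut k S | ++-cut k U
  ... | A , c ∷ B , ≡.refl | A′ , c′ ∷ B′ , ≡.refl
    rewrite ∪-++ A A′ (c ∷ B) (c′ ∷ B′) | word-++ A c B | word-++ (A ∪ A′) (c ∨ c′) (B ∪ B′) =
    freeBlocks-mono A B (A ∪ A′) (B ∪ B′) (imp c c′) (sub-∪ A A′) (sub-∪ B B′)
    where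
    imp : ∀ c c′ → implies c (c ∨ c′) ≡ true
    imp true  c′ = ≡.refl
    imp false c′ = ≡.refl
    sub-∪ : ∀ {n} (A A′ : Subset n) → sub A (A ∪ A′) ≡ true
    sub-∪ []          []       = ≡.refl
    sub-∪ (true ∷ A)  (_ ∷ A′) = sub-∪ A A′
    sub-∪ (false ∷ A) (_ ∷ A′) = sub-∪ A A′

  module FanMatroid (k : ℕ) (rank : Subset (k ℕ.+ suc k) → ℕ)
    (rank≡ : ∀ F → rank F ≡ suc k ∸ free (word F)) where

    rank-++ : ∀ A c B → rank (A ++ (c ∷ B)) ≡ suc k ∸ freeBlocks c A B
    rank-++ A c B = ≡.trans (rank≡ _) (≡.cong (λ w → suc k ∸ free w) (word-++ A c B))

    rank-mono : ∀ S U → rank S ≤ rank (S ∪ U)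
    rank-mono S U = ≡.subst₂ _≤_ (≡.sym (rank≡ S)) (≡.sym (rank≡ (S ∪ U))) (ℕ.∸-monoʳ-≤ (suc k) (free-word-mono S U))

    open KLUniqueness rank rank-mono (λ F → p.runKL 0 (word F)) (λ F → q.runKL 0 (word F))

    flat-++ : ∀ A c B → flat (A ++ (c ∷ B)) ≡ local c A B
    flat-++ A c B = ≡.trans (flat≡ (A ++ (c ∷ B))) (FanFlats.flat≡local k rank rank-++ A c B)

    rank-∸ : ∀ F S → rank F ∸ rank S ≡ free (word S) ∸ free (word F)
    rank-∸ F S = ≡.trans (≡.cong₂ _∸_ (rank≡ F) (rank≡ S)) (≡.trans (∸-swap (suc k) (free (word F)) (suc k ∸ free (word S)))
      (≡.cong (_∸ free (word F)) (ℕ.m∸[m∸n]≡n (free-word-≤ S))))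
      where
      ∸-swap : ∀ x y z → x ∸ y ∸ z ≡ x ∸ z ∸ y
      ∸-swap x y z = ≡.trans (ℕ.∸-+-assoc x y z) (≡.trans (≡.cong (x ∸_) (ℕ.+-comm y z)) (≡.sym (ℕ.∸-+-assoc x z y)))

    corank≡ : ∀ F → corank F ≡ free (word F)
    corank≡ F = ≡.trans (rank-∸ ⊤ F) (≡.cong (free (word F) ∸_) (free-word-⊤ k))

    -- Serves both sides of `balanced`: `ω` is `t^` for the weights (1 , t) and constantly 1 for (t
    -- , 1).
    ∑-flats-above : ∀ a b (ω : ℕ → Carrier) → (∀ n → ω n ≈ FlatSum.pow ℤ⟦t⟧ a b n) → ∀ S →
      ∑ (λ F → when (sub S F) (when (flat F) (ω (rank F ∸ rank S) * FanSum.runKL ℤ⟦t⟧ a b 0 (word F)))) ≈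
      FanSum.fanSum ℤ⟦t⟧ a b (word S) 0
    ∑-flats-above a b ω ω≈ S with ++-cut k S
    ... | A , c ∷ B , ≡.refl = trans (∑-++ k f) (trans (∑-+ (λ A′ → ∑ (λ B′ → f (A′ ++ (false ∷ B′)))) (λ A′ → ∑ (λ B′ → f (A′ ++ (true ∷ B′)))))
        (trans (+-cong (off c ≡.refl) (∑²-cong (λ A′ B′ → term true A′ B′ (sub-head c B B′))))
          (trans (flatSum-total c A B) (reflexive (≡.cong (λ w → fanSum w 0) (≡.sym (word-++ A c B)))))))
      where
      open FlatSum ℤ⟦t⟧ a b
      open FanSum ℤ⟦t⟧ a b

      f : Subset (k ℕ.+ suc k) → Carrier
      f F = when (sub (A ++ (c ∷ B)) F) (when (flat F) (ω (rank F ∸ rank (A ++ (c ∷ B))) * runKL 0 (word F)))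

      sub-head : ∀ c B B′ → sub {suc k} (c ∷ B) (true ∷ B′) ≡ sub B B′
      sub-head true  B B′ = ≡.refl
      sub-head false B B′ = ≡.refl

      term : ∀ x A′ B′ → sub (c ∷ B) (x ∷ B′) ≡ sub B B′ → f (A′ ++ (x ∷ B′)) ≈ summand x 0 (freeBlocks c A B) A B A′ B′
      term x A′ B′ s = trans (reflexive (≡.sym (when-∧ (sub (A ++ (c ∷ B)) F) (flat F) _)))
        (trans (reflexive (≡.cong (λ z → when z (ω (rank F ∸ rank (A ++ (c ∷ B))) * runKL 0 (word F))) (≡.trans (≡.cong₂ _∧_
            (≡.trans (sub-++ A A′ (c ∷ B) (x ∷ B′)) (≡.cong (sub A A′ ∧_) s)) (flat-++ A′ x B′)) (≡.sym (above≡ x A B A′ B′)))))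
          (when-cong (above x A B A′ B′) (λ _ → *-cong
            (trans (ω≈ (rank F ∸ rank (A ++ (c ∷ B)))) (reflexive (≡.cong pow (≡.trans (rank-∸ F (A ++ (c ∷ B)))
              (≡.cong₂ (λ v w → free v ∸ free w) (word-++ A c B) (word-++ A′ x B′))))))
            (reflexive (≡.cong (runKL 0) (word-++ A′ x B′))))))
        where
        F : Subset (k ℕ.+ suc k)
        F = A′ ++ (x ∷ B′)

      off : ∀ z → c ≡ z → ∑² (λ A′ B′ → f (A′ ++ (false ∷ B′))) ≈ when (not z) (flatSum false 0 (freeBlocks z A B) A B)
      off true  ≡.refl = trans (∑²-cong (λ A′ B′ → reflexive (≡.cong (λ z → when z (when (flat (A′ ++ (false ∷ B′))) (ω (rank (A′ ++ (false ∷ B′)) ∸ rank (A ++ (true ∷ B))) * runKL 0 (word (A′ ++ (false ∷ B′))))))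
        (≡.trans (sub-++ A A′ (true ∷ B) (false ∷ B′)) (∧-zeroʳ (sub A A′)))))) (∑²-zero k)
      off false ≡.refl = ∑²-cong (λ A′ B′ → term false A′ B′ ≡.refl)

    balanced : ∀ S → ∑ (λ F → when (sub S F) (when (flat F) (t^ (rank F ∸ rank S) * p.runKL 0 (word F))))
                   ≈ ∑ (λ F → when (sub S F) (when (flat F) (q.runKL 0 (word F))))
    balanced S = trans (∑-flats-above 1# τ t^ t^≈pow S) (trans (fanSum-sym ℤ⟦t⟧ 1# τ (word S))
      (trans (sym (∑-flats-above τ 1# (λ _ → 1#) 1≈pow S))
        (∑-cong (λ F → when-cong (sub S F) (λ _ → when-cong (flat F) (λ _ → *-identityˡ (q.runKL 0 (word F))))))))

    Zpoly-fan : coeff (Zpoly (matroid ⊤ rank)) ≈ p.Z (suc k)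
    Zpoly-fan = trans (Zpoly-formula balanced
        (λ F e → Bounds.runKL-hub (word F) (≡.trans (≡.sym (corank≡ F)) e))
        (λ F j 0< ≤2j → Bounds.runKLAbove 0 (word F) j (pred-< (≡.subst (0 <_) (corank≡ F) 0<) (≡.subst (_≤ j ℕ.+ j) (corank≡ F) ≤2j)))
        (λ F j 2j< → Bounds.runKLBelow 0 (word F) j (≡.subst (j ℕ.+ j <_) (corank≡ F) 2j<)))
      (trans (∑-cong (λ F → sym (trans (reflexive (≡.cong (λ z → when z (when (flat F) (t^ (rank F ∸ rank ⊥) * p.runKL 0 (word F)))) (sub-⊥ F)))
          (reflexive (≡.cong (λ r → when (flat F) (t^ (rank F ∸ r) * p.runKL 0 (word F))) rank-⊥)))))
        (trans (∑-flats-above 1# τ t^ t^≈pow ⊥)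
          (trans (reflexive (≡.cong (λ w → p.fanSum w 0) (word-⊥ k)))
            (trans (p.fanSum≈Zrun (replicate (suc k) false)) (reflexive (≡.trans (p.Zrun-replicate (suc k) 0) (≡.cong p.Z (ℕ.+-identityʳ (suc k)))))))))
      where
      pred-< : ∀ {c j} → 0 < c → c ≤ j → c ∸ 1 < j
      pred-< {suc c} _ le = le

      sub-⊥ : ∀ {n} (F : Subset n) → sub ⊥ F ≡ true
      sub-⊥ []      = ≡.refl
      sub-⊥ (_ ∷ F) = sub-⊥ F

      rank-⊥ : rank ⊥ ≡ 0
      rank-⊥ = ≡.trans (rank≡ ⊥) (≡.trans (≡.cong (λ w → suc k ∸ free w) (word-⊥ k)) (≡.trans (≡.cong (suc k ∸_) (free-replicate (suc k))) (ℕ.n∸n≡0 k)))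
        where
        free-replicate : ∀ n → free (replicate n false) ≡ n
        free-replicate zero    = ≡.refl
        free-replicate (suc n) = ≡.cong suc (free-replicate n)

  -- The edges of `fan` are indexed by the length of a list; with `m` and `end` general, matching on
  -- `e` replaces this by the index type that splits into path edges and spokes.
  ZG-fan-shape : ∀ k {m} (e : k ℕ.+ suc k ≡ m) (end : Fin m → ℕ × ℕ) →
    (∀ i → end (≡.subst Fin e (i ↑ˡ suc k)) ≡ (suc (toℕ i) , suc (suc (toℕ i)))) →
    (∀ i → end (≡.subst Fin e (k ↑ʳ i)) ≡ (0 , suc (toℕ i))) →
    coeff (ZG (record { V = suc (suc k) ; m = m ; ends = end })) ≈ p.Z (suc k)
  ZG-fan-shape k ≡.refl end end-path end-spoke = FanMatroid.Zpoly-fan k (rk (graphic G)) rank≡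
    where
    open FanComponents k end end-path end-spoke
    rank≡ : ∀ F → suc (suc k) ∸ components G F ≡ suc k ∸ free (word F)
    rank≡ F with ++-cut k F
    ... | A , c ∷ B , ≡.refl = ≡.trans (≡.cong (suc (suc k) ∸_) (components-fan A c B))
                                 (≡.cong (λ w → suc k ∸ free w) (≡.sym (word-++ A c B)))

  private
    -- Natural-number positions can be rewritten along an equation of lists, without transport of
    -- `Fin`.
    nth : {X : Set} → List X → ℕ → Maybe X
    nth []       _       = nothing
    nth (x ∷ xs) zero    = just x
    nth (x ∷ xs) (suc i) = nth xs i

    nth-lookup : {X : Set} (xs : List X) (i : Fin (length xs)) → nth xs (toℕ i) ≡ just (List.lookup xs i)
    nth-lookup (x ∷ xs) zero    = ≡.refl
    nth-lookup (x ∷ xs) (suc i) = nth-lookup xs i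

    nth-applyUpTo : {X : Set} (f : ℕ → X) (k : ℕ) (ys : List X) → ∀ i → i < k → nth (applyUpTo f k List.++ ys) i ≡ just (f i)
    nth-applyUpTo f (suc k) ys zero    _         = ≡.refl
    nth-applyUpTo f (suc k) ys (suc i) (s≤s i<k) = nth-applyUpTo (f ∘ suc) k ys i i<k

    nth-applyUpTo-+ : {X : Set} (f : ℕ → X) (k : ℕ) (ys : List X) → ∀ i → nth (applyUpTo f k List.++ ys) (k ℕ.+ i) ≡ nth ys i
    nth-applyUpTo-+ f zero    ys i = ≡.refl
    nth-applyUpTo-+ f (suc k) ys i = nth-applyUpTo-+ (f ∘ suc) k ys i

    toℕ-subst : ∀ {m n} (e : m ≡ n) (i : Fin m) → toℕ (≡.subst Fin e i) ≡ toℕ i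
    toℕ-subst ≡.refl i = ≡.refl

    lookup-nth : {X : Set} (xs : List X) (i : Fin (length xs)) {j : ℕ} {x : X} → toℕ i ≡ j → nth xs j ≡ just x → List.lookup xs i ≡ x
    lookup-nth xs i ≡.refl e = just-injective (≡.trans (≡.sym (nth-lookup xs i)) e)

  ZG-fan : ∀ n → coeff (ZG (fan n)) ≈ p.Z n
  -- F_0 has no first spoke, so the encoding of edge sets does not cover it; it is evaluated
  -- directly.
  ZG-fan zero zero    = ≡.refl
  ZG-fan zero (suc j) = ≡.refl
  ZG-fan (suc k) = ZG-fan-shape k len (List.lookup edges) end-path end-spoke
    where
    path spoke : ℕ → ℕ × ℕ
    path i = suc i , suc (suc i)
    spoke i = 0 , suc i

    edges : List (ℕ × ℕ)
    edges = fanEdges (suc k)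

    edges≡ : edges ≡ applyUpTo path k List.++ applyUpTo spoke (suc k)
    edges≡ = ≡.cong₂ List._++_ (map-upTo path k) (map-upTo spoke (suc k))

    len : k ℕ.+ suc k ≡ length edges
    len = ≡.sym (≡.trans (length-++ (List.map path (upTo k))) (≡.cong₂ ℕ._+_
      (≡.trans (length-map path (upTo k)) (length-upTo k))
      (≡.trans (length-map spoke (upTo (suc k))) (length-upTo (suc k)))))

    end-path : ∀ i → List.lookup edges (≡.subst Fin len (i ↑ˡ suc k)) ≡ path (toℕ i)
    end-path i = lookup-nth edges _ (≡.trans (toℕ-subst len (i ↑ˡ suc k)) (toℕ-↑ˡ i (suc k)))
      (≡.trans (≡.cong (λ es → nth es (toℕ i)) edges≡) (nth-applyUpTo path k (applyUpTo spoke (suc k)) (toℕ i) (toℕ<n i)))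

    end-spoke : ∀ i → List.lookup edges (≡.subst Fin len (k ↑ʳ i)) ≡ spoke (toℕ i)
    end-spoke i = lookup-nth edges _ (≡.trans (toℕ-subst len (k ↑ʳ i)) (toℕ-↑ʳ k i))
      (≡.trans (≡.cong (λ es → nth es (k ℕ.+ toℕ i)) edges≡) (≡.trans (nth-applyUpTo-+ path k (applyUpTo spoke (suc k)) (toℕ i))
        (≡.trans (≡.cong (λ es → nth es (toℕ i)) (≡.sym (++-identityʳ (applyUpTo spoke (suc k))))) (nth-applyUpTo spoke (suc k) [] (toℕ i) (toℕ<n i)))))

-- The quadratic equation and its discriminant

-- Z is the root of c Z² − (1 − β) Z + 1, and √disc = 1 − β − 2 c Z.
module Quadratic (R : Ring) where
  open CommutativeRing R
  open import Relation.Binary.Reasoning.Setoid setoid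
  open import Algebra.Properties.Group +-group using () renaming (∙-cancelʳ to +-cancelʳ)
  open import Algebra.Solver.Ring.NaturalCoefficients.Default commutativeSemiring using (solve; _:=_; _:+_; _:*_) renaming (con to :con)

  -- The solver works in semirings. Identities with differences are proved after adding the
  -- subtracted terms to both sides, and `+-cancelʳ` removes them.
  x-y+y≈x : ∀ x y → x - y + y ≈ x
  x-y+y≈x x y = trans (+-assoc _ _ _) (trans (+-congˡ (-‿inverseˡ y)) (+-identityʳ x))

  module _ (Z β c : Carrier) (root : Z ≈ 1# + β * Z + c * (Z * Z)) where
    private
      b : Carrier
      b = 1# - β

      bZ : b * Z ≈ 1# + c * (Z * Z)
      bZ = +-cancelʳ (β * Z) _ _ (begin
        b * Z + β * Z           ≈⟨ sym (distribʳ Z b β) ⟩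
        (b + β) * Z             ≈⟨ *-congʳ (x-y+y≈x 1# β) ⟩
        1# * Z                  ≈⟨ *-identityˡ Z ⟩
        Z                       ≈⟨ root ⟩
        1# + β * Z + c * (Z * Z) ≈⟨ solve 3 (λ o x y → o :+ x :+ y := o :+ y :+ x) refl _ _ _ ⟩
        1# + c * (Z * Z) + β * Z ∎)

    √disc : Carrier
    √disc = 1# - β - (c + c) * Z

    private
      √disc+ : √disc + (c + c) * Z ≈ b
      √disc+ = x-y+y≈x b _

    -- Completing the square: with e = 2cZ one has s + e = b and 4c (1 + c Z²) = 4c b Z = 2 b e, so
    -- s² + 4c + e² = s² + 2 (s + e) e = b² + e².
    √disc² : √disc * √disc ≈ b * b - (c + c + c + c)
    √disc² = +-cancelʳ d _ _ (trans (+-cancelʳ (e * e) _ _ (begin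
      s * s + d + e * e
        ≈⟨ solve 3 (λ s c z → s :* s :+ (c :+ c :+ c :+ c) :+ (c :+ c) :* z :* ((c :+ c) :* z) :=
                     s :* s :+ (c :+ c :+ c :+ c) :* (:con 1 :+ c :* (z :* z))) refl s c Z ⟩
      s * s + d * (1# + c * (Z * Z))
        ≈⟨ +-congˡ (*-congˡ (sym bZ)) ⟩
      s * s + d * (b * Z)
        ≈⟨ +-congˡ (*-congˡ (*-congʳ (sym √disc+))) ⟩
      s * s + d * ((s + e) * Z)
        ≈⟨ solve 3 (λ s c z → s :* s :+ (c :+ c :+ c :+ c) :* ((s :+ (c :+ c) :* z) :* z) :=
                     (s :+ (c :+ c) :* z) :* (s :+ (c :+ c) :* z) :+ (c :+ c) :* z :* ((c :+ c) :* z)) refl s c Z ⟩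
      (s + e) * (s + e) + e * e
        ≈⟨ +-congʳ (*-cong √disc+ √disc+) ⟩
      b * b + e * e ∎)) (sym (x-y+y≈x (b * b) d)))
      where
      s d e : Carrier
      s = √disc
      d = c + c + c + c
      e = (c + c) * Z

    -- √disc + b = 2b - 2cZ, and bZ - cZ² = 1.
    Z*denominator : Z * (√disc + b) ≈ 1# + 1#
    Z*denominator = +-cancelʳ ((c + c) * (Z * Z)) _ _ (begin
      Z * (√disc + b) + (c + c) * (Z * Z)
        ≈⟨ solve 4 (λ z s b c → z :* (s :+ b) :+ (c :+ c) :* (z :* z) := (s :+ (c :+ c) :* z) :* z :+ b :* z) refl Z √disc b c ⟩
      (√disc + (c + c) * Z) * Z + b * Z
        ≈⟨ +-cong (trans (*-congʳ √disc+) bZ) bZ ⟩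
      1# + c * (Z * Z) + (1# + c * (Z * Z))
        ≈⟨ solve 4 (λ o c z w → o :+ c :* w :+ (o :+ c :* w) := o :+ o :+ (c :+ c) :* w) refl 1# c Z (Z * Z) ⟩
      1# + 1# + (c + c) * (Z * Z) ∎)

  distrib₂ : ∀ k u v → (k + k) * u * v ≈ k * u * v + k * u * v
  distrib₂ = solve 3 (λ k u v → (k :+ k) :* u :* v := k :* u :* v :+ k :* u :* v) refl

  distrib₄ : ∀ k u v → (k + k + k + k) * u * v ≈ k * u * v + k * u * v + k * u * v + k * u * v
  distrib₄ = solve 3 (λ k u v → (k :+ k :+ k :+ k) :* u :* v := k :* u :* v :+ k :* u :* v :+ k :* u :* v :+ k :* u :* v) refl

  square-difference : ∀ x y → x * x ≈ y * y → (x - y) * (x + y) ≈ 0#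
  square-difference x y eq = +-cancelʳ (y * y) _ _ (begin
    (x - y) * (x + y) + y * y
      ≈⟨ +-congʳ (*-congˡ (+-congʳ (sym (x-y+y≈x x y)))) ⟩
    (x - y) * (x - y + y + y) + y * y
      ≈⟨ solve 2 (λ d y → d :* (d :+ y :+ y) :+ y :* y := (d :+ y) :* (d :+ y)) refl (x - y) y ⟩
    (x - y + y) * (x - y + y)
      ≈⟨ *-cong (x-y+y≈x x y) (x-y+y≈x x y) ⟩
    x * x
      ≈⟨ trans eq (sym (+-identityˡ _)) ⟩
    0# + y * y ∎)

module Cancellation (R : Ring) where
  open CommutativeRing R
  open Convolution R

  private
    conv-last : ∀ n f g → (∀ i → i < n → f i ≈ 0#) → conv n f g ≈ f n * g 0
    conv-last zero    f g f≈0 = refl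
    conv-last (suc n) f g f≈0 = trans (+-cong (trans (*-congʳ (f≈0 0 (s≤s z≤n))) (zeroˡ _))
                                              (conv-last n (f ∘ suc) g (λ i i<n → f≈0 (suc i) (s≤s i<n))))
                                      (+-identityˡ _)

  -- If all earlier coefficients of f vanish, coefficient n of the product is f n * g 0; regularity
  -- of g 0 suffices where it is not a unit.
  conv-cancelʳ : ∀ {f g} → (∀ x → x * g 0 ≈ 0# → x ≈ 0#) → (∀ n → conv n f g ≈ 0#) → ∀ n → f n ≈ 0#
  conv-cancelʳ {f} {g} regular fg≈0 n = below (suc n) n ℕ.≤-refl
    where
    below : ∀ n i → i < n → f i ≈ 0#
    below (suc n) i (s≤s i≤n) = regular (f i) (trans (sym (conv-last i f g (λ j j<i → below n j (ℕ.<-≤-trans j<i i≤n)))) (fg≈0 i))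

-- The generating function in u

ℤ⟦t⟧⟦u⟧ : Ring
ℤ⟦t⟧⟦u⟧ = powerSeries ℤ⟦t⟧

module _ where
  open CommutativeRing ℤ⟦t⟧⟦u⟧
  open Convolution ℤ⟦t⟧ using (conv; conv-cong; const; conv-constˡ)
  open import Algebra.Properties.Group +-group using () renaming (x∙y⁻¹≈ε⇒x≈y to x-y≈0⇒x≈y)
  open import Algebra.Properties.CommutativeSemigroup *-commutativeSemigroup using (xy∙z≈y∙xz)
  private
    module R = CommutativeRing ℤ⟦t⟧
    module p = FanSum ℤ⟦t⟧ R.1# τ

  ⟦_⟧ : Series → Carrier
  ⟦ A ⟧ n = coeff (A n)

  ⟦+⟧ : ∀ A B → ⟦ A +S B ⟧ ≈ ⟦ A ⟧ + ⟦ B ⟧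
  ⟦+⟧ A B n = coeff-+ (A n) (B n)

  ⟦-⟧ : ∀ A B → ⟦ A -S B ⟧ ≈ ⟦ A ⟧ - ⟦ B ⟧
  ⟦-⟧ A B n k = ≡.trans (coeff-+ (A n) (negP (B n)) k) (≡.cong (λ z → coeff (A n) k ℤ.+ z) (coeff-neg (B n) k))

  ⟦*⟧ : ∀ A B → ⟦ A *S B ⟧ ≈ ⟦ A ⟧ * ⟦ B ⟧
  ⟦*⟧ A B n = R.trans (R.reflexive (≡.cong (coeff ∘ sumP) (map-upTo (λ i → A i *P B (n ∸ i)) (suc n)))) (go n A)
    where
    go : ∀ n A → coeff (sumP (applyUpTo (λ i → A i *P B (n ∸ i)) (suc n))) R.≈ conv n ⟦ A ⟧ ⟦ B ⟧
    go zero    A k = ≡.trans (coeff-+ (A 0 *P B 0) [] k) (≡.trans (ℤ.+-identityʳ _) (coeff-* (A 0) (B 0) k))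
    go (suc n) A k = ≡.trans (coeff-+ (A 0 *P B (suc n)) _ k)
                       (≡.cong₂ ℤ._+_ (coeff-* (A 0) (B (suc n)) k) (go n (A ∘ suc) k))

  ⟦const⟧ : ∀ p → ⟦ constS p ⟧ ≈ const (coeff p)
  ⟦const⟧ p zero    k = ≡.refl
  ⟦const⟧ p (suc n) k = ≡.refl

  ⟦one⟧ : ⟦ constS oneP ⟧ ≈ 1#
  ⟦one⟧ zero    = coeff-oneP
  ⟦one⟧ (suc n) = λ _ → ≡.refl

  U κ β c : Carrier
  U = ⟦ uS ⟧
  κ = const τ
  β = ⟦ constS (tP +P oneP) ⟧ * U
  c = κ * U * U

  U*-zero : ∀ f → (U * f) 0 R.≈ R.0#
  U*-zero f = R.zeroˡ (f 0)

  U*-suc : ∀ f n → (U * f) (suc n) R.≈ f n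
  U*-suc f n = R.trans (R.+-cong (R.zeroˡ (f (suc n)))
                 (R.trans (conv-cong n tail (λ i → R.refl {f i})) (R.trans (conv-constˡ n R.1# f) (R.*-identityˡ (f n)))))
               (R.+-identityˡ (f n))
    where
    tail : ∀ i → U (suc i) R.≈ const R.1# i
    tail zero    = coeff-oneP
    tail (suc i) = R.refl

  root : p.Z ≈ 1# + β * p.Z + c * (p.Z * p.Z)
  root n = R.trans (coefficient n) (sym rearranged n)
    where
    -- The factors `U` are moved to the front, where `U*-zero` and `U*-suc` read off coefficients.
    rearranged : 1# + β * p.Z + c * (p.Z * p.Z) ≈
                 1# + U * (⟦ constS (tP +P oneP) ⟧ * p.Z) + U * (U * (κ * (p.Z * p.Z)))
    rearranged = +-cong (+-congˡ {1#} (xy∙z≈y∙xz ⟦ constS (tP +P oneP) ⟧ U p.Z))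
      (trans (xy∙z≈y∙xz (κ * U) U (p.Z * p.Z)) (*-congˡ {U} (xy∙z≈y∙xz κ U (p.Z * p.Z))))

    level : ∀ n → (⟦ constS (tP +P oneP) ⟧ * p.Z) n R.≈ (R.1# R.+ τ) R.* p.Z n
    level n = R.trans (*-congʳ {p.Z} (⟦const⟧ (tP +P oneP)) n) (R.trans (conv-constˡ n (coeff (tP +P oneP)) p.Z)
      (R.*-congʳ {p.Z n} (R.trans (coeff-+ tP oneP) (R.trans (R.+-congˡ {τ} coeff-oneP) (R.+-comm τ R.1#)))))

    coefficient : ∀ n → p.Z n R.≈ (1# + U * (⟦ constS (tP +P oneP) ⟧ * p.Z) + U * (U * (κ * (p.Z * p.Z)))) n
    coefficient zero = R.sym (R.trans (R.+-cong (R.trans (R.+-congˡ {R.1#} (U*-zero (⟦ constS (tP +P oneP) ⟧ * p.Z))) (R.+-identityʳ R.1#))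
      (U*-zero (U * (κ * (p.Z * p.Z))))) (R.+-identityʳ R.1#))
    coefficient (suc n) = R.trans (p.Z-suc n) (R.sym (R.+-cong
      (R.trans (R.+-identityˡ _) (R.trans (U*-suc (⟦ constS (tP +P oneP) ⟧ * p.Z) n) (level n)))
      (R.trans (U*-suc (U * (κ * (p.Z * p.Z))) n) (quadratic n))))
      where
      quadratic : ∀ n → (U * (κ * (p.Z * p.Z))) n R.≈ R.1# R.* τ R.* p.Zpairs [] n
      quadratic zero    = R.trans (U*-zero (κ * (p.Z * p.Z))) (R.sym (R.zeroʳ (R.1# R.* τ)))
      quadratic (suc n) = R.trans (U*-suc (κ * (p.Z * p.Z)) n) (R.trans (conv-constˡ n τ (p.Z * p.Z))
        (R.*-congʳ {(p.Z * p.Z) n} (R.sym (R.*-identityˡ τ))))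

  open Quadratic ℤ⟦t⟧⟦u⟧

  ⟦β⟧ : ⟦ constS (tP +P oneP) *S uS ⟧ ≈ β
  ⟦β⟧ = ⟦*⟧ (constS (tP +P oneP)) uS

  ⟦Z⟧ : ⟦ ZfanGF ⟧ ≈ p.Z
  ⟦Z⟧ = ZG-fan

  private
    multiple : ∀ A (k : Carrier) → ⟦ A ⟧ ≈ k → ⟦ A *S uS *S uS ⟧ ≈ k * U * U
    multiple A k e = trans (⟦*⟧ (A *S uS) uS) (*-congʳ {U} (trans (⟦*⟧ A uS) (*-congʳ {U} e)))

    ⟦4t⟧ : ⟦ constS (constP (+ 4) *P tP) ⟧ ≈ κ + κ + κ + κ
    ⟦4t⟧ zero    zero          = ≡.refl
    ⟦4t⟧ zero    (suc zero)    = ≡.refl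
    ⟦4t⟧ zero    (suc (suc k)) = ≡.refl
    ⟦4t⟧ (suc n) k             = ≡.refl

    ⟦2t⟧ : ⟦ constS (constP (+ 2) *P tP) ⟧ ≈ κ + κ
    ⟦2t⟧ zero    zero          = ≡.refl
    ⟦2t⟧ zero    (suc zero)    = ≡.refl
    ⟦2t⟧ zero    (suc (suc k)) = ≡.refl
    ⟦2t⟧ (suc n) k             = ≡.refl

    ⟦2⟧ : 1# + 1# ≈ ⟦ constS (constP (+ 2)) ⟧
    ⟦2⟧ zero    zero    = ≡.refl
    ⟦2⟧ zero    (suc k) = ≡.refl
    ⟦2⟧ (suc n) k       = ≡.refl

  ⟦1-β⟧ : ⟦ constS oneP -S constS (tP +P oneP) *S uS ⟧ ≈ 1# - β
  ⟦1-β⟧ = trans (⟦-⟧ (constS oneP) (constS (tP +P oneP) *S uS)) (+-cong ⟦one⟧ (-‿cong ⟦β⟧))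

  ⟦disc⟧ : ⟦ discS ⟧ ≈ (1# - β) * (1# - β) - (c + c + c + c)
  ⟦disc⟧ = trans (⟦-⟧ (B *S B) D) (+-cong (trans (⟦*⟧ B B) (*-cong ⟦1-β⟧ ⟦1-β⟧))
             (-‿cong (trans (multiple (constS (constP (+ 4) *P tP)) (κ + κ + κ + κ) ⟦4t⟧) (distrib₄ κ U U))))
    where
    B D : Series
    B = constS oneP -S constS (tP +P oneP) *S uS
    D = constS (constP (+ 4) *P tP) *S uS *S uS

  -- The square root must have polynomial coefficients, whereas `s` lives over ℤ[[t]]; it is rebuilt
  -- here from operations on lists.
  root-series : Series
  root-series = constS oneP -S constS (tP +P oneP) *S uS -S constS (constP (+ 2) *P tP) *S uS *S uS *S ZfanGF

  s : Carrier
  s = √disc p.Z β c root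

  ⟦root-series⟧ : ⟦ root-series ⟧ ≈ s
  ⟦root-series⟧ = trans (⟦-⟧ (constS oneP -S constS (tP +P oneP) *S uS) (C *S ZfanGF))
    (+-cong ⟦1-β⟧ (-‿cong (trans (⟦*⟧ C ZfanGF)
      (*-cong (trans (multiple (constS (constP (+ 2) *P tP)) (κ + κ) ⟦2t⟧) (distrib₂ κ U U)) ⟦Z⟧))))
    where
    C : Series
    C = constS (constP (+ 2) *P tP) *S uS *S uS

  s-constant : s 0 R.≈ R.1#
  s-constant = R.trans (R.+-cong (R.trans (R.+-congˡ {R.1#} (R.-‿cong β₀)) (R.trans (R.+-congˡ {R.1#} -0≈0) (R.+-identityʳ R.1#)))
                  (R.trans (R.-‿cong cZ₀) -0≈0)) (R.+-identityʳ R.1#)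
    where
    -0≈0 : R.- R.0# R.≈ R.0#
    -0≈0 _ = ≡.refl

    β₀ : β 0 R.≈ R.0#
    β₀ = R.zeroʳ (⟦ constS (tP +P oneP) ⟧ 0)

    c₀ : c 0 R.≈ R.0#
    c₀ = R.zeroʳ ((κ * U) 0)

    cZ₀ : ((c + c) * p.Z) 0 R.≈ R.0#
    cZ₀ = R.trans (R.*-congʳ {p.Z 0} (R.trans (R.+-cong c₀ c₀) (R.+-identityˡ R.0#))) (R.zeroˡ (p.Z 0))

  -- (S - s)(S + s) = 0, and S + s has constant term 2 because both roots start with 1; 2 is regular
  -- in ℤ[[t]].
  √disc-unique : ∀ S → S 0 ≈P oneP → S *S S ≈S discS → ⟦ S ⟧ ≈ s
  √disc-unique S S₀ S² = x-y≈0⇒x≈y ⟦ S ⟧ s (Cancellation.conv-cancelʳ ℤ⟦t⟧ {⟦ S ⟧ - s} {⟦ S ⟧ + s} regular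
    (square-difference ⟦ S ⟧ s (trans (sym (⟦*⟧ S S)) (trans S² (trans ⟦disc⟧ (sym (√disc² p.Z β c root)))))))
    where
    i+i≡0 : ∀ i → i ℤ.+ i ≡ + 0 → i ≡ + 0
    i+i≡0 (+ zero)  _ = ≡.refl

    regular : ∀ x → x R.* (⟦ S ⟧ 0 R.+ s 0) R.≈ R.0# → x R.≈ R.0#
    regular x e k = i+i≡0 (x k) (≡.trans (R.sym (R.trans (R.*-congˡ {x} (R.+-cong (R.trans S₀ coeff-oneP) s-constant))
      (R.trans (R.distribˡ x R.1# R.1#) (R.+-cong (R.*-identityʳ x) (R.*-identityʳ x)))) k) (e k))

  existence : Σ[ S ∈ Series ] (S 0 ≈P oneP × S *S S ≈S discS)
  existence = root-series
    , R.trans (⟦root-series⟧ 0) (R.trans s-constant (R.sym coeff-oneP))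
    , trans (⟦*⟧ root-series root-series) (trans (*-cong ⟦root-series⟧ ⟦root-series⟧)
        (trans (√disc² p.Z β c root) (sym ⟦disc⟧)))

  generating-function : (S : Series) → S 0 ≈P oneP → S *S S ≈S discS →
    ZfanGF *S (S -S constS (tP +P oneP) *S uS +S constS oneP) ≈S constS (constP (+ 2))
  generating-function S S₀ S² =
    trans (⟦*⟧ ZfanGF (S -S constS (tP +P oneP) *S uS +S constS oneP))
   (trans (*-cong ⟦Z⟧ (trans (⟦+⟧ (S -S constS (tP +P oneP) *S uS) (constS oneP))
            (+-cong (trans (⟦-⟧ S (constS (tP +P oneP) *S uS)) (+-cong (√disc-unique S S₀ S²) (-‿cong ⟦β⟧))) ⟦one⟧)))
   (trans (*-congˡ {p.Z} (x∙y∙z≈x∙zy s (- β) 1#))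
   (trans (Z*denominator p.Z β c root) ⟦2⟧)))
    where
    x∙y∙z≈x∙zy : ∀ x y z → x + y + z ≈ x + (z + y)
    x∙y∙z≈x∙zy x y z = trans (+-assoc x y z) (+-congˡ {x} (+-comm y z))

theorem6p1 : (Σ[ S ∈ Series ] (S 0 ≈P oneP × S *S S ≈S discS))
    × ((S : Series) → S 0 ≈P oneP → S *S S ≈S discS →
    ZfanGF *S (S -S constS (tP +P oneP) *S uS +S constS oneP) ≈S constS (constP (+ 2)))
theorem6p1 = existence , generating-function
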